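{- Let $(\mathcal G,z)$ be a canvas such that $\deg(A)\ge 4+|\tau(A)|$ for every non-empty $A\subsetneq V(\mathcal G)\setminus\{z\}$. If there exists a vertex $x\in V(\mathcal G)\setminus\{z\}$ such that $\deg(X)>\deg(z)-2$ for every $X\subseteq V(\mathcal G)\setminus\{z\}$ containing $x$, then every tip preflow extends to a nowhere-zero flow in $\mathcal G$.
   Context: Graphs are finite, loopless, and may have parallel edges. A $\mathbb{Z}_3$-boundary of a graph $G$ is a map $\beta:V(G)\to\mathbb{Z}_3$ with $\sum_{v\in V(C)}\beta(v)=0$ for every component $C$ of $G$; $\mathcal G=(G,\beta)$ is then a $\mathbb{Z}_3$-bordered graph. A nowhere-zero flow in $(G,\beta)$ is an orientation of $G$ with $\deg^+(v)-\deg^-(v)\equiv\beta(v)\pmod 3$ for every $v$. For $A\subseteq V(G)$, $\deg(A)$ is the number of edges with exactly one end in $A$, $\beta(A)=\sum_{v\in A}\beta(v)$, and $|\tau(A)|$ equals $0$ if $\deg(A)$ is even and $\beta(A)=0$; $2$ if $\deg(A)$ is even and $\beta(A)\neq 0$; $3$ if $\deg(A)$ is odd and $\beta(A)=0$; $1$ if $\deg(A)$ is odd and $\beta(A)\neq 0$. A canvas $(\mathcal G,z)$ is a $\mathbb{Z}_3$-bordered graph with a distinguished vertex $z$. A tip preflow is an orientation $\psi$ of the edges incident with $z$ such that (counting in $\psi$) $\deg^+(z)-\deg^-(z)\equiv \beta(z)\pmod 3$; it extends to a nowhere-zero flow in $\mathcal G$ if some nowhere-zero flow agrees with $\psi$ on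 all edges incident with $z$. -}

module Defs where

open import Data.Nat using (ℕ; zero; suc; _+_; _*_; _%_)
open import Data.Nat.Properties using ()
open import Data.Fin using (Fin; zero; suc; toℕ)
open import Data.Fin.Subset using (Subset; _∈_; _∉_)
open import Data.Vec using (lookup)
open import Data.Bool using (Bool; true; false; if_then_else_; _xor_; not)
open import Data.Sum using (_⊎_)
open import Data.Product using (_×_; _,_; proj₁; proj₂; ∃; ∃-syntax)
open import Relation.Binary.PropositionalEquality using (_≡_; _≢_)

sumFin : (k : ℕ) → (Fin k → ℕ) → ℕ
sumFin zero f = 0
sumFin (suc k) f = f zero + sumFin k (λ i → f (suc i))

count : (k : ℕ) → (Fin k → Bool) → ℕ
count k p = sumFin k (λ i → if p i then 1 else 0)

-- A finite loopless multigraph: vertices Fin n, edges Fin m; edge e has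
-- (reference) ends (proj₁ (ends e), proj₂ (ends e)), which are distinct.
record Graph : Set where
  field
    n : ℕ
    m : ℕ
    ends : Fin m → Fin n × Fin n
    loopless : ∀ e → proj₁ (ends e) ≢ proj₂ (ends e)
open Graph public

V : Graph → Set
V G = Fin (n G)

E : Graph → Set
E G = Fin (m G)

Z3 : Set
Z3 = Fin 3

_≟ᵇ_ : {k : ℕ} → Fin k → Fin k → Bool
zero ≟ᵇ zero = true
zero ≟ᵇ suc _ = false
suc _ ≟ᵇ zero = false
suc i ≟ᵇ suc j = i ≟ᵇ j

incidentᵇ : (G : Graph) → V G → E G → Bool
incidentᵇ G v e = (proj₁ (ends G e) ≟ᵇ v) Data.Bool.∨ (proj₂ (ends G e) ≟ᵇ v)

inᵇ : {k : ℕ} → Subset k → Fin k → Bool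
inᵇ A v = lookup A v

deg : (G : Graph) → Subset (n G) → ℕ
deg G A = count (m G) (λ e → inᵇ A (proj₁ (ends G e)) xor inᵇ A (proj₂ (ends G e)))

-- degree of a single vertex (= number of incident edges; graph is loopless)
degV : (G : Graph) → V G → ℕ
degV G v = count (m G) (incidentᵇ G v)

-- β(A) as a natural number, to be read mod 3
βsum : (G : Graph) → (V G → Z3) → Subset (n G) → ℕ
βsum G β A = sumFin (n G) (λ v → if inᵇ A v then toℕ (β v) else 0)

tauAbs : (G : Graph) → (V G → Z3) → Subset (n G) → ℕ
tauAbs G β A with deg G A % 2 | βsum G β A % 3
... | zero  | zero  = 0
... | zero  | suc _ = 2
... | suc _ | zero  = 3
... | suc _ | suc _ = 1

data Connected (G : Graph) : V G → V G → Set where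
  here : ∀ {v} → Connected G v v
  step : ∀ {u w} (e : E G) →
         ((proj₁ (ends G e) ≡ u × proj₂ (ends G e) ≡ w) ⊎
          (proj₂ (ends G e) ≡ u × proj₁ (ends G e) ≡ w)) →
         ∀ {v} → Connected G w v → Connected G u v

IsComponent : (G : Graph) → Subset (n G) → Set
IsComponent G C =
  (∃[ v ] v ∈ C) × (deg G C ≡ 0) × (∀ u v → u ∈ C → v ∈ C → Connected G u v)

IsBoundary : (G : Graph) → (V G → Z3) → Set
IsBoundary G β = ∀ C → IsComponent G C → βsum G β C % 3 ≡ 0

-- An orientation: true = edge directed from proj₁ (ends e) to proj₂ (ends e),
-- false = reverse direction.
Orientation : Graph → Set
Orientation G = E G → Bool

tailᵇ : (G : Graph) → Orientation G → V G → E G → Bool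
tailᵇ G o v e = if o e then proj₁ (ends G e) ≟ᵇ v else proj₂ (ends G e) ≟ᵇ v

headᵇ : (G : Graph) → Orientation G → V G → E G → Bool
headᵇ G o v e = if o e then proj₂ (ends G e) ≟ᵇ v else proj₁ (ends G e) ≟ᵇ v

outdeg indeg : (G : Graph) → Orientation G → V G → ℕ
outdeg G o v = count (m G) (tailᵇ G o v)
indeg G o v = count (m G) (headᵇ G o v)

-- deg⁺(v) − deg⁻(v) ≡ β(v) (mod 3), written as deg⁺ + 2·deg⁻ ≡ β (mod 3)
FlowAt : (G : Graph) → (V G → Z3) → Orientation G → V G → Set
FlowAt G β o v = (outdeg G o v + 2 * indeg G o v) % 3 ≡ toℕ (β v)

NowhereZeroFlow : (G : Graph) → (V G → Z3) → Orientation G → Set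
NowhereZeroFlow G β o = ∀ v → FlowAt G β o v

-- A tip preflow at z: an orientation ψ of the edges incident with z
-- (values of ψ on non-incident edges are irrelevant) satisfying the
-- boundary condition at z.
IsTipPreflow : (G : Graph) → (V G → Z3) → V G → Orientation G → Set
IsTipPreflow G β z ψ = FlowAt G β ψ z

Extends : (G : Graph) → (V G → Z3) → V G → Orientation G → Set
Extends G β z ψ = ∃[ o ] (NowhereZeroFlow G β o ×
                          (∀ e → incidentᵇ G z e ≡ true → o e ≡ ψ e))

module Submission where

open import Defs using (Z3)
open import Algebra.Properties.CommutativeSemigroup using (interchange)
open import Data.Bool using (Bool; true; false; not; _∧_; _∨_; _xor_; if_then_else_; T)
import Data.Bool.Properties as Bool
open import Data.Empty using (⊥; ⊥-elim)
open import Data.Fin using (Fin; zero; suc; toℕ; _≟_)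
open import Data.Fin.Properties using (all?; any?; toℕ-injective)
open import Data.Fin.Subset using (Subset; _∈_; _∉_)
open import Data.List using (List; []; _∷_; _++_; map; length; allFin) renaming (tabulate to tabulateₗ)
open import Data.List.Membership.Propositional using () renaming (_∈_ to _∈ₗ_)
open import Data.List.Membership.Propositional.Properties using (∈-allFin; ∈-map⁺)
open import Data.List.Properties using (length-map; length-++)
open import Data.List.Relation.Unary.All using (All; []; _∷_)
open import Data.List.Relation.Unary.Any using (here; there)
open import Data.Nat hiding (_≟_)
import Data.Nat as ℕ
open import Data.Nat.DivMod using (%-distribˡ-+; [m+n]%n≡m%n)
open import Data.Nat.Properties hiding (_≟_)
open import Data.Product using (_×_; _,_; proj₁; proj₂; Σ; ∃; ∃-syntax)
open import Data.Sum using (_⊎_; inj₁; inj₂)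
open import Data.Unit using (⊤; tt)
open import Data.Vec using (tabulate; lookup)
open import Data.Vec.Properties using (lookup∘tabulate; lookup⇒[]=; []=⇒lookup)
open import Function using (Equivalence; _∘_; case_of_)
open import Relation.Binary.PropositionalEquality
open import Relation.Nullary using (¬_; Dec; yes; no; does)
open import Relation.Nullary.Decidable using (True; from-yes; map′; toWitness; dec-true; dec-false; ¬?; _×-dec_; _→-dec_)

-- Delete the tip and orient its edges as prescribed: what remains is a graph with a boundary, and
-- the tip edges serve only as a certificate for the degree conditions, so they may be replaced by
-- any other tip edges satisfying these conditions.  Consider a smallest canvas without a flow,
-- where instead of the existence of x we also allow deg(z) ≤ 4 + |τ(z)| (the theorem of Lovász,
-- Thomassen, Wu and Zhang).  Contracting a set A and then solving A with its complement as the tip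
-- gives deg(A) ≥ 6 + |τ(A)| for all non-trivial A, and deg(A) > deg(z) if x lies in A.  It follows
-- that there are no parallel edges and, by lifting pairs of edges, that every vertex other than x
-- has degree exactly 4 + |τ| with τ ≠ 0.  For such a vertex |τ| decreases when an edge of a suitable
-- direction is deleted; an edge whose ends prefer opposite directions at the respective end can
-- be deleted, and a tip edge never has the preferred direction.  If deg(x) ≥ deg(z), or deg(z) ≤ 4,
-- one end of some edge can be moved to the tip.  Otherwise all preferences agree outside x.  In the
-- case deg(z) ≤ 4 + |τ(z)| this forces deg(z) ≤ 5, and a tip edge can be replaced by two tip edges of
-- the opposite direction; the same works if deg(z) = 6.  In the remaining case deg(z) = deg(x) + 1 ≥ 7,
-- all non-trivial sets have degree at least 8, so that at a neighbour of z of degree 6 a tip edge can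
-- be reversed, and a vertex of degree 5 can be deleted with all its edges in the same direction.

-- Linear arithmetic over ℕ by bounded search for a Farkas certificate

-- In a flow, deg⁺ - deg⁻ of a set has the parity of the degree and equals the boundary modulo 3.
-- Both together fix it modulo 6, and |τ| is its least possible absolute value. These residues add
-- up over disjoint sets, and one edge moves them by 1 or -1. So a degree above 4 + |τ| is at least
-- 6 + |τ|. This slack of two pays for deleting an edge of any direction, where |τ| grows by at most
-- one, and for lifting a pair, where |τ| is unchanged. A vertex without slack can lose an edge in a
-- preferred direction only; hence the bookkeeping of preferences. The second mode is forced by the
-- induction: a set of degree exactly 4 + |τ|, solved by itself, gets a tip of that degree, but need
-- not contain a vertex that can play the role of x. Conversely, for deg(z) = 6 the last reduction
-- leaves the mode with x and lands in that of a small tip.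

infixl 6 _:+_
infixl 7 _:*_
infix 4 _:≤_ _:≡_
infix 2 _⊢_

data Lin : Set where
  var  : ℕ → Lin
  #_   : ℕ → Lin
  _:+_ : Lin → Lin → Lin
  _:*_ : ℕ → Lin → Lin

data Rel : Set where
  _:≤_ _:≡_ : Lin → Lin → Rel

record Sequent : Set where
  constructor _⊢_
  field
    hyps : List Rel
    goal : Rel

nth : List ℕ → ℕ → ℕ
nth []       _       = 0
nth (x ∷ xs) zero    = x
nth (x ∷ xs) (suc n) = nth xs n

⟦_⟧ : Lin → List ℕ → ℕ
⟦ var i ⟧  ρ = nth ρ i
⟦ # c ⟧    ρ = c
⟦ s :+ t ⟧ ρ = ⟦ s ⟧ ρ + ⟦ t ⟧ ρ
⟦ c :* t ⟧ ρ = c * ⟦ t ⟧ ρ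

⟦_⟧ᵣ : Rel → List ℕ → Set
⟦ s :≤ t ⟧ᵣ ρ = ⟦ s ⟧ ρ ≤ ⟦ t ⟧ ρ
⟦ s :≡ t ⟧ᵣ ρ = ⟦ s ⟧ ρ ≡ ⟦ t ⟧ ρ

-- Coefficient lists are dotted with 1 ∷ ρ, so that their head is the constant term.
Coeffs : Set
Coeffs = List ℕ

dot : Coeffs → List ℕ → ℕ
dot []       _        = 0
dot (_ ∷ _)  []       = 0
dot (c ∷ cs) (x ∷ xs) = c * x + dot cs xs

add : Coeffs → Coeffs → Coeffs
add []       ds       = ds
add (c ∷ cs) []       = c ∷ cs
add (c ∷ cs) (d ∷ ds) = (c + d) ∷ add cs ds

scale : ℕ → Coeffs → Coeffs
scale k []       = []
scale k (c ∷ cs) = (k * c) ∷ scale k cs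

unit : ℕ → Coeffs
unit zero    = 1 ∷ []
unit (suc i) = 0 ∷ unit i

norm : Lin → Coeffs
norm (var i)  = 0 ∷ unit i
norm (# c)    = c ∷ []
norm (s :+ t) = add (norm s) (norm t)
norm (c :* t) = scale c (norm t)

-- Comparing coefficients suffices because the variables range over natural numbers; a missing tail
-- counts as zeros.
leq : Coeffs → Coeffs → Bool
leq []       _        = true
leq (c ∷ cs) []       = (c ≤ᵇ 0) ∧ leq cs []
leq (c ∷ cs) (d ∷ ds) = (c ≤ᵇ d) ∧ leq cs ds

dot-add : ∀ cs ds xs → dot (add cs ds) xs ≡ dot cs xs + dot ds xs
dot-add []       ds       xs       = refl
dot-add (c ∷ cs) []       xs       = sym (+-identityʳ _)
dot-add (c ∷ cs) (d ∷ ds) []       = refl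
dot-add (c ∷ cs) (d ∷ ds) (x ∷ xs)
  rewrite dot-add cs ds xs | *-distribʳ-+ x c d =
  interchange +-commutativeSemigroup (c * x) (d * x) (dot cs xs) (dot ds xs)

dot-scale : ∀ k cs xs → dot (scale k cs) xs ≡ k * dot cs xs
dot-scale k []       xs       = sym (*-zeroʳ k)
dot-scale k (c ∷ cs) []       = sym (*-zeroʳ k)
dot-scale k (c ∷ cs) (x ∷ xs)
  rewrite dot-scale k cs xs | *-assoc k c x = sym (*-distribˡ-+ k (c * x) (dot cs xs))

dot-unit : ∀ i ρ → dot (unit i) ρ ≡ nth ρ i
dot-unit zero    []      = refl
dot-unit zero    (x ∷ ρ) = trans (+-identityʳ _) (+-identityʳ x)
dot-unit (suc i) []      = refl
dot-unit (suc i) (x ∷ ρ) = dot-unit i ρ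

dot-norm : ∀ t ρ → dot (norm t) (1 ∷ ρ) ≡ ⟦ t ⟧ ρ
dot-norm (var i)  ρ = dot-unit i ρ
dot-norm (# c)    ρ = trans (+-identityʳ _) (*-identityʳ c)
dot-norm (s :+ t) ρ
  rewrite dot-add (norm s) (norm t) (1 ∷ ρ) | dot-norm s ρ | dot-norm t ρ = refl
dot-norm (c :* t) ρ
  rewrite dot-scale c (norm t) (1 ∷ ρ) | dot-norm t ρ = refl

leq-sound : ∀ cs ds xs → T (leq cs ds) → dot cs xs ≤ dot ds xs
leq-sound []       ds       xs       p = z≤n
leq-sound (c ∷ cs) []       []       p = z≤n
leq-sound (c ∷ cs) (d ∷ ds) []       p = z≤n
leq-sound (c ∷ cs) []       (x ∷ xs) p
  with c≤0 , q ← Equivalence.to (Bool.T-∧ {c ≤ᵇ 0}) p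
  rewrite n≤0⇒n≡0 (≤ᵇ⇒≤ c 0 c≤0) = leq-sound cs [] xs q
leq-sound (c ∷ cs) (d ∷ ds) (x ∷ xs) p
  with c≤d , q ← Equivalence.to (Bool.T-∧ {c ≤ᵇ d}) p =
  +-mono-≤ (*-monoˡ-≤ x (≤ᵇ⇒≤ c d c≤d)) (leq-sound cs ds xs q)

Ineq : Set
Ineq = Coeffs × Coeffs

Holds : List ℕ → Ineq → Set
Holds xs (l , r) = dot l xs ≤ dot r xs

-- A coordinate in which X exceeds Y, the constant term being looked at last.
excess : Coeffs → Coeffs → ℕ
excess []       Y = 0
excess (_ ∷ cs) Y = go cs 1
  where
  go : Coeffs → ℕ → ℕ
  go []       i = 0
  go (c ∷ cs) i = if c ≤ᵇ nth Y i then go cs (suc i) else i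

-- X ≤ Y follows from X + r ≤ Y + l when l ≤ r is a hypothesis; only hypotheses that
-- improve the exceeding coordinate are tried.
mutual
  search : ℕ → List Ineq → Coeffs → Coeffs → Bool
  search zero       hs X Y = leq X Y
  search (suc fuel) hs X Y = if leq X Y then true else branch fuel (excess X Y) hs hs X Y

  branch : ℕ → ℕ → List Ineq → List Ineq → Coeffs → Coeffs → Bool
  branch fuel i hs []             X Y = false
  branch fuel i hs ((l , r) ∷ gs) X Y =
    if nth l i ≤ᵇ nth r i then branch fuel i hs gs X Y else
    (if search fuel hs (add X r) (add Y l) then true else branch fuel i hs gs X Y)

deepen : ℕ → ℕ → List Ineq → Coeffs → Coeffs → Bool
deepen zero    n hs X Y = search n hs X Y
deepen (suc k) n hs X Y = if search n hs X Y then true else deepen k (suc n) hs X Y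

cancel-hyp : ∀ X Y l r xs → dot l xs ≤ dot r xs →
             dot (add X r) xs ≤ dot (add Y l) xs → dot X xs ≤ dot Y xs
cancel-hyp X Y l r xs h q rewrite dot-add X r xs | dot-add Y l xs =
  +-cancelʳ-≤ _ _ _ (≤-trans q (+-monoʳ-≤ _ h))

mutual
  search-sound : ∀ n hs X Y xs → T (search n hs X Y) → All (Holds xs) hs → dot X xs ≤ dot Y xs
  search-sound zero    hs X Y xs p ps = leq-sound X Y xs p
  search-sound (suc n) hs X Y xs p ps with leq X Y in e
  ... | true  = leq-sound X Y xs (subst T (sym e) tt)
  ... | false = branch-sound n (excess X Y) hs hs X Y xs p ps ps

  branch-sound : ∀ n i hs gs X Y xs → T (branch n i hs gs X Y) →
                 All (Holds xs) hs → All (Holds xs) gs → dot X xs ≤ dot Y xs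
  branch-sound n i hs ((l , r) ∷ gs) X Y xs p ps (q ∷ qs) with nth l i ≤ᵇ nth r i
  ... | true  = branch-sound n i hs gs X Y xs p ps qs
  ... | false with search n hs (add X r) (add Y l) in e
  ...   | true  = cancel-hyp X Y l r xs q (search-sound n hs _ _ xs (subst T (sym e) tt) ps)
  ...   | false = branch-sound n i hs gs X Y xs p ps qs

deepen-sound : ∀ k n hs X Y xs → T (deepen k n hs X Y) → All (Holds xs) hs → dot X xs ≤ dot Y xs
deepen-sound zero    n hs X Y xs p ps = search-sound n hs X Y xs p ps
deepen-sound (suc k) n hs X Y xs p ps with search n hs X Y in e
... | true  = search-sound n hs X Y xs (subst T (sym e) tt) ps
... | false = deepen-sound k (suc n) hs X Y xs p ps

-- Iterative deepening tries short certificates first. Each use of a hypothesis costs one unit of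
-- fuel, so 12 bounds the sum of the multipliers.
entails : List Ineq → Coeffs → Coeffs → Bool
entails = deepen 12 0

ineqs : List Rel → List Ineq
ineqs []              = []
ineqs ((s :≤ t) ∷ rs) = (norm s , norm t) ∷ ineqs rs
ineqs ((s :≡ t) ∷ rs) = (norm s , norm t) ∷ (norm t , norm s) ∷ ineqs rs

check : Sequent → Bool
check (hs ⊢ (s :≤ t)) = entails (ineqs hs) (norm s) (norm t)
check (hs ⊢ (s :≡ t)) = entails (ineqs hs) (norm s) (norm t) ∧ entails (ineqs hs) (norm t) (norm s)

Implies : List ℕ → List Rel → Rel → Set
Implies ρ []       g = ⟦ g ⟧ᵣ ρ
Implies ρ (h ∷ hs) g = ⟦ h ⟧ᵣ ρ → Implies ρ hs g

Terms : ℕ → Set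
Terms zero    = Sequent
Terms (suc n) = Lin → Terms n

close : ℕ → (n : ℕ) → Terms n → Sequent
close i zero    f = f
close i (suc n) f = close (suc i) n (f (var i))

Forall : (n : ℕ) → (List ℕ → Set) → Set
Forall zero    P = P []
Forall (suc n) P = ∀ x → Forall n (λ ρ → P (x ∷ ρ))

intro : ∀ n {P : List ℕ → Set} → (∀ ρ → P ρ) → Forall n P
intro zero    p = p []
intro (suc n) p x = intro n (λ ρ → p (x ∷ ρ))

conclude : ∀ ρ g hs → T (check (hs ⊢ g)) → All (Holds (1 ∷ ρ)) (ineqs hs) → ⟦ g ⟧ᵣ ρ
conclude ρ (s :≤ t) hs p ps =
  subst₂ _≤_ (dot-norm s ρ) (dot-norm t ρ) (deepen-sound 12 0 (ineqs hs) (norm s) (norm t) (1 ∷ ρ) p ps)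
conclude ρ (s :≡ t) hs p ps with q , r ← Equivalence.to Bool.T-∧ p =
  ≤-antisym (conclude ρ (s :≤ t) hs q ps) (conclude ρ (t :≤ s) hs r ps)

curry : ∀ ρ hs g → (All (Holds (1 ∷ ρ)) (ineqs hs) → ⟦ g ⟧ᵣ ρ) → Implies ρ hs g
curry ρ []              g f = f []
curry ρ ((s :≤ t) ∷ hs) g f h =
  curry ρ hs g λ ps → f (subst₂ _≤_ (sym (dot-norm s ρ)) (sym (dot-norm t ρ)) h ∷ ps)
curry ρ ((s :≡ t) ∷ hs) g f h =
  curry ρ hs g λ ps → f (≤-reflexive eq ∷ ≤-reflexive (sym eq) ∷ ps)
  where
  eq : dot (norm s) (1 ∷ ρ) ≡ dot (norm t) (1 ∷ ρ)
  eq = trans (dot-norm s ρ) (trans h (sym (dot-norm t ρ)))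

Valid : Sequent → List ℕ → Set
Valid (hs ⊢ g) ρ = Implies ρ hs g

-- Sequents are functions of their variables, so no syntax has to be quoted. The implicit argument
-- computes to the unit type when the search succeeds and is then filled in automatically.
lin : ∀ n (f : Terms n) → {T (check (close 0 n f))} → Forall n (Valid (close 0 n f))
lin n f {p} with close 0 n f
... | hs ⊢ g = intro n λ ρ → curry ρ hs g (conclude ρ g hs p)

1≰0 : 1 ≤ 0 → ⊥
1≰0 ()

-- Arithmetic modulo 3

pattern 0₃ = zero
pattern 1₃ = suc zero
pattern 2₃ = suc (suc zero)

infixl 6 _⊕_

_⊕_ : Z3 → Z3 → Z3
0₃ ⊕ d  = d
1₃ ⊕ 0₃ = 1₃
1₃ ⊕ 1₃ = 2₃
1₃ ⊕ 2₃ = 0₃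
2₃ ⊕ 0₃ = 2₃
2₃ ⊕ 1₃ = 0₃
2₃ ⊕ 2₃ = 1₃

⊖_ : Z3 → Z3
⊖ 0₃ = 0₃
⊖ 1₃ = 2₃
⊖ 2₃ = 1₃

Z3-Terms : ℕ → Set
Z3-Terms zero    = List (Z3 × Z3) × (Z3 × Z3)
Z3-Terms (suc n) = Z3 → Z3-Terms n

Z3-Implies : List (Z3 × Z3) → Z3 × Z3 → Set
Z3-Implies []             (a , b) = a ≡ b
Z3-Implies ((a , b) ∷ hs) g       = a ≡ b → Z3-Implies hs g

Z3-Valid : ∀ n → Z3-Terms n → Set
Z3-Valid zero    (hs , g) = Z3-Implies hs g
Z3-Valid (suc n) f        = ∀ x → Z3-Valid n (f x)

Z3-implies? : ∀ hs g → Dec (Z3-Implies hs g)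
Z3-implies? []             (a , b) = a ≟ b
Z3-implies? ((a , b) ∷ hs) g       = (a ≟ b) →-dec Z3-implies? hs g

Z3-valid? : ∀ n f → Dec (Z3-Valid n f)
Z3-valid? zero    (hs , g) = Z3-implies? hs g
Z3-valid? (suc n) f        = all? λ x → Z3-valid? n (f x)

z3 : ∀ n (f : Z3-Terms n) → {True (Z3-valid? n f)} → Z3-Valid n f
z3 n f {p} = toWitness p

-- The contribution of an edge to out-degree minus in-degree: 1 at its tail, -1 at its head.
val : Bool → Z3
val true  = 1₃
val false = 2₃

sel : Bool → Z3 → Z3
sel true  c = c
sel false c = 0₃

ind : Bool → ℕ
ind true  = 1
ind false = 0

ind≤1 : ∀ b → ind b ≤ 1
ind≤1 true  = s≤s z≤n
ind≤1 false = z≤n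

∀Bool? : {P : Bool → Set} → (∀ b → Dec (P b)) → Dec (∀ b → P b)
∀Bool? P? = map′ (λ { (t , f) true → t ; (t , f) false → f }) (λ h → h true , h false)
                 (P? true ×-dec P? false)

-- A leaf pairs a proposition with its decision, so that the proposition can be left as `_` and
-- inferred.
Bool-Terms : ℕ → Set₁
Bool-Terms zero    = Σ Set Dec
Bool-Terms (suc n) = Bool → Bool-Terms n

Bool-Valid : ∀ n → Bool-Terms n → Set
Bool-Valid zero    (P , _) = P
Bool-Valid (suc n) f       = ∀ b → Bool-Valid n (f b)

bool-valid? : ∀ n f → Dec (Bool-Valid n f)
bool-valid? zero    (_ , P?) = P?
bool-valid? (suc n) f        = ∀Bool? λ b → bool-valid? n (f b)

bool : ∀ n (f : Bool-Terms n) → {True (bool-valid? n f)} → Bool-Valid n f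
bool n f {p} = toWitness p

val-cancel : ∀ s c c′ → c ≡ val s ⊕ c′ → c ⊕ val (not s) ≡ c′
val-cancel = bool 1 λ s → _ , all? λ c → all? λ c′ → (c ≟ val s ⊕ c′) →-dec (c ⊕ val (not s) ≟ c′)

-- The norm τ.  A degree d and a boundary value c determine a residue modulo 6, and
-- τ d c is the distance of that residue from 0.

odd : ℕ → Bool
odd zero    = false
odd (suc n) = not (odd n)

norm₆ : Bool → Z3 → ℕ
norm₆ false 0₃      = 0
norm₆ false (suc _) = 2
norm₆ true  0₃      = 3
norm₆ true  (suc _) = 1

τ : ℕ → Z3 → ℕ
τ d c = norm₆ (odd d) c

odd-+ : ∀ a b → odd (a + b) ≡ odd a xor odd b
odd-+ zero    b = refl
odd-+ (suc a) b rewrite odd-+ a b with odd a | odd b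
... | true  | true  = refl
... | true  | false = refl
... | false | true  = refl
... | false | false = refl

odd-double : ∀ a → odd (2 * a) ≡ false
odd-double a rewrite +-identityʳ a | odd-+ a a = Bool.xor-same (odd a)

odd-norm₆ : ∀ p c → odd (norm₆ p c) ≡ p
odd-norm₆ = from-yes (∀Bool? λ p → all? λ c → odd (norm₆ p c) Bool.≟ p)

τ≤3 : ∀ d c → τ d c ≤ 3
τ≤3 d = from-yes (∀Bool? λ p → all? λ c → norm₆ p c ≤? 3) (odd d)

-- Changing the parity and adding 1 or -1 modulo 3 is a step by 1 or -1 modulo 6.
norm₆-step : ∀ p c s → norm₆ (not p) (c ⊕ val s) ≤ suc (norm₆ p c)
norm₆-step = from-yes (∀Bool? λ p → all? λ c → ∀Bool? λ s → norm₆ (not p) (c ⊕ val s) ≤? suc (norm₆ p c))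

τ-up : ∀ d c s → τ (suc d) (c ⊕ val s) ≤ suc (τ d c)
τ-up d = norm₆-step (odd d)

τ-down : ∀ d c s → τ d (c ⊕ val s) ≤ suc (τ (suc d) c)
τ-down d c s = subst (λ p → norm₆ p (c ⊕ val s) ≤ suc (τ (suc d) c)) (Bool.not-involutive (odd d))
                     (norm₆-step (not (odd d)) c s)

-- At fixed parity, a change modulo 3 is a move by 0, 2 or -2 modulo 6.
τ-shift : ∀ d c x → τ d (c ⊕ x) ≤ 2 + τ d c
τ-shift d = from-yes (∀Bool? λ p → all? λ c → all? λ x → norm₆ p (c ⊕ x) ≤? 2 + norm₆ p c) (odd d)

τ-suc : ∀ d c → τ (suc d) c ≤ 3 + τ d c
τ-suc d c = ≤-trans (τ≤3 (suc d) c) (m≤m+n 3 _)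

-- This is the triangle inequality for the distance on the cycle of residues modulo 6.
τ-triangle : ∀ d c d′ c′ → τ (d + d′) (c ⊕ c′) ≤ τ d c + τ d′ c′
τ-triangle d c d′ c′ rewrite odd-+ d d′ =
  from-yes (∀Bool? λ p → all? λ c → ∀Bool? λ q → all? λ c′ →
              norm₆ (p xor q) (c ⊕ c′) ≤? norm₆ p c + norm₆ q c′) (odd d) c (odd d′) c′

τ-+2* : ∀ d c m → τ (2 * m + d) c ≡ τ d c
τ-+2* d c m rewrite odd-+ (2 * m) d | odd-double m = refl

-- At 6 the parity bounds `τ` by 2; from 7 on the crude bound 3 is enough.
6≤⇒cond : ∀ d c → 6 ≤ d → 4 + τ d c ≤ d
6≤⇒cond d c h with m≤n⇒m<n∨m≡n h
... | inj₁ 7≤d  = ≤-trans (+-monoʳ-≤ 4 (τ≤3 d c)) 7≤d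
... | inj₂ refl = from-yes (all? λ c → 4 + norm₆ false c ≤? 6) c

-- At 5 the degree is odd, so `τ` is at least 1. Hence every tip of degree at most five is in the
-- mode `Small`.
≤5⇒small : ∀ d c → d ≤ 5 → d ≤ 4 + τ d c
≤5⇒small 0 c _ = z≤n
≤5⇒small 1 c _ = s≤s z≤n
≤5⇒small 2 c _ = s≤s (s≤s z≤n)
≤5⇒small 3 c _ = s≤s (s≤s (s≤s z≤n))
≤5⇒small 4 c _ = m≤m+n 4 _
≤5⇒small 5 c _ = from-yes (all? λ c → 5 ≤? 4 + norm₆ true c) c
≤5⇒small (suc (suc (suc (suc (suc (suc d)))))) c (s≤s (s≤s (s≤s (s≤s (s≤s ())))))

-- `τ d c` has the parity of `d`, which rules out `5 + τ d c`.
tight-or-loose : ∀ d c → 4 + τ d c ≤ d → d ≡ 4 + τ d c ⊎ 6 + τ d c ≤ d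
tight-or-loose d c h with m≤n⇒m<n∨m≡n h
... | inj₂ eq = inj₁ (sym eq)
... | inj₁ h′ with m≤n⇒m<n∨m≡n h′
...   | inj₁ h″ = inj₂ h″
...   | inj₂ eq = ⊥-elim (no-parity (odd d) (trans (sym (cong not⁵ (odd-norm₆ (odd d) c))) (cong odd eq)))
  where
  not⁵ : Bool → Bool
  not⁵ b = not (not (not (not (not b))))

  no-parity : ∀ b → ¬ (not⁵ b ≡ b)
  no-parity true  ()
  no-parity false ()

module Canvases (N : ℕ) where

  -- Additive functionals on vertex sets


  Vertex : Set
  Vertex = Fin N

  VSet : Set
  VSet = Vertex → Bool

  Edge : Set
  Edge = Vertex × Vertex

  -- (v , true) is an edge directed from v to the tip, (v , false) one directed from the tip to v.
  Tip : Set
  Tip = Vertex × Bool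

  Charge : Set
  Charge = Vertex × Z3

  full : VSet
  full _ = true

  ∅ : VSet
  ∅ _ = false

  ∁ : VSet → VSet
  ∁ A v = not (A v)

  infixr 7 _∩_
  infixr 6 _∪_

  _∩_ _∪_ : VSet → VSet → VSet
  (A ∩ B) v = A v ∧ B v
  (A ∪ B) v = A v ∨ B v

  ⁅_⁆ : Vertex → VSet
  ⁅ u ⁆ v = does (u ≟ v)

  self : ∀ u → ⁅ u ⁆ u ≡ true
  self u = dec-true (u ≟ u) refl

  ⁅⁆-≢ : ∀ {u v} → u ≢ v → ⁅ u ⁆ v ≡ false
  ⁅⁆-≢ {u} {v} = dec-false (u ≟ v)

  ⁅⁆-≡ : ∀ {u v} → ⁅ u ⁆ v ≡ true → u ≡ v
  ⁅⁆-≡ {u} {v} p with u ≟ v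
  ... | yes eq = eq

  cut : List Edge → VSet → ℕ
  cut []             A = 0
  cut ((u , w) ∷ es) A = ind (A u xor A w) + cut es A

  btw : List Edge → VSet → VSet → ℕ
  btw []             A B = 0
  btw ((u , w) ∷ es) A B = ind ((A u ∧ B w) ∨ (A w ∧ B u)) + btw es A B

  cnt : List Tip → VSet → ℕ
  cnt []             A = 0
  cnt ((v , _) ∷ zs) A = ind (A v) + cnt zs A

  chg : List Charge → VSet → Z3
  chg []             A = 0₃
  chg ((v , c) ∷ cs) A = sel (A v) c ⊕ chg cs A

  tip-charge : Tip → Charge
  tip-charge (v , s) = v , val s

  γ : List Tip → VSet → Z3
  γ zs = chg (map tip-charge zs)

  -- Listed edges that represent an orientation are directed from the first to the second end.
  charges : List Edge → List Charge
  charges []             = []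
  charges ((u , w) ∷ os) = (u , 1₃) ∷ (w , 2₃) ∷ charges os

  ∂ : List Edge → VSet → Z3
  ∂ os = chg (charges os)

  infix 4 _≗[_]_

  _≗[_]_ : VSet → VSet → VSet → Set
  A ≗[ S ] B = ∀ v → S v ≡ true → A v ≡ B v

  Within : VSet → List Edge → Set
  Within S = All (λ (u , w) → S u ≡ true × S w ≡ true)

  On : {X : Set} → VSet → List (Vertex × X) → Set
  On S = All (λ (v , _) → S v ≡ true)

  cut-cong : ∀ {S A B es} → A ≗[ S ] B → Within S es → cut es A ≡ cut es B
  cut-cong eq []               = refl
  cut-cong eq ((p , q) ∷ pqs) = cong₂ _+_ (cong₂ (λ a b → ind (a xor b)) (eq _ p) (eq _ q)) (cut-cong eq pqs)

  btw-cong : ∀ {S A A′ B es} → A ≗[ S ] A′ → Within S es → btw es A B ≡ btw es A′ B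
  btw-cong eq []              = refl
  btw-cong {B = B} {(u , w) ∷ _} eq ((p , q) ∷ pqs) =
    cong₂ _+_ (cong₂ (λ a b → ind ((a ∧ B w) ∨ (b ∧ B u))) (eq u p) (eq w q)) (btw-cong eq pqs)

  cnt-cong : ∀ {S A B zs} → A ≗[ S ] B → On S zs → cnt zs A ≡ cnt zs B
  cnt-cong eq []       = refl
  cnt-cong eq (p ∷ ps) = cong₂ _+_ (cong ind (eq _ p)) (cnt-cong eq ps)

  chg-cong : ∀ {S A B cs} → A ≗[ S ] B → On S cs → chg cs A ≡ chg cs B
  chg-cong eq []       = refl
  chg-cong eq (p ∷ ps) = cong₂ _⊕_ (cong (λ b → sel b _) (eq _ p)) (chg-cong eq ps)

  cut-ext : ∀ {A B} es → (∀ v → A v ≡ B v) → cut es A ≡ cut es B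
  cut-ext []             eq = refl
  cut-ext ((u , w) ∷ es) eq = cong₂ _+_ (cong₂ (λ a b → ind (a xor b)) (eq u) (eq w)) (cut-ext es eq)

  btw-ext : ∀ {A A′ B B′} es → (∀ v → A v ≡ A′ v) → (∀ v → B v ≡ B′ v) → btw es A B ≡ btw es A′ B′
  btw-ext []             p q = refl
  btw-ext ((u , w) ∷ es) p q rewrite p u | p w | q u | q w = cong₂ _+_ refl (btw-ext es p q)

  cnt-ext : ∀ {A B} zs → (∀ v → A v ≡ B v) → cnt zs A ≡ cnt zs B
  cnt-ext []             eq = refl
  cnt-ext ((v , _) ∷ zs) eq = cong₂ _+_ (cong ind (eq v)) (cnt-ext zs eq)

  chg-ext : ∀ {A B} cs → (∀ v → A v ≡ B v) → chg cs A ≡ chg cs B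
  chg-ext []             eq = refl
  chg-ext ((v , _) ∷ cs) eq = cong₂ _⊕_ (cong (λ b → sel b _) (eq v)) (chg-ext cs eq)

  cut-∁ : ∀ es A → cut es (∁ A) ≡ cut es A
  cut-∁ []             A = refl
  cut-∁ ((u , w) ∷ es) A = cong₂ _+_ (cong ind (lem (A u) (A w))) (cut-∁ es A)
    where
    lem = bool 2 λ a b → _ , ((not a xor not b) Bool.≟ (a xor b))

  cnt-split : ∀ zs A S → cnt zs A ≡ cnt zs (A ∩ S) + cnt zs (A ∩ ∁ S)
  cnt-split []             A S = refl
  cnt-split ((v , _) ∷ zs) A S =
    lin 6 (λ a b c x y z → (a :≡ b :+ c) ∷ (x :≡ y :+ z) ∷ [] ⊢ a :+ x :≡ b :+ y :+ (c :+ z))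
      (ind (A v)) (ind (A v ∧ S v)) _ _ _ _ (lem (A v) (S v)) (cnt-split zs A S)
    where
    lem = bool 2 λ a b → _ , (ind a ℕ.≟ ind (a ∧ b) + ind (a ∧ not b))

  chg-split : ∀ cs A S → chg cs A ≡ chg cs (A ∩ S) ⊕ chg cs (A ∩ ∁ S)
  chg-split []             A S = refl
  chg-split ((v , c) ∷ cs) A S =
    z3 6 (λ a b c x y z → ((a , b ⊕ c) ∷ (x , y ⊕ z) ∷ [] , (a ⊕ x , b ⊕ y ⊕ (c ⊕ z))))
      (sel (A v) c) (sel (A v ∧ S v) c) _ _ _ _ (lem (A v) (S v) c) (chg-split cs A S)
    where
    lem : ∀ a b c → sel a c ≡ sel (a ∧ b) c ⊕ sel (a ∧ not b) c
    lem true  true  c = z3 1 (λ c → [] , (c , c ⊕ 0₃)) c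
    lem true  false c = refl
    lem false b     c = refl

  chg-∅ : ∀ cs → chg cs ∅ ≡ 0₃
  chg-∅ []       = refl
  chg-∅ (_ ∷ cs) = chg-∅ cs

  cnt-full : ∀ zs → cnt zs full ≡ length zs
  cnt-full []       = refl
  cnt-full (_ ∷ zs) = cong suc (cnt-full zs)

  cnt-∁ : ∀ zs A → cnt zs A + cnt zs (∁ A) ≡ length zs
  cnt-∁ zs A = trans (sym (cnt-split zs full A)) (cnt-full zs)

  chg-∁ : ∀ cs A → chg cs A ⊕ chg cs (∁ A) ≡ chg cs full
  chg-∁ cs A = sym (chg-split cs full A)

  ∂-full : ∀ os → ∂ os full ≡ 0₃
  ∂-full []       = refl
  ∂-full (_ ∷ os) rewrite ∂-full os = refl

  chg-++ : ∀ cs ds A → chg (cs ++ ds) A ≡ chg cs A ⊕ chg ds A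
  chg-++ []             ds A = refl
  chg-++ ((v , c) ∷ cs) ds A rewrite chg-++ cs ds A =
    z3 3 (λ a b c → [] , (a ⊕ (b ⊕ c) , a ⊕ b ⊕ c)) (sel (A v) c) (chg cs A) (chg ds A)

  cnt-++ : ∀ zs ys A → cnt (zs ++ ys) A ≡ cnt zs A + cnt ys A
  cnt-++ []             ys A = refl
  cnt-++ ((v , c) ∷ zs) ys A rewrite cnt-++ zs ys A = sym (+-assoc (ind (A v)) _ _)

  γ-++ : ∀ zs ys A → γ (zs ++ ys) A ≡ γ zs A ⊕ γ ys A
  γ-++ []             ys A = refl
  γ-++ ((v , c) ∷ zs) ys A rewrite γ-++ zs ys A =
    z3 3 (λ a b c → [] , (a ⊕ (b ⊕ c) , a ⊕ b ⊕ c)) (sel (A v) (val c)) (γ zs A) (γ ys A)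

  cut-∪ : ∀ es A B → (∀ v → A v ∧ B v ≡ false) → cut es A + cut es B ≡ cut es (A ∪ B) + 2 * btw es A B
  cut-∪ []             A B dis = refl
  cut-∪ ((u , w) ∷ es) A B dis =
    lin 8 (λ a b c d x y z t → (a :+ b :≡ c :+ 2 :* d) ∷ (x :+ y :≡ z :+ 2 :* t) ∷ [] ⊢
             a :+ x :+ (b :+ y) :≡ c :+ z :+ 2 :* (d :+ t))
      (ind (A u xor A w)) (ind (B u xor B w)) (ind ((A u ∨ B u) xor (A w ∨ B w)))
      (ind ((A u ∧ B w) ∨ (A w ∧ B u))) _ _ _ _
      (lem (A u) (A w) (B u) (B w) (dis u) (dis w)) (cut-∪ es A B dis)
    where
    lem = bool 4 λ a a′ b b′ → _ , ((a ∧ b Bool.≟ false) →-dec (a′ ∧ b′ Bool.≟ false) →-dec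
            ind (a xor a′) + ind (b xor b′) ℕ.≟
            ind ((a ∨ b) xor (a′ ∨ b′)) + 2 * ind ((a ∧ b′) ∨ (a′ ∧ b)))

  cut-btw : ∀ es A B → (∀ v → A v ∧ B v ≡ false) → cut es A ≡ btw es A B + btw es A (∁ A ∩ ∁ B)
  cut-btw []             A B dis = refl
  cut-btw ((u , w) ∷ es) A B dis =
    lin 6 (λ a b c x y z → (a :≡ b :+ c) ∷ (x :≡ y :+ z) ∷ [] ⊢ a :+ x :≡ b :+ y :+ (c :+ z))
      (ind (A u xor A w)) (ind ((A u ∧ B w) ∨ (A w ∧ B u))) _ _ _ _
      (lem (A u) (A w) (B u) (B w) (dis u) (dis w)) (cut-btw es A B dis)
    where
    lem = bool 4 λ a a′ b b′ → _ , ((a ∧ b Bool.≟ false) →-dec (a′ ∧ b′ Bool.≟ false) →-dec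
            ind (a xor a′) ℕ.≟ ind ((a ∧ b′) ∨ (a′ ∧ b)) +
            ind ((a ∧ (not a′ ∧ not b′)) ∨ (a′ ∧ (not a ∧ not b))))

  btw-∪ : ∀ es A B C → btw es A (B ∪ C) ≤ btw es A B + btw es A C
  btw-∪ []             A B C = z≤n
  btw-∪ ((u , w) ∷ es) A B C =
    lin 6 (λ a b c x y z → (a :≤ b :+ c) ∷ (x :≤ y :+ z) ∷ [] ⊢ a :+ x :≤ b :+ y :+ (c :+ z))
      (ind ((A u ∧ (B w ∨ C w)) ∨ (A w ∧ (B u ∨ C u)))) (ind ((A u ∧ B w) ∨ (A w ∧ B u)))
      (ind ((A u ∧ C w) ∨ (A w ∧ C u))) _ _ _
      (lem (A u) (A w) (B w) (C w) (B u) (C u)) (btw-∪ es A B C)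
    where

    lem = bool 6 λ a a′ b c b′ c′ → _ , (ind ((a ∧ (b ∨ c)) ∨ (a′ ∧ (b′ ∨ c′))) ≤?
            ind ((a ∧ b) ∨ (a′ ∧ b′)) + ind ((a ∧ c) ∨ (a′ ∧ c′)))

  btw-sym : ∀ es A B → btw es A B ≡ btw es B A
  btw-sym []             A B = refl
  btw-sym ((u , w) ∷ es) A B = cong₂ _+_ (cong ind (lem (A u) (A w) (B u) (B w))) (btw-sym es A B)
    where
    lem = bool 4 λ a a′ b b′ → _ , ((a ∧ b′) ∨ (a′ ∧ b) Bool.≟ (b ∧ a′) ∨ (b′ ∧ a))

  -- Each tip edge moves the residue modulo 6 by one step.
  τ-tips : ∀ zs A → τ (cnt zs A) (γ zs A) ≤ cnt zs A
  τ-tips []             A = z≤n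
  τ-tips ((v , s) ∷ zs) A with A v
  ... | false = τ-tips zs A
  ... | true  = ≤-trans (≤-reflexive (cong (τ (suc (cnt zs A))) (z3 2 (λ a b → [] , (a ⊕ b , b ⊕ a)) (val s) _)))
                        (≤-trans (τ-up (cnt zs A) (γ zs A) s) (s≤s (τ-tips zs A)))

  -- Singletons are split off one at a time along a list of vertices that covers the set.
  chg-local : ∀ cs A → (∀ v → A v ≡ true → chg cs ⁅ v ⁆ ≡ 0₃) → chg cs A ≡ 0₃
  chg-local cs A h = go (allFin N) A (λ v _ → ∈-allFin v) h
    where
    go : ∀ vs B → (∀ v → B v ≡ true → v ∈ₗ vs) → (∀ v → B v ≡ true → chg cs ⁅ v ⁆ ≡ 0₃) → chg cs B ≡ 0₃
    go []       B cover h = trans (chg-ext cs (λ v → empty v (B v) refl)) (chg-∅ cs)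
      where
      empty : ∀ v b → B v ≡ b → B v ≡ false
      empty v false eq = eq
      empty v true  eq with () ← cover v eq
    go (u ∷ vs) B cover h =
      trans (chg-split cs B ⁅ u ⁆) (cong₂ _⊕_ at-u (go vs (B ∩ ∁ ⁅ u ⁆) cover′ h′))
      where
      at-u : chg cs (B ∩ ⁅ u ⁆) ≡ 0₃
      at-u with B u in eq
      ... | true  = trans (chg-ext cs same) (h u eq)
        where
        same : ∀ v → B v ∧ ⁅ u ⁆ v ≡ ⁅ u ⁆ v
        same v with u ≟ v
        ... | yes refl rewrite eq = refl
        ... | no  _    = Bool.∧-zeroʳ (B v)
      ... | false = trans (chg-ext cs none) (chg-∅ cs)
        where
        none : ∀ v → B v ∧ ⁅ u ⁆ v ≡ false
        none v with u ≟ v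
        ... | yes refl rewrite eq = refl
        ... | no  _    = Bool.∧-zeroʳ (B v)
      cover′ : ∀ v → B v ∧ not (⁅ u ⁆ v) ≡ true → v ∈ₗ vs
      cover′ v p with B v in eq | u ≟ v
      ... | true | no u≢v with cover v eq
      ...   | here v≡u = ⊥-elim (u≢v (sym v≡u))
      ...   | there i  = i
      h′ : ∀ v → B v ∧ not (⁅ u ⁆ v) ≡ true → chg cs ⁅ v ⁆ ≡ 0₃
      h′ v p with B v in eq
      ... | true = h v eq

  -- Orientations and flows


  private variable
    ls ms ns : List Edge

  infix 4 _≋_

  -- Equality as multisets of undirected edges, used to bring a chosen edge to the front. `Reor`, in
  -- contrast, keeps all positions, so that it can stand for an orientation.
  data _≋_ : List Edge → List Edge → Set where
    ≋-refl  : ls ≋ ls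
    ≋-cons  : ∀ {e} → ls ≋ ms → e ∷ ls ≋ e ∷ ms
    ≋-flip  : ∀ {u w} → (u , w) ∷ ls ≋ (w , u) ∷ ls
    ≋-swap  : ∀ {e f} → e ∷ f ∷ ls ≋ f ∷ e ∷ ls
    ≋-trans : ∀ {gs} → ls ≋ ms → ms ≋ gs → ls ≋ gs

  data Reor : List Edge → List Edge → Set where
    []   : Reor [] []
    same : ∀ {e} → Reor ns ls → Reor (e ∷ ns) (e ∷ ls)
    flip : ∀ {u w} → Reor ns ls → Reor ((w , u) ∷ ns) ((u , w) ∷ ls)

  -- Required for all sets and not only for vertices, since contraction and restriction act on sets;
  -- by `chg-determined` this is equivalent.
  Flow : List Edge → List Charge → Set
  Flow ls cs = ∃[ ns ] (Reor ns ls × (∀ A → ∂ ns A ≡ chg cs A))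

  Reor-refl : ∀ ls → Reor ls ls
  Reor-refl []       = []
  Reor-refl (_ ∷ ls) = same (Reor-refl ls)

  Reor-trans : Reor ns ls → Reor ls ms → Reor ns ms
  Reor-trans []       []       = []
  Reor-trans (same r) (same s) = same (Reor-trans r s)
  Reor-trans (same r) (flip s) = flip (Reor-trans r s)
  Reor-trans (flip r) (same s) = flip (Reor-trans r s)
  Reor-trans (flip r) (flip s) = same (Reor-trans r s)

  xor-comm : ∀ a b → a xor b ≡ b xor a
  xor-comm = bool 2 λ a b → _ , ((a xor b) Bool.≟ (b xor a))

  cut-Reor : Reor ns ls → ∀ A → cut ns A ≡ cut ls A
  cut-Reor []       A = refl
  cut-Reor (same r) A = cong₂ _+_ refl (cut-Reor r A)
  cut-Reor (flip {u = u} {w} r) A = cong₂ _+_ (cong ind (xor-comm (A w) (A u))) (cut-Reor r A)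

  btw-Reor : Reor ns ls → ∀ A B → btw ns A B ≡ btw ls A B
  btw-Reor []       A B = refl
  btw-Reor (same r) A B = cong₂ _+_ refl (btw-Reor r A B)
  btw-Reor (flip {u = u} {w} r) A B =
    cong₂ _+_ (cong ind (Bool.∨-comm (A w ∧ B u) (A u ∧ B w))) (btw-Reor r A B)

  Within-Reor : ∀ {S} → Reor ns ls → Within S ls → Within S ns
  Within-Reor []       []             = []
  Within-Reor (same r) (p ∷ ps)       = p ∷ Within-Reor r ps
  Within-Reor (flip r) ((p , q) ∷ ps) = (q , p) ∷ Within-Reor r ps

  length-Reor : Reor ns ls → length ns ≡ length ls
  length-Reor []       = refl
  length-Reor (same r) = cong suc (length-Reor r)
  length-Reor (flip r) = cong suc (length-Reor r)

  cut-≋ : ls ≋ ms → ∀ A → cut ls A ≡ cut ms A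
  cut-≋ ≋-refl A = refl
  cut-≋ (≋-cons r) A = cong₂ _+_ refl (cut-≋ r A)
  cut-≋ (≋-flip {u = u} {w}) A = cong₂ _+_ (cong ind (xor-comm (A u) (A w))) refl
  cut-≋ (≋-swap {ls} {e} {f}) A =
    lin 3 (λ x y z → [] ⊢ x :+ (y :+ z) :≡ y :+ (x :+ z))
      (ind (A (proj₁ e) xor A (proj₂ e))) (ind (A (proj₁ f) xor A (proj₂ f))) (cut ls A)
  cut-≋ (≋-trans r s) A = trans (cut-≋ r A) (cut-≋ s A)

  btw-≋ : ls ≋ ms → ∀ A B → btw ls A B ≡ btw ms A B
  btw-≋ ≋-refl A B = refl
  btw-≋ (≋-cons r) A B = cong₂ _+_ refl (btw-≋ r A B)
  btw-≋ (≋-flip {u = u} {w}) A B = cong₂ _+_ (cong ind (Bool.∨-comm (A u ∧ B w) (A w ∧ B u))) refl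
  btw-≋ (≋-swap {ls} {u , w} {v , x}) A B =
    lin 3 (λ x y z → [] ⊢ x :+ (y :+ z) :≡ y :+ (x :+ z))
      (ind ((A u ∧ B w) ∨ (A w ∧ B u))) (ind ((A v ∧ B x) ∨ (A x ∧ B v))) (btw ls A B)
  btw-≋ (≋-trans r s) A B = trans (btw-≋ r A B) (btw-≋ s A B)

  Within-≋ : ∀ {S} → ls ≋ ms → Within S ls → Within S ms
  Within-≋ ≋-refl        ps             = ps
  Within-≋ (≋-cons r)    (p ∷ ps)       = p ∷ Within-≋ r ps
  Within-≋ ≋-flip        ((p , q) ∷ ps) = (q , p) ∷ ps
  Within-≋ ≋-swap        (p ∷ q ∷ ps)   = q ∷ p ∷ ps
  Within-≋ (≋-trans r s) ps             = Within-≋ s (Within-≋ r ps)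

  length-≋ : ls ≋ ms → length ls ≡ length ms
  length-≋ ≋-refl        = refl
  length-≋ (≋-cons r)    = cong suc (length-≋ r)
  length-≋ ≋-flip        = refl
  length-≋ ≋-swap        = refl
  length-≋ (≋-trans r s) = trans (length-≋ r) (length-≋ s)

  ∂-swap : ∀ e f ns A → ∂ (e ∷ f ∷ ns) A ≡ ∂ (f ∷ e ∷ ns) A
  ∂-swap (u , w) (v , x) ns A =
    z3 5 (λ a b c d e → [] , (a ⊕ (b ⊕ (c ⊕ (d ⊕ e))) , c ⊕ (d ⊕ (a ⊕ (b ⊕ e)))))
      (sel (A u) 1₃) (sel (A w) 2₃) (sel (A v) 1₃) (sel (A x) 2₃) (∂ ns A)

  ∂-∷ : ∀ e ns ns′ A → ∂ ns′ A ≡ ∂ ns A → ∂ (e ∷ ns′) A ≡ ∂ (e ∷ ns) A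
  ∂-∷ (u , w) ns ns′ A eq = cong (λ c → sel (A u) 1₃ ⊕ (sel (A w) 2₃ ⊕ c)) eq

  Reor-≋ : ls ≋ ms → Reor ns ms → ∃[ ns′ ] (Reor ns′ ls × (∀ A → ∂ ns′ A ≡ ∂ ns A))
  Reor-≋ {ns = ns} ≋-refl r = ns , r , λ A → refl
  Reor-≋ (≋-cons {e = e} p) (same {ns} r) with ns′ , r′ , eq ← Reor-≋ p r =
    e ∷ ns′ , same r′ , λ A → ∂-∷ e ns ns′ A (eq A)
  Reor-≋ (≋-cons {e = u , w} p) (flip {ns} r) with ns′ , r′ , eq ← Reor-≋ p r =
    (w , u) ∷ ns′ , flip r′ , λ A → ∂-∷ (w , u) ns ns′ A (eq A)
  Reor-≋ ≋-flip (same r) = _ , flip r , λ A → refl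
  Reor-≋ ≋-flip (flip r) = _ , same r , λ A → refl
  Reor-≋ ≋-swap (same {e = e} (same {ns} {e = f} r)) = f ∷ e ∷ ns , same (same r) , ∂-swap f e ns
  Reor-≋ ≋-swap (same {e = e} (flip {ns} {u = u} {w} r)) =
    (w , u) ∷ e ∷ ns , flip (same r) , ∂-swap (w , u) e ns
  Reor-≋ ≋-swap (flip {u = u} {w} (same {ns} {e = f} r)) =
    f ∷ (w , u) ∷ ns , same (flip r) , ∂-swap f (w , u) ns
  Reor-≋ ≋-swap (flip {u = u} {w} (flip {ns} {u = v} {x} r)) =
    (x , v) ∷ (w , u) ∷ ns , flip (flip r) , ∂-swap (x , v) (w , u) ns
  Reor-≋ (≋-trans p q) r with _ , r₁ , eq₁ ← Reor-≋ q r with _ , r₂ , eq₂ ← Reor-≋ p r₁ =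
    _ , r₂ , λ A → trans (eq₂ A) (eq₁ A)

  Flow-≋ : ∀ {cs} → ls ≋ ms → Flow ms cs → Flow ls cs
  Flow-≋ p (ns , r , eq) with ns′ , r′ , eq′ ← Reor-≋ p r = ns′ , r′ , λ A → trans (eq′ A) (eq A)

  ∧-true : ∀ {a b} → a ∧ b ≡ true → a ≡ true × b ≡ true
  ∧-true {true} {true} _ = refl , refl

  find-edge : ∀ ls A B → 1 ≤ btw ls A B →
              ∃[ u ] ∃[ w ] ∃[ ms ] (A u ≡ true × B w ≡ true × ls ≋ (u , w) ∷ ms)
  find-edge ((u , w) ∷ ls) A B p with A u ∧ B w in e₁ | A w ∧ B u in e₂
  ... | true  | _     = u , w , ls , proj₁ (∧-true e₁) , proj₂ (∧-true e₁) , ≋-refl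
  ... | false | true  = w , u , ls , proj₁ (∧-true e₂) , proj₂ (∧-true e₂) , ≋-flip
  ... | false | false with v , x , ms , a , b , q ← find-edge ls A B p =
    v , x , (u , w) ∷ ms , a , b , ≋-trans (≋-cons q) ≋-swap

  -- Tips

  data Pick {X : Set} (x : X) : List X → List X → Set where
    here  : ∀ {xs} → Pick x (x ∷ xs) xs
    there : ∀ {y xs ys} → Pick x xs ys → Pick x (y ∷ xs) (y ∷ ys)

  Pick-length : ∀ {X : Set} {x : X} {xs ys} → Pick x xs ys → length xs ≡ suc (length ys)
  Pick-length here      = refl
  Pick-length (there i) = cong suc (Pick-length i)

  Pick-All : ∀ {X : Set} {P : X → Set} {x xs ys} → Pick x xs ys → All P xs → P x × All P ys
  Pick-All here      (p ∷ ps) = p , ps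
  Pick-All (there i) (p ∷ ps) with q , qs ← Pick-All i ps = q , p ∷ qs

  Pick-cnt : ∀ {v s zs ys} → Pick (v , s) zs ys → ∀ A → cnt zs A ≡ ind (A v) + cnt ys A
  Pick-cnt here A = refl
  Pick-cnt {v} (there {y , _} i) A rewrite Pick-cnt i A =
    lin 3 (λ x y z → [] ⊢ x :+ (y :+ z) :≡ y :+ (x :+ z)) (ind (A y)) (ind (A v)) _

  Pick-γ : ∀ {v s zs ys} → Pick (v , s) zs ys → ∀ A → γ zs A ≡ sel (A v) (val s) ⊕ γ ys A
  Pick-γ here A = refl
  Pick-γ {v} {s} (there {y , t} i) A rewrite Pick-γ i A =
    z3 3 (λ x y z → [] , (x ⊕ (y ⊕ z) , y ⊕ (x ⊕ z))) (sel (A y) (val t)) (sel (A v) (val s)) _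

  find-tip : ∀ zs (A : VSet) → 1 ≤ cnt zs A → ∃[ v ] ∃[ s ] ∃[ ys ] (A v ≡ true × Pick (v , s) zs ys)
  find-tip ((v , s) ∷ zs) A p with A v in e
  ... | true  = v , s , zs , e , here
  ... | false with u , t , ys , a , i ← find-tip zs A p = u , t , (v , s) ∷ ys , a , there i

  times : ℕ → Z3 → Z3
  times zero    c = 0₃
  times (suc n) c = c ⊕ times n c

  times-+ : ∀ a b c → times (a + b) c ≡ times a c ⊕ times b c
  times-+ zero    b c = refl
  times-+ (suc a) b c rewrite times-+ a b c =
    z3 3 (λ x y z → [] , (x ⊕ (y ⊕ z) , x ⊕ y ⊕ z)) c (times a c) (times b c)

  times-not : ∀ a r → times a (val (not r)) ≡ ⊖ times a (val r)
  times-not zero    r = refl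
  times-not (suc a) r rewrite times-not a r = bool 1 (λ r → _ , all? λ c → (val (not r) ⊕ (⊖ c) ≟ ⊖ (val r ⊕ c))) r (times a (val r))

  γ-uniform : ∀ zs (A : VSet) s → (∀ v t ys → Pick (v , t) zs ys → A v ≡ true → t ≡ s) →
              γ zs A ≡ times (cnt zs A) (val s)
  γ-uniform []             A s h = refl
  γ-uniform ((v , t) ∷ zs) A s h with A v in e
  ... | true  = cong₂ (λ r c → val r ⊕ c) (h v t zs here e)
                  (γ-uniform zs A s (λ u r ys i → h u r _ (there i)))
  ... | false = γ-uniform zs A s (λ u r ys i → h u r _ (there i))

  -- Existence of a flow is decidable

  any-Reor? : ∀ {P : List Edge → Set} → (∀ ns → Dec (P ns)) → ∀ ls → Dec (∃[ ns ] (Reor ns ls × P ns))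
  any-Reor? P? [] = map′ (λ p → [] , [] , p) (λ { (_ , [] , p) → p }) (P? [])
  any-Reor? P? ((u , w) ∷ ls)
    with any-Reor? (λ ns → P? ((u , w) ∷ ns)) ls | any-Reor? (λ ns → P? ((w , u) ∷ ns)) ls
  ... | yes (ns , r , p) | _                = yes (_ , same r , p)
  ... | no _             | yes (ns , r , p) = yes (_ , flip r , p)
  ... | no ¬p            | no ¬q            =
    no λ { (_ , same r , p) → ¬p (_ , r , p) ; (_ , flip r , p) → ¬q (_ , r , p) }

  opposite : List Charge → List Charge
  opposite = map λ (v , c) → v , ⊖ c

  chg-opposite : ∀ cs A → chg (opposite cs) A ≡ ⊖ chg cs A
  chg-opposite []             A = refl
  chg-opposite ((v , c) ∷ cs) A rewrite chg-opposite cs A = lem (A v)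
    where
    lem : ∀ b → sel b (⊖ c) ⊕ (⊖ chg cs A) ≡ ⊖ (sel b c ⊕ chg cs A)
    lem true  = z3 2 (λ x y → [] , ((⊖ x) ⊕ (⊖ y) , ⊖ (x ⊕ y))) c (chg cs A)
    lem false = refl

  chg-determined : ∀ cs ds → (∀ v → chg cs ⁅ v ⁆ ≡ chg ds ⁅ v ⁆) → ∀ A → chg cs A ≡ chg ds A
  chg-determined cs ds h A =
    z3 3 (λ x y z → (x ⊕ z , 0₃) ∷ (z , ⊖ y) ∷ [] , (x , y)) (chg cs A) (chg ds A) (chg (opposite ds) A)
      (trans (sym (chg-++ cs (opposite ds) A))
             (chg-local (cs ++ opposite ds) A λ v _ →
                trans (chg-++ cs (opposite ds) ⁅ v ⁆)
                      (z3 3 (λ x y z → (x , y) ∷ (z , ⊖ y) ∷ [] , (x ⊕ z , 0₃)) _ _ _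
                         (h v) (chg-opposite ds ⁅ v ⁆))))
      (chg-opposite ds A)

  -- The main argument only refutes canvases without a flow; this decision turns the refutation into
  -- an orientation.
  flow? : ∀ ls cs → Dec (Flow ls cs)
  flow? ls cs = any-Reor? (λ ns → map′ (chg-determined (charges ns) cs) (λ h v → h ⁅ v ⁆)
                                       (all? λ v → ∂ ns ⁅ v ⁆ ≟ chg cs ⁅ v ⁆)) ls

  -- Flows on two vertices

  -- The sums of m signs modulo 3. From two signs on every residue occurs.
  data Reachable : ℕ → Z3 → Set where
    nil  : Reachable 0 0₃
    one  : ∀ s → Reachable 1 (val s)
    many : ∀ {m c} → Reachable (2 + m) c

  Reachable-suc : ∀ m c → Reachable (suc m) c → ∃[ s ] Reachable m (c ⊕ (⊖ val s))
  Reachable-suc zero _ (one true)  = true , nil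
  Reachable-suc zero _ (one false) = false , nil
  Reachable-suc (suc zero) 0₃ many = true , one false
  Reachable-suc (suc zero) 1₃ many = false , one false
  Reachable-suc (suc zero) 2₃ many = true , one true
  Reachable-suc (suc (suc m)) c many = true , many

  On-charges : ∀ {S ns} → Within S ns → On S (charges ns)
  On-charges []             = []
  On-charges ((p , q) ∷ ps) = p ∷ q ∷ On-charges ps

  ⁅⁆-other : ∀ {u v w} → u ≢ v → ⁅ u ⁆ w ∨ ⁅ v ⁆ w ≡ true → ⁅ v ⁆ w ≡ not (⁅ u ⁆ w)
  ⁅⁆-other {u} {v} {w} u≢v p with u ≟ w | v ≟ w
  ... | yes refl | yes refl = ⊥-elim (u≢v refl)
  ... | yes _    | no _     = refl
  ... | no _     | yes _    = refl

  -- Loops, which arise from contractions, contribute nothing and keep their direction; the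
  -- remaining edges choose their signs one by one.
  orient-two : ∀ u v ls c → u ≢ v → Within (⁅ u ⁆ ∪ ⁅ v ⁆) ls → Reachable (btw ls ⁅ u ⁆ ⁅ v ⁆) c →
               ∃[ ns ] (Reor ns ls × ∂ ns ⁅ u ⁆ ≡ c)
  orient-two u v [] _ u≢v [] nil = [] , [] , refl
  orient-two u v ((a , b) ∷ ls) c u≢v ((p , q) ∷ ps) r
    rewrite ⁅⁆-other u≢v p | ⁅⁆-other u≢v q with ⁅ u ⁆ a in ea | ⁅ u ⁆ b in eb
  ... | true | true with ns , s , eq ← orient-two u v ls c u≢v ps r =
    (a , b) ∷ ns , same s ,
    trans (cong₂ (λ x y → sel x 1₃ ⊕ (sel y 2₃ ⊕ ∂ ns ⁅ u ⁆)) ea eb)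
          (z3 2 (λ x y → (x , y) ∷ [] , (1₃ ⊕ (2₃ ⊕ x) , y)) _ _ eq)
  ... | false | false with ns , s , eq ← orient-two u v ls c u≢v ps r =
    (a , b) ∷ ns , same s ,
    trans (cong₂ (λ x y → sel x 1₃ ⊕ (sel y 2₃ ⊕ ∂ ns ⁅ u ⁆)) ea eb) eq
  ... | true | false with Reachable-suc _ c r
  ...   | true , r′ with ns , s , eq ← orient-two u v ls _ u≢v ps r′ =
    (a , b) ∷ ns , same s ,
    trans (cong₂ (λ x y → sel x 1₃ ⊕ (sel y 2₃ ⊕ ∂ ns ⁅ u ⁆)) ea eb)
          (z3 2 (λ x y → (x , y ⊕ (⊖ 1₃)) ∷ [] , (1₃ ⊕ x , y)) _ _ eq)
  ...   | false , r′ with ns , s , eq ← orient-two u v ls _ u≢v ps r′ =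
    (b , a) ∷ ns , flip s ,
    trans (cong₂ (λ x y → sel y 1₃ ⊕ (sel x 2₃ ⊕ ∂ ns ⁅ u ⁆)) ea eb)
          (z3 2 (λ x y → (x , y ⊕ (⊖ 2₃)) ∷ [] , (2₃ ⊕ x , y)) _ _ eq)
  orient-two u v ((a , b) ∷ ls) c u≢v ((p , q) ∷ ps) r
      | false | true with Reachable-suc _ c r
  ...   | true , r′ with ns , s , eq ← orient-two u v ls _ u≢v ps r′ =
    (b , a) ∷ ns , flip s ,
    trans (cong₂ (λ x y → sel y 1₃ ⊕ (sel x 2₃ ⊕ ∂ ns ⁅ u ⁆)) ea eb)
          (z3 2 (λ x y → (x , y ⊕ (⊖ 1₃)) ∷ [] , (1₃ ⊕ x , y)) _ _ eq)
  ...   | false , r′ with ns , s , eq ← orient-two u v ls _ u≢v ps r′ =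
    (a , b) ∷ ns , same s ,
    trans (cong₂ (λ x y → sel x 1₃ ⊕ (sel y 2₃ ⊕ ∂ ns ⁅ u ⁆)) ea eb)
          (z3 2 (λ x y → (x , y ⊕ (⊖ 2₃)) ∷ [] , (2₃ ⊕ x , y)) _ _ eq)

  flow-two : ∀ u v ls cs → u ≢ v → Within (⁅ u ⁆ ∪ ⁅ v ⁆) ls → On (⁅ u ⁆ ∪ ⁅ v ⁆) cs → chg cs full ≡ 0₃ →
             Reachable (btw ls ⁅ u ⁆ ⁅ v ⁆) (chg cs ⁅ u ⁆) → Flow ls cs
  flow-two u v ls cs u≢v ps qs total r with ns , s , eq ← orient-two u v ls _ u≢v ps r =
    ns , s , chg-determined (charges ns) cs agree
    where
    On-os : On (⁅ u ⁆ ∪ ⁅ v ⁆) (charges ns)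
    On-os = On-charges (Within-Reor s ps)

    at-v : ∀ ds → On (⁅ u ⁆ ∪ ⁅ v ⁆) ds → chg ds full ≡ 0₃ → chg ds ⁅ v ⁆ ≡ ⊖ chg ds ⁅ u ⁆
    at-v ds on t =
      z3 4 (λ a b c d → (a , b) ∷ (c ⊕ b , d) ∷ (d , 0₃) ∷ [] , (a , ⊖ c)) _ _ _ _
        (chg-cong {B = ∁ ⁅ u ⁆} (λ w p → ⁅⁆-other u≢v p) on) (chg-∁ ds ⁅ u ⁆) t

    elsewhere : ∀ {w} ds → On (⁅ u ⁆ ∪ ⁅ v ⁆) ds → u ≢ w → v ≢ w → chg ds ⁅ w ⁆ ≡ 0₃
    elsewhere {w} ds on u≢w v≢w = trans (chg-cong {B = ∅} away on) (chg-∅ ds)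
      where
      away : ∀ x → ⁅ u ⁆ x ∨ ⁅ v ⁆ x ≡ true → ⁅ w ⁆ x ≡ false
      away x p with w ≟ x
      ... | no _ = refl
      ... | yes refl rewrite ⁅⁆-≢ u≢w | ⁅⁆-≢ v≢w with () ← p

    agree : ∀ w → ∂ ns ⁅ w ⁆ ≡ chg cs ⁅ w ⁆
    agree w = case u ≟ w of λ where
      (yes refl) → eq
      (no u≢w) → case v ≟ w of λ where
        (yes refl) → trans (at-v (charges ns) On-os (∂-full ns))
                           (trans (cong ⊖_ eq) (sym (at-v cs qs total)))
        (no v≢w) → trans (elsewhere (charges ns) On-os u≢w v≢w) (sym (elsewhere cs qs u≢w v≢w))

  -- Restriction to a vertex set and contraction of a vertex set

  inner : VSet → List Edge → List Edge
  inner S []             = []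
  inner S ((u , w) ∷ ns) = if S u ∧ S w then (u , w) ∷ inner S ns else inner S ns

  -- The oriented edges leaving S, seen from S as tip edges.
  outer : VSet → List Edge → List Tip
  outer S [] = []
  outer S ((u , w) ∷ ns) with S u | S w
  ... | true  | true  = outer S ns
  ... | true  | false = (u , true) ∷ outer S ns
  ... | false | true  = (w , false) ∷ outer S ns
  ... | false | false = outer S ns

  restr : {X : Set} → VSet → List (Vertex × X) → List (Vertex × X)
  restr S []             = []
  restr S ((v , x) ∷ xs) = if S v then (v , x) ∷ restr S xs else restr S xs

  restr-On : ∀ {X : Set} {P S} {xs : List (Vertex × X)} → On P xs → On (P ∩ S) (restr S xs)
  restr-On [] = []
  restr-On {S = S} {xs = (v , _) ∷ _} (p ∷ ps) with S v in e
  ... | true  = cong₂ _∧_ p e ∷ restr-On ps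
  ... | false = restr-On ps

  cnt-restr : ∀ S zs A → cnt (restr S zs) A ≡ cnt zs (A ∩ S)
  cnt-restr S []             A = refl
  cnt-restr S ((v , s) ∷ zs) A with S v
  ... | true  = cong₂ _+_ (cong ind (sym (Bool.∧-identityʳ (A v)))) (cnt-restr S zs A)
  ... | false = cong₂ _+_ (cong ind (sym (Bool.∧-zeroʳ (A v)))) (cnt-restr S zs A)

  chg-restr : ∀ S cs A → chg (restr S cs) A ≡ chg cs (A ∩ S)
  chg-restr S []             A = refl
  chg-restr S ((v , c) ∷ cs) A with S v
  ... | true  = cong₂ _⊕_ (cong (λ b → sel b c) (sym (Bool.∧-identityʳ (A v)))) (chg-restr S cs A)
  ... | false = cong₂ _⊕_ (cong (λ b → sel b c) (sym (Bool.∧-zeroʳ (A v)))) (chg-restr S cs A)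

  γ-restr : ∀ S zs A → γ (restr S zs) A ≡ γ zs (A ∩ S)
  γ-restr S []             A = refl
  γ-restr S ((v , s) ∷ zs) A with S v
  ... | true  = cong₂ _⊕_ (cong (λ b → sel b (val s)) (sym (Bool.∧-identityʳ (A v)))) (γ-restr S zs A)
  ... | false = cong₂ _⊕_ (cong (λ b → sel b (val s)) (sym (Bool.∧-zeroʳ (A v)))) (γ-restr S zs A)

  length-restr : ∀ {X : Set} S (xs : List (Vertex × X)) → length (restr S xs) ≤ length xs
  length-restr S []             = z≤n
  length-restr S ((v , x) ∷ xs) with S v
  ... | true  = s≤s (length-restr S xs)
  ... | false = m≤n⇒m≤1+n (length-restr S xs)

  cut-inner : ∀ S ns A → cut (inner S ns) A + cnt (outer S ns) A ≡ cut ns (A ∩ S)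
  cut-inner S [] A = refl
  cut-inner S ((u , w) ∷ ns) A with S u | S w
  ... | true | true rewrite Bool.∧-identityʳ (A u) | Bool.∧-identityʳ (A w) =
    trans (+-assoc (ind (A u xor A w)) _ _) (cong₂ _+_ refl (cut-inner S ns A))
  ... | true | false rewrite Bool.∧-identityʳ (A u) | Bool.∧-zeroʳ (A w) | Bool.xor-identityʳ (A u) =
    lin 4 (λ a b c d → (a :+ c :≡ d) ∷ [] ⊢ a :+ (b :+ c) :≡ b :+ d)
      (cut (inner S ns) A) (ind (A u)) _ _ (cut-inner S ns A)
  ... | false | true rewrite Bool.∧-identityʳ (A w) | Bool.∧-zeroʳ (A u) =
    lin 4 (λ a b c d → (a :+ c :≡ d) ∷ [] ⊢ a :+ (b :+ c) :≡ b :+ d)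
      (cut (inner S ns) A) (ind (A w)) _ _ (cut-inner S ns A)
  ... | false | false rewrite Bool.∧-zeroʳ (A u) | Bool.∧-zeroʳ (A w) = cut-inner S ns A

  ∂-inner : ∀ S ns A → ∂ (inner S ns) A ⊕ γ (outer S ns) A ≡ ∂ ns (A ∩ S)
  ∂-inner S [] A = refl
  ∂-inner S ((u , w) ∷ ns) A with S u | S w
  ... | true | true rewrite Bool.∧-identityʳ (A u) | Bool.∧-identityʳ (A w) =
    z3 5 (λ a b c d e → (c ⊕ d , e) ∷ [] , (a ⊕ (b ⊕ c) ⊕ d , a ⊕ (b ⊕ e)))
      (sel (A u) 1₃) (sel (A w) 2₃) (∂ (inner S ns) A) _ _ (∂-inner S ns A)
  ... | true | false rewrite Bool.∧-identityʳ (A u) | Bool.∧-zeroʳ (A w) =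
    z3 4 (λ a c d e → (c ⊕ d , e) ∷ [] , (c ⊕ (a ⊕ d) , a ⊕ e))
      (sel (A u) 1₃) (∂ (inner S ns) A) _ _ (∂-inner S ns A)
  ... | false | true rewrite Bool.∧-identityʳ (A w) | Bool.∧-zeroʳ (A u) =
    z3 4 (λ a c d e → (c ⊕ d , e) ∷ [] , (c ⊕ (a ⊕ d) , a ⊕ e))
      (sel (A w) 2₃) (∂ (inner S ns) A) _ _ (∂-inner S ns A)
  ... | false | false rewrite Bool.∧-zeroʳ (A u) | Bool.∧-zeroʳ (A w) = ∂-inner S ns A

  inner-Within : ∀ {P S} → Within P ns → Within (P ∩ S) (inner S ns)
  inner-Within [] = []
  inner-Within {(u , w) ∷ _} {S = S} ((p , q) ∷ ps) with S u in e | S w in f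
  ... | true  | true  = (cong₂ _∧_ p e , cong₂ _∧_ q f) ∷ inner-Within ps
  ... | true  | false = inner-Within ps
  ... | false | _     = inner-Within ps

  outer-On : ∀ {P S} → Within P ns → On (P ∩ S) (outer S ns)
  outer-On [] = []
  outer-On {(u , w) ∷ _} {S = S} ((p , q) ∷ ps) with S u in e | S w in f
  ... | true  | true  = outer-On ps
  ... | true  | false = cong₂ _∧_ p e ∷ outer-On ps
  ... | false | true  = cong₂ _∧_ q f ∷ outer-On ps
  ... | false | false = outer-On ps

  length-inner : ∀ S ns → 2 * length (inner S ns) + length (outer S ns) ≤ 2 * length ns
  length-inner S [] = z≤n
  length-inner S ((u , w) ∷ ns) with S u | S w
  ... | true | true = lin 3 (λ a b c → (2 :* a :+ b :≤ 2 :* c) ∷ [] ⊢ 2 :* (# 1 :+ a) :+ b :≤ 2 :* (# 1 :+ c))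
                        (length (inner S ns)) _ _ (length-inner S ns)
  ... | true | false = lin 3 (λ a b c → (2 :* a :+ b :≤ 2 :* c) ∷ [] ⊢ 2 :* a :+ (# 1 :+ b) :≤ 2 :* (# 1 :+ c))
                        (length (inner S ns)) _ _ (length-inner S ns)
  ... | false | true = lin 3 (λ a b c → (2 :* a :+ b :≤ 2 :* c) ∷ [] ⊢ 2 :* a :+ (# 1 :+ b) :≤ 2 :* (# 1 :+ c))
                        (length (inner S ns)) _ _ (length-inner S ns)
  ... | false | false = lin 3 (λ a b c → (2 :* a :+ b :≤ 2 :* c) ∷ [] ⊢ 2 :* a :+ b :≤ 2 :* (# 1 :+ c))
                        (length (inner S ns)) _ _ (length-inner S ns)

  cnt-outer : ∀ S ns A → cnt (outer S ns) A ≡ btw ns (A ∩ S) (∁ S)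
  cnt-outer S [] A = refl
  cnt-outer S ((u , w) ∷ ns) A with S u | S w
  ... | true | true rewrite Bool.∧-zeroʳ (A u ∧ true) | Bool.∧-zeroʳ (A w ∧ true) = cnt-outer S ns A
  ... | true | false rewrite Bool.∧-zeroʳ (A w) | Bool.∧-identityʳ (A u) | Bool.∧-identityʳ (A u)
                           | Bool.∨-identityʳ (A u) = cong₂ _+_ refl (cnt-outer S ns A)
  ... | false | true rewrite Bool.∧-zeroʳ (A u) | Bool.∧-identityʳ (A w) | Bool.∧-identityʳ (A w) =
    cong₂ _+_ refl (cnt-outer S ns A)
  ... | false | false rewrite Bool.∧-zeroʳ (A u) | Bool.∧-zeroʳ (A w) = cnt-outer S ns A

  kept : ∀ a a′ b b′ x → sel (a ∧ b) 1₃ ⊕ (sel (a′ ∧ b′) 2₃ ⊕ x) ≡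
         (if b then sel a 1₃ else 0₃) ⊕ ((if b′ then sel a′ 2₃ else 0₃) ⊕ x)
  kept = bool 4 λ a a′ b b′ → _ , all? λ x →
         (sel (a ∧ b) 1₃ ⊕ (sel (a′ ∧ b′) 2₃ ⊕ x) ≟
          (if b then sel a 1₃ else 0₃) ⊕ ((if b′ then sel a′ 2₃ else 0₃) ⊕ x))

  -- A reorientation that reverses edges inside `S` only. At the end this shows that the edges at
  -- the tip keep the prescribed direction.
  data Turns (S : VSet) : List Edge → List Edge → Set where
    []   : Turns S [] []
    stay : ∀ {e ks ns} → Turns S ks ns → Turns S (e ∷ ks) (e ∷ ns)
    turn : ∀ {u w ks ns} → S u ≡ true → S w ≡ true → Turns S ks ns → Turns S ((w , u) ∷ ks) ((u , w) ∷ ns)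

  Turns⇒Reor : ∀ {S ks ns} → Turns S ks ns → Reor ks ns
  Turns⇒Reor []           = []
  Turns⇒Reor (stay t)     = same (Turns⇒Reor t)
  Turns⇒Reor (turn _ _ t) = flip (Turns⇒Reor t)

  -- An edge leaving `S` keeps its direction; its end in `S` is counted by the second summand and
  -- its other end by the third.
  merge : ∀ S ns {is} → Reor is (inner S ns) →
          ∃[ ks ] (Turns S ks ns × (∀ A → ∂ ks A ≡ ∂ is A ⊕ γ (outer S ns) A ⊕ ∂ ns (A ∩ ∁ S)))
  merge S [] [] = [] , [] , λ A → refl
  merge S ((u , w) ∷ ns) r with S u in e | S w in f
  merge S ((u , w) ∷ ns) (same {is} r) | true | true with ks , r′ , eq ← merge S ns r =
    (u , w) ∷ ks , stay r′ , λ A → trans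
      (z3 6 (λ a b c d e f → (c , d ⊕ e ⊕ f) ∷ [] , (a ⊕ (b ⊕ c) , a ⊕ (b ⊕ d) ⊕ e ⊕ f))
         (sel (A u) 1₃) (sel (A w) 2₃) (∂ ks A) (∂ is A) (γ (outer S ns) A) (∂ ns (A ∩ ∁ S)) (eq A))
      (cong (λ c → ∂ ((u , w) ∷ is) A ⊕ γ (outer S ns) A ⊕ c) (sym (kept (A u) (A w) false false (∂ ns (A ∩ ∁ S)))))
  merge S ((u , w) ∷ ns) (flip {is} r) | true | true with ks , r′ , eq ← merge S ns r =
    (w , u) ∷ ks , turn e f r′ , λ A → trans
      (z3 6 (λ a b c d e f → (c , d ⊕ e ⊕ f) ∷ [] , (a ⊕ (b ⊕ c) , a ⊕ (b ⊕ d) ⊕ e ⊕ f))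
         (sel (A w) 1₃) (sel (A u) 2₃) (∂ ks A) (∂ is A) (γ (outer S ns) A) (∂ ns (A ∩ ∁ S)) (eq A))
      (cong (λ c → ∂ ((w , u) ∷ is) A ⊕ γ (outer S ns) A ⊕ c) (sym (kept (A u) (A w) false false (∂ ns (A ∩ ∁ S)))))
  merge S ((u , w) ∷ ns) {is} r | true | false with ks , r′ , eq ← merge S ns r =
    (u , w) ∷ ks , stay r′ , λ A → trans
      (z3 6 (λ a b c d e f → (c , d ⊕ e ⊕ f) ∷ [] , (a ⊕ (b ⊕ c) , d ⊕ (a ⊕ e) ⊕ (b ⊕ f)))
         (sel (A u) 1₃) (sel (A w) 2₃) (∂ ks A) (∂ is A) (γ (outer S ns) A) (∂ ns (A ∩ ∁ S)) (eq A))
      (cong (λ c → ∂ is A ⊕ (sel (A u) 1₃ ⊕ γ (outer S ns) A) ⊕ c) (sym (kept (A u) (A w) false true (∂ ns (A ∩ ∁ S)))))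
  merge S ((u , w) ∷ ns) {is} r | false | true with ks , r′ , eq ← merge S ns r =
    (u , w) ∷ ks , stay r′ , λ A → trans
      (z3 6 (λ a b c d e f → (c , d ⊕ e ⊕ f) ∷ [] , (a ⊕ (b ⊕ c) , d ⊕ (b ⊕ e) ⊕ (a ⊕ f)))
         (sel (A u) 1₃) (sel (A w) 2₃) (∂ ks A) (∂ is A) (γ (outer S ns) A) (∂ ns (A ∩ ∁ S)) (eq A))
      (cong (λ c → ∂ is A ⊕ (sel (A w) 2₃ ⊕ γ (outer S ns) A) ⊕ c) (sym (kept (A u) (A w) true false (∂ ns (A ∩ ∁ S)))))
  merge S ((u , w) ∷ ns) {is} r | false | false with ks , r′ , eq ← merge S ns r =
    (u , w) ∷ ks , stay r′ , λ A → trans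
      (z3 6 (λ a b c d e f → (c , d ⊕ e ⊕ f) ∷ [] , (a ⊕ (b ⊕ c) , d ⊕ e ⊕ (a ⊕ (b ⊕ f))))
         (sel (A u) 1₃) (sel (A w) 2₃) (∂ ks A) (∂ is A) (γ (outer S ns) A) (∂ ns (A ∩ ∁ S)) (eq A))
      (cong (λ c → ∂ is A ⊕ γ (outer S ns) A ⊕ c) (sym (kept (A u) (A w) true true (∂ ns (A ∩ ∁ S)))))

  -- What the edges inside `S` still have to supply once the edges leaving `S` are fixed as in `ns`.
  inner-charges : VSet → List Edge → List Charge → List Charge
  inner-charges S ns cs = restr S cs ++ opposite (map tip-charge (outer S ns))

  chg-inner : ∀ S ns cs A → chg (inner-charges S ns cs) A ⊕ γ (outer S ns) A ≡ chg cs (A ∩ S)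
  chg-inner S ns cs A =
    trans (cong (_⊕ γ (outer S ns) A)
                (trans (chg-++ (restr S cs) _ A)
                       (cong₂ _⊕_ (chg-restr S cs A) (chg-opposite (map tip-charge (outer S ns)) A))))
          (z3 2 (λ x y → [] , (x ⊕ (⊖ y) ⊕ y , x)) (chg cs (A ∩ S)) (γ (outer S ns) A))

  inner-charges-On : ∀ {P S ns cs} → Within P ns → On P cs → On (P ∩ S) (inner-charges S ns cs)
  inner-charges-On {P} {S} {ns} {cs} ps qs = go (restr S cs) (restr-On qs)
    where
    opp : ∀ {zs} → On (P ∩ S) zs → On (P ∩ S) (opposite (map tip-charge zs))
    opp []       = []
    opp (r ∷ rs) = r ∷ opp rs

    go : ∀ ds → On (P ∩ S) ds → On (P ∩ S) (ds ++ opposite (map tip-charge (outer S ns)))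
    go []       []       = opp (outer-On ps)
    go (_ ∷ ds) (r ∷ rs) = r ∷ go ds rs

  solve-inner : ∀ S ns cs → (∀ A → ∂ ns (A ∩ ∁ S) ≡ chg cs (A ∩ ∁ S)) →
                Flow (inner S ns) (inner-charges S ns cs) → ∃[ ks ] (Turns S ks ns × (∀ A → ∂ ks A ≡ chg cs A))
  solve-inner S ns cs out (is , s , eq) with ks , t , eq′ ← merge S ns s =
    ks , t , λ A →
      trans (eq′ A) (trans (cong₂ (λ i o → i ⊕ γ (outer S ns) A ⊕ o) (eq A) (out A))
        (trans (cong (_⊕ chg cs (A ∩ ∁ S)) (chg-inner S ns cs A)) (sym (chg-split cs A S))))

  flow-inner : ∀ S cs → Reor ns ls → (∀ A → ∂ ns (A ∩ ∁ S) ≡ chg cs (A ∩ ∁ S)) →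
               Flow (inner S ns) (inner-charges S ns cs) → Flow ls cs
  flow-inner {ns = ns} S cs r out f with ks , t , eq ← solve-inner S ns cs out f =
    ks , Reor-trans (Turns⇒Reor t) r , eq

  demand-at : ∀ ns cs y → ∂ ns ⁅ y ⁆ ≡ chg cs ⁅ y ⁆ → ∀ B → ∂ ns (B ∩ ∁ (∁ ⁅ y ⁆)) ≡ chg cs (B ∩ ∁ (∁ ⁅ y ⁆))
  demand-at ns cs y h B with B y in eq
  ... | true  = trans (chg-ext (charges ns) at-y) (trans h (sym (chg-ext cs at-y)))
    where
    at-y : ∀ v → (B ∩ ∁ (∁ ⁅ y ⁆)) v ≡ ⁅ y ⁆ v
    at-y v with y ≟ v
    ... | yes refl rewrite eq = refl
    ... | no _ = Bool.∧-zeroʳ (B v)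
  ... | false = trans (chg-ext (charges ns) none) (trans (trans (chg-∅ (charges ns)) (sym (chg-∅ cs))) (sym (chg-ext cs none)))
    where
    none : ∀ v → (B ∩ ∁ (∁ ⁅ y ⁆)) v ≡ false
    none v with y ≟ v
    ... | yes refl rewrite eq = refl
    ... | no _ = Bool.∧-zeroʳ (B v)

  -- The edges inside `S` sum to zero, so those leaving it carry `∂ ns S`. This is minus
  -- `∂ ns (∁ S)`, hence minus the demand outside, which is the demand inside.
  inner-total : ∀ S ns cs → (∀ A → ∂ ns (A ∩ ∁ S) ≡ chg cs (A ∩ ∁ S)) → chg cs full ≡ 0₃ →
                chg (inner-charges S ns cs) full ≡ 0₃
  inner-total S ns cs out total =
    z3 6 (λ c g x o a b → (c ⊕ g , x) ∷ (0₃ ⊕ g , a) ∷ (a ⊕ o , 0₃) ∷ (x ⊕ b , 0₃) ∷ (o , b) ∷ [] , (c , 0₃))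
      (chg (inner-charges S ns cs) full) (γ (outer S ns) full) (chg cs S) (∂ ns (∁ S)) (∂ ns S) (chg cs (∁ S))
      (chg-inner S ns cs full)
      (trans (cong (_⊕ γ (outer S ns) full) (sym (∂-full (inner S ns)))) (∂-inner S ns full))
      (trans (chg-∁ (charges ns) S) (∂-full ns))
      (trans (chg-∁ cs S) total)
      (out full)

  -- Edges inside `S` become loops at `r` and are not dropped. They count zero in every cut and
  -- boundary, and since positions are kept, orientations pull back by `Reor-map`.
  collapse : VSet → Vertex → Vertex → Vertex
  collapse S r v = if S v then r else v

  both : (Vertex → Vertex) → Edge → Edge
  both ρ (u , w) = ρ u , ρ w

  first : {X : Set} → (Vertex → Vertex) → Vertex × X → Vertex × X
  first ρ (v , x) = ρ v , x

  cut-map : ∀ ρ ls A → cut (map (both ρ) ls) A ≡ cut ls (A ∘ ρ)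
  cut-map ρ []       A = refl
  cut-map ρ (_ ∷ ls) A = cong₂ _+_ refl (cut-map ρ ls A)

  cnt-map : ∀ ρ zs A → cnt (map (first ρ) zs) A ≡ cnt zs (A ∘ ρ)
  cnt-map ρ []       A = refl
  cnt-map ρ (_ ∷ zs) A = cong₂ _+_ refl (cnt-map ρ zs A)

  chg-map : ∀ ρ cs A → chg (map (first ρ) cs) A ≡ chg cs (A ∘ ρ)
  chg-map ρ []       A = refl
  chg-map ρ (_ ∷ cs) A = cong₂ _⊕_ refl (chg-map ρ cs A)

  γ-map : ∀ ρ zs A → γ (map (first ρ) zs) A ≡ γ zs (A ∘ ρ)
  γ-map ρ []       A = refl
  γ-map ρ (_ ∷ zs) A = cong₂ _⊕_ refl (γ-map ρ zs A)

  Reor-map : ∀ ρ ls {ks} → Reor ks (map (both ρ) ls) →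
             ∃[ ns ] (Reor ns ls × (∀ A → ∂ ks A ≡ ∂ ns (A ∘ ρ)))
  Reor-map ρ [] [] = [] , [] , λ A → refl
  Reor-map ρ ((u , w) ∷ ls) (same r) with ns , r′ , eq ← Reor-map ρ ls r =
    (u , w) ∷ ns , same r′ , λ A → cong (λ c → sel (A (ρ u)) 1₃ ⊕ (sel (A (ρ w)) 2₃ ⊕ c)) (eq A)
  Reor-map ρ ((u , w) ∷ ls) (flip r) with ns , r′ , eq ← Reor-map ρ ls r =
    (w , u) ∷ ns , flip r′ , λ A → cong (λ c → sel (A (ρ w)) 1₃ ⊕ (sel (A (ρ u)) 2₃ ⊕ c)) (eq A)

  Within-map : ∀ {P Q} ρ → (∀ v → P v ≡ true → Q (ρ v) ≡ true) → Within P ls → Within Q (map (both ρ) ls)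
  Within-map ρ h []             = []
  Within-map ρ h ((p , q) ∷ ps) = (h _ p , h _ q) ∷ Within-map ρ h ps

  On-map : ∀ {X : Set} {xs : List (Vertex × X)} {P Q} ρ → (∀ v → P v ≡ true → Q (ρ v) ≡ true) →
           On P xs → On Q (map (first ρ) xs)
  On-map ρ h []       = []
  On-map ρ h (p ∷ ps) = h _ p ∷ On-map ρ h ps

  -- Orient every edge at y away from it if s is false and towards it if s is true.
  aim : Vertex → Bool → Edge → Edge
  aim y s (u , w) = if (if s then ⁅ y ⁆ u else ⁅ y ⁆ w) then (w , u) else (u , w)

  Reor-aim : ∀ y s ls → Reor (map (aim y s) ls) ls
  Reor-aim y s []             = []
  Reor-aim y s ((u , w) ∷ ls) with if s then ⁅ y ⁆ u else ⁅ y ⁆ w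
  ... | true  = flip (Reor-aim y s ls)
  ... | false = same (Reor-aim y s ls)

  aim-sign : ∀ y s ls {v t zs} → Pick (v , t) (outer (∁ ⁅ y ⁆) (map (aim y s) ls)) zs → t ≡ s
  aim-sign y true ((u , w) ∷ ls) i with ⁅ y ⁆ u in e | ⁅ y ⁆ w in f
  ... | true | true rewrite e | f = aim-sign y true ls i
  ... | false | false rewrite e | f = aim-sign y true ls i
  ... | true | false rewrite e | f with i
  ...   | here    = refl
  ...   | there i = aim-sign y true ls i
  aim-sign y true ((u , w) ∷ ls) i | false | true rewrite e | f with i
  ...   | here    = refl
  ...   | there i = aim-sign y true ls i
  aim-sign y false ((u , w) ∷ ls) i with ⁅ y ⁆ u in e | ⁅ y ⁆ w in f
  ... | true | true rewrite e | f = aim-sign y false ls i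
  ... | false | false rewrite e | f = aim-sign y false ls i
  ... | true | false rewrite e | f with i
  ...   | here    = refl
  ...   | there i = aim-sign y false ls i
  aim-sign y false ((u , w) ∷ ls) i | false | true rewrite e | f with i
  ...   | here    = refl
  ...   | there i = aim-sign y false ls i

  -- Canvases after deletion of the tip

  deg′ : List Edge → List Tip → VSet → ℕ
  deg′ es zs A = cut es A + cnt zs A

  bdry : List Charge → List Tip → VSet → Z3
  bdry cs zs A = chg cs A ⊕ γ zs A

  Proper : VSet → VSet → Set
  Proper act A = (∃[ u ] (act u ≡ true × A u ≡ true)) × (∃[ w ] (act w ≡ true × A w ≡ false))

  Cond : VSet → List Edge → List Tip → List Charge → Set
  Cond act es zs cs = ∀ A → Proper act A → 4 + τ (deg′ es zs A) (bdry cs zs A) ≤ deg′ es zs A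

  -- Since the demands sum to zero, the boundary at the tip is minus `γ zs full`. As `τ` ignores the
  -- sign, the right-hand side is 4 + |τ(z)|.
  Small : List Tip → Set
  Small zs = length zs ≤ 4 + τ (length zs) (γ zs full)

  -- The bound is deg(X) > deg(z) - 2 without subtraction. The full set is left out; its degree is
  -- `length zs` anyway.
  Center : VSet → List Edge → List Tip → Vertex → Set
  Center act es zs x = act x ≡ true × (∀ A → Proper act A → A x ≡ true → length zs ≤ suc (deg′ es zs A))

  Mode : VSet → List Edge → List Tip → Set
  Mode act es zs = Small zs ⊎ ∃ (Center act es zs)

  -- The vertices in act carry the graph es left after deletion of the tip, and cs is the boundary
  -- that remains once the edges zs at the tip are oriented as prescribed.  Existence of a flow
  -- does not depend on zs, which only serves as a certificate for the degree conditions.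
  record Canvas : Set where
    constructor canvas
    field
      act    : VSet
      es     : List Edge
      zs     : List Tip
      cs     : List Charge
      es-act : Within act es
      zs-act : On act zs
      cs-act : On act cs
      total  : chg cs full ≡ 0₃
      cond   : Cond act es zs cs
      mode   : Mode act es zs

  -- The measure of the induction

  vertices : List Tip
  vertices = map (λ v → v , true) (allFin N)

  size : VSet → ℕ
  size = cnt vertices

  -- An edge weighs two and a tip edge one, so that the measure drops when one end of an edge is
  -- moved to the tip, and does not grow when edges leaving a set are turned into tip edges.
  μ : Canvas → ℕ
  μ K = size act + (2 * length es + length zs)
    where open Canvas K

  cnt-pos : ∀ zs A {v s} → (v , s) ∈ₗ zs → A v ≡ true → 1 ≤ cnt zs A
  cnt-pos (_ ∷ zs) A (here refl) p rewrite p = s≤s z≤n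
  cnt-pos (_ ∷ zs) A (there i)   p = ≤-trans (cnt-pos zs A i p) (m≤n+m _ _)

  sub-∩ : ∀ {A B : VSet} → (∀ v → A v ≡ true → B v ≡ true) → ∀ v → (B ∩ A) v ≡ A v
  sub-∩ {A} {B} h v with A v in e
  ... | true  = trans (Bool.∧-identityʳ (B v)) (h v e)
  ... | false = Bool.∧-zeroʳ (B v)

  size-≤ : ∀ A B → (∀ v → A v ≡ true → B v ≡ true) → size A ≤ size B
  size-≤ A B h = ≤-trans (≤-reflexive (sym (cnt-ext vertices (sub-∩ h))))
                         (≤-trans (m≤m+n _ _) (≤-reflexive (sym (cnt-split vertices B A))))

  size-< : ∀ A B → (∀ v → A v ≡ true → B v ≡ true) → ∀ v → B v ≡ true → A v ≡ false → size A < size B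
  size-< A B h v b a =
    lin 4 (λ p q r t → (p :≡ q :+ r) ∷ (q :≡ t) ∷ (# 1 :≤ r) ∷ [] ⊢ # 1 :+ t :≤ p)
      (size B) (size (B ∩ A)) (size (B ∩ ∁ A)) (size A)
      (cnt-split vertices B A) (cnt-ext vertices (sub-∩ h))
      (cnt-pos vertices (B ∩ ∁ A) (∈-map⁺ (λ v → v , true) (∈-allFin v)) (cong₂ (λ x y → x ∧ not y) b a))

  some : (A : VSet) → (∃[ v ] A v ≡ true) ⊎ (∀ v → A v ≡ false)
  some A with any? (λ v → A v Bool.≟ true)
  ... | yes p = inj₁ p
  ... | no ¬p = inj₂ λ v → case A v Bool.≟ true of λ where
    (yes e) → ⊥-elim (¬p (v , e))
    (no ne) → Bool.¬-not (λ e → ne e)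

  cut-∅ : ∀ es → cut es ∅ ≡ 0
  cut-∅ []       = refl
  cut-∅ (_ ∷ es) = cut-∅ es

  cut-full : ∀ es → cut es full ≡ 0
  cut-full []       = refl
  cut-full (_ ∷ es) = cut-full es

  btw-∅ : ∀ es A → btw es A ∅ ≡ 0
  btw-∅ []             A = refl
  btw-∅ ((u , w) ∷ es) A rewrite Bool.∧-zeroʳ (A u) | Bool.∧-zeroʳ (A w) = btw-∅ es A

  btw-inner : ∀ S os A B → btw (inner S os) A B ≡ btw os (A ∩ S) (B ∩ S)
  btw-inner S []             A B = refl
  btw-inner S ((u , w) ∷ os) A B with S u | S w
  ... | true | true
    rewrite Bool.∧-identityʳ (A u) | Bool.∧-identityʳ (A w)
          | Bool.∧-identityʳ (B u) | Bool.∧-identityʳ (B w) = cong₂ _+_ refl (btw-inner S os A B)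
  ... | true | false
    rewrite Bool.∧-zeroʳ (B w) | Bool.∧-zeroʳ (A w) | Bool.∧-zeroʳ (A u ∧ true) = btw-inner S os A B
  ... | false | true
    rewrite Bool.∧-zeroʳ (A u) | Bool.∧-zeroʳ (B u) | Bool.∧-zeroʳ (A w ∧ true) = btw-inner S os A B
  ... | false | false
    rewrite Bool.∧-zeroʳ (A u) | Bool.∧-zeroʳ (A w) = btw-inner S os A B

  cut-btw∁ : ∀ es A → cut es A ≡ btw es A (∁ A)
  cut-btw∁ es A = trans (cut-btw es A ∅ (λ w → Bool.∧-zeroʳ (A w)))
    (cong₂ _+_ (btw-∅ es A) (btw-ext es (λ _ → refl) (λ w → Bool.∧-identityʳ (not (A w)))))

  Within-weaken : ∀ {P Q es} → (∀ v → P v ≡ true → Q v ≡ true) → Within P es → Within Q es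
  Within-weaken h []             = []
  Within-weaken h ((p , q) ∷ ps) = (h _ p , h _ q) ∷ Within-weaken h ps

  On-weaken : ∀ {X : Set} {P Q} {xs : List (Vertex × X)} →
              (∀ v → P v ≡ true → Q v ≡ true) → On P xs → On Q xs
  On-weaken h []       = []
  On-weaken h (p ∷ ps) = h _ p ∷ On-weaken h ps

  On-++ : ∀ {X : Set} {P} {xs ys : List (Vertex × X)} → On P xs → On P ys → On P (xs ++ ys)
  On-++ []       qs = qs
  On-++ (p ∷ ps) qs = p ∷ On-++ ps qs

  On-tip-charge : ∀ {P zs} → On P zs → On P (map tip-charge zs)
  On-tip-charge []       = []
  On-tip-charge (p ∷ ps) = p ∷ On-tip-charge ps

  γ-cong : ∀ {S A B zs} → A ≗[ S ] B → On S zs → γ zs A ≡ γ zs B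
  γ-cong eq ps = chg-cong eq (On-tip-charge ps)

  -- Signs

  -- On the cycle of residues modulo 6, a liked direction leads towards 0 when it is taken away: 1
  -- and 2 like `true`, 4 and 5 like `false`, 3 likes both and 0 neither.
  likes₆ : Bool → Z3 → Bool → Bool
  likes₆ p c r = does (norm₆ p c ℕ.≟ suc (norm₆ (not p) (c ⊕ val (not r))))

  -- A vertex likes r if removing an edge that contributes val r to its boundary decreases τ.
  likes : ℕ → Z3 → Bool → Bool
  likes d = likes₆ (odd d)

  odd-pred : ∀ {n d} → suc n ≡ d → odd n ≡ not (odd d)
  odd-pred {n} refl = sym (Bool.not-involutive (odd n))

  τ-remove : ∀ {n d} → suc n ≡ d → ∀ c s → τ n (c ⊕ val s) ≤ suc (τ d c)
  τ-remove {n} refl c s = τ-down n c s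

  τ-like : ∀ {n d} → suc n ≡ d → ∀ c r → likes d c r ≡ true → suc (τ n (c ⊕ val (not r))) ≡ τ d c
  τ-like {n} {d} eq c r h rewrite odd-pred eq =
    bool 3 (λ p r h → _ , all? λ c → (likes₆ p c r Bool.≟ true) →-dec
              (suc (norm₆ (not p) (c ⊕ val (not r))) ℕ.≟ norm₆ p c)) (odd d) r true c h

  likes-some : ∀ d c → 1 ≤ τ d c → ∃[ r ] likes d c r ≡ true
  likes-some d c h with likes d c true in e | likes d c false in f
  ... | true  | _     = true , e
  ... | false | true  = false , f
  ... | false | false
    with () ← bool 1 (λ p → _ , all? λ c → (1 ≤? norm₆ p c) →-dec (likes₆ p c true Bool.≟ false) →-dec
                        (likes₆ p c false Bool.≟ false) →-dec (true Bool.≟ false)) (odd d) c h e f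

  -- A single preference means residue 1, 2, 4 or 5. Adding `val r` at equal parity moves it by two
  -- towards 0 and at most just past it: 1 goes to 5 and 2 goes to 0.
  likes-one : ∀ d c r → likes d c r ≡ true → likes d c (not r) ≡ false →
              1 ≤ τ d c × τ d c ≤ 2 × τ d (c ⊕ val r) ≤ τ d c
  likes-one d c r =
    bool 2 (λ p r → _ , all? λ c → (likes₆ p c r Bool.≟ true) →-dec (likes₆ p c (not r) Bool.≟ false) →-dec
              ((1 ≤? norm₆ p c) ×-dec (norm₆ p c ≤? 2) ×-dec (norm₆ p (c ⊕ val r) ≤? norm₆ p c))) (odd d) r c

  likes-max : ∀ d c r → 3 ≤ τ d c → likes d c r ≡ true
  likes-max d c r = bool 2 (λ p r → _ , all? λ c → (3 ≤? norm₆ p c) →-dec (likes₆ p c r Bool.≟ true)) (odd d) r c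

  -- A smallest canvas without a flow

  module Step (K : Canvas)
              (smaller : ∀ K′ → μ K′ < μ K → Flow (Canvas.es K′) (Canvas.cs K′))
              (no-flow : ¬ Flow (Canvas.es K) (Canvas.cs K)) where

    open Canvas K

    d : VSet → ℕ
    d = deg′ es zs

    σ : VSet → Z3
    σ = bdry cs zs

    D : ℕ
    D = length zs

    Γ : Z3
    Γ = γ zs full

    e : VSet → ℕ
    e = cut es

    k : VSet → ℕ
    k = cnt zs

    -- Counting the tip, `A` and its complement then both have at least two vertices, so that
    -- contracting either makes the canvas smaller.
    NT : VSet → Set
    NT A = (∃[ u ] ∃[ v ] (u ≢ v × (act u ≡ true × A u ≡ true) × (act v ≡ true × A v ≡ true)))
         × (∃[ w ] (act w ≡ true × A w ≡ false))

    NT⇒Proper : ∀ {A} → NT A → Proper act A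
    NT⇒Proper ((u , _ , _ , p , _) , q) = (u , p) , q

    Proper-∁ : ∀ {A} → Proper act A → Proper act (∁ A)
    Proper-∁ ((u , p , q) , (w , r , s)) = (w , r , cong not s) , (u , p , cong not q)

    d-cong : ∀ {A B} → A ≗[ act ] B → d A ≡ d B
    d-cong eq = cong₂ _+_ (cut-cong eq es-act) (cnt-cong eq zs-act)

    σ-cong : ∀ {A B} → A ≗[ act ] B → σ A ≡ σ B
    σ-cong eq = cong₂ _⊕_ (chg-cong eq cs-act) (γ-cong eq zs-act)

    d-∁ : ∀ A → d A + d (∁ A) ≡ 2 * e A + D
    d-∁ A = lin 5 (λ c c′ k k′ D → (c′ :≡ c) ∷ (k :+ k′ :≡ D) ∷ [] ⊢ c :+ k :+ (c′ :+ k′) :≡ 2 :* c :+ D)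
              (e A) (e (∁ A)) (k A) (k (∁ A)) D (cut-∁ es A) (cnt-∁ zs A)

    σ-∁ : ∀ A → σ A ⊕ σ (∁ A) ≡ Γ
    σ-∁ A = z3 6 (λ b b′ g g′ t G → (b ⊕ b′ , t) ∷ (t , 0₃) ∷ (g ⊕ g′ , G) ∷ [] , (b ⊕ g ⊕ (b′ ⊕ g′) , G))
              (chg cs A) (chg cs (∁ A)) (γ zs A) (γ zs (∁ A)) (chg cs full) Γ
              (chg-∁ cs A) total (chg-∁ (map tip-charge zs) A)

    -- The residues of `A` and of its complement add up to that of the tip, as `2 * e A` does not
    -- affect parity.
    τ-∁ : ∀ A → τ D Γ ≤ τ (d A) (σ A) + τ (d (∁ A)) (σ (∁ A))
    τ-∁ A = ≤-trans (≤-reflexive (trans (sym (τ-+2* D Γ (e A))) (cong₂ τ (sym (d-∁ A)) (sym (σ-∁ A)))))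
                    (τ-triangle (d A) (σ A) (d (∁ A)) (σ (∁ A)))

    d-∪ : ∀ A B → (∀ v → A v ∧ B v ≡ false) → d A + d B ≡ d (A ∪ B) + 2 * btw es A B
    d-∪ A B dis =
      lin 7 (λ a b c m x y z → (a :+ b :≡ c :+ 2 :* m) ∷ (z :≡ x :+ y) ∷ [] ⊢
               a :+ x :+ (b :+ y) :≡ c :+ z :+ 2 :* m)
        (e A) (e B) (e (A ∪ B)) (btw es A B) (k A) (k B) (k (A ∪ B)) (cut-∪ es A B dis)
        (trans (cnt-split zs (A ∪ B) A) (cong₂ _+_ (cnt-ext zs left) (cnt-ext zs right)))
      where
      left : ∀ v → (A v ∨ B v) ∧ A v ≡ A v
      left v with A v
      ... | true  = refl
      ... | false = Bool.∧-zeroʳ (B v)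

      right : ∀ v → (A v ∨ B v) ∧ not (A v) ≡ B v
      right v with A v | B v | dis v
      ... | true  | false | _ = refl
      ... | false | b     | _ = Bool.∧-identityʳ b

    -- `2 * e A` equals `d A + d (∁ A)` minus D, and both degrees are at least four. The slack of
    -- one in the mode with a centre leaves the bound 3, which is enough because the left side is
    -- even.
    e≥2 : ∀ A → Proper act A → 2 ≤ e A
    e≥2 A pr = *-cancelˡ-< 2 1 (e A) (main mode)
      where
      centered : ∀ B → Proper act B → D ≤ suc (d B) → 3 ≤ 2 * e B
      centered B pr h =
        lin 6 (λ c c′ k k′ D t → (D :≤ # 1 :+ (c :+ k)) ∷ (k :+ k′ :≡ D) ∷ (c′ :≡ c) ∷ (# 4 :+ t :≤ c′ :+ k′) ∷ []
                 ⊢ # 3 :≤ 2 :* c)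
          (e B) (e (∁ B)) (k B) (k (∁ B)) D (τ (d (∁ B)) (σ (∁ B)))
          h (cnt-∁ zs B) (cut-∁ es B) (cond (∁ B) (Proper-∁ pr))

      main : Mode act es zs → 3 ≤ 2 * e A
      main (inj₁ small) =
        lin 7 (λ a b t x y c D → (D :≤ # 4 :+ t) ∷ (t :≤ a :+ b) ∷ (# 4 :+ a :≤ x) ∷ (# 4 :+ b :≤ y) ∷
                                 (x :+ y :≡ 2 :* c :+ D) ∷ [] ⊢ # 3 :≤ 2 :* c)
          (τ (d A) (σ A)) (τ (d (∁ A)) (σ (∁ A))) (τ D Γ) (d A) (d (∁ A)) (e A) D
          small (τ-∁ A) (cond A pr) (cond (∁ A) (Proper-∁ pr)) (d-∁ A)
      main (inj₂ (x , _ , c)) with A x in ax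
      ... | true  = centered A pr (c A pr ax)
      ... | false = subst (λ n → 3 ≤ 2 * n) (cut-∁ es A)
                      (centered (∁ A) (Proper-∁ pr) (c (∁ A) (Proper-∁ pr) (cong not ax)))

    two-active : ∃[ u ] ∃[ v ] (u ≢ v × act u ≡ true × act v ≡ true)
    two-active with any? (λ u → any? λ v → ¬? (u ≟ v) ×-dec (act u Bool.≟ true) ×-dec (act v Bool.≟ true))
    ... | yes p = p
    ... | no ¬p = ⊥-elim (no-flow (es , Reor-refl es , agree))
      where
      agree : ∀ A → ∂ es A ≡ chg cs A
      agree A with some (act ∩ A)
      ... | inj₂ none = trans (trans (chg-cong off (On-charges es-act)) (chg-∅ (charges es)))
                              (sym (trans (chg-cong off cs-act) (chg-∅ cs)))
        where
        off : A ≗[ act ] ∅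
        off v p with none v
        ... | q rewrite p = q
      ... | inj₁ (u , q) = trans (trans (chg-cong on (On-charges es-act)) (∂-full es))
                                 (sym (trans (chg-cong on cs-act) total))
        where
        on : A ≗[ act ] full
        on v p with u ≟ v
        ... | yes refl = proj₂ (∧-true q)
        ... | no u≢v   = ⊥-elim (¬p (u , v , u≢v , proj₁ (∧-true q) , p))

    sing-Proper : ∀ {u v} → u ≢ v → act u ≡ true → act v ≡ true → Proper act ⁅ u ⁆
    sing-Proper {u} {v} u≢v p q = (u , p , self u) , (v , q , ⁅⁆-≢ u≢v)

    Reachable-many : ∀ m c → 2 ≤ m → Reachable m c
    Reachable-many (suc (suc m)) c (s≤s (s≤s z≤n)) = many

    pair : Vertex → Vertex → VSet
    pair u v = ⁅ u ⁆ ∪ ⁅ v ⁆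

    disjoint : ∀ {u v} → u ≢ v → ∀ w → ⁅ u ⁆ w ∧ ⁅ v ⁆ w ≡ false
    disjoint {u} {v} u≢v w with u ≟ w
    ... | yes refl = ⁅⁆-≢ (u≢v ∘ sym)
    ... | no _     = refl

    btw-none : ∀ {es A B} → (∀ u w → A u ≡ true → B w ≡ true → ∀ {fs} → ¬ (es ≋ (u , w) ∷ fs)) → btw es A B ≡ 0
    btw-none {es} {A} {B} h with btw es A B in eq
    ... | zero  = refl
    ... | suc n with u , w , fs , a , b , p ← find-edge es A B (subst (1 ≤_) (sym eq) (s≤s z≤n)) =
      ⊥-elim (h u w a b p)

    -- If only `u` and `v` were active, the two or more edges between them would realise every
    -- boundary.
    third : ∀ u v → u ≢ v → act u ≡ true → act v ≡ true → ∃[ w ] (w ≢ u × w ≢ v × act w ≡ true)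
    third u v u≢v p q with any? (λ w → ¬? (w ≟ u) ×-dec ¬? (w ≟ v) ×-dec (act w Bool.≟ true))
    ... | yes r = r
    ... | no ¬r = ⊥-elim (no-flow (flow-two u v es cs u≢v (Within-weaken inside es-act) (On-weaken inside cs-act)
                                     total (Reachable-many _ _ (subst (2 ≤_) edges (e≥2 ⁅ u ⁆ (sing-Proper u≢v p q))))))
      where
      inside : ∀ w → act w ≡ true → pair u v w ≡ true
      inside w a with u ≟ w | v ≟ w
      ... | yes _  | _      = refl
      ... | no _   | yes _  = refl
      ... | no u≢w | no v≢w = ⊥-elim (¬r (w , u≢w ∘ sym , v≢w ∘ sym , a))

      outside : ∀ w → act w ≡ true → not (⁅ u ⁆ w) ∧ not (⁅ v ⁆ w) ≡ true → ⊥
      outside w a o with ⁅ u ⁆ w | ⁅ v ⁆ w | inside w a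
      outside w a () | true  | _     | _
      outside w a () | false | true  | _

      edges : e ⁅ u ⁆ ≡ btw es ⁅ u ⁆ ⁅ v ⁆
      edges = trans (cut-btw es ⁅ u ⁆ ⁅ v ⁆ (disjoint u≢v))
                    (trans (cong (btw es ⁅ u ⁆ ⁅ v ⁆ +_) (btw-none λ x w _ o r →
                              case Within-≋ r es-act of λ { ((_ , b) ∷ _) → outside w b o }))
                           (+-identityʳ _))

    -- Contracting a set and restricting to a set

    quotient-act : VSet → Vertex → VSet
    quotient-act S r v = act v ∧ (not (S v) ∨ ⁅ r ⁆ v)

    -- The outcome speaks of preimages `A ∘ collapse S r`, so that callers never see the contracted
    -- canvas. The list `fs` need not be `es`, since `lift` lifts and contracts at once.
    quotient : ∀ fs S r → act r ≡ true → S r ≡ true → Within act fs →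
      (∀ A → Proper act (A ∘ collapse S r) →
         4 + τ (deg′ fs zs (A ∘ collapse S r)) (σ (A ∘ collapse S r)) ≤ deg′ fs zs (A ∘ collapse S r)) →
      Small zs ⊎ (∃[ x ] (act x ≡ true × (∀ A → Proper act (A ∘ collapse S r) → A (collapse S r x) ≡ true →
                                            D ≤ suc (deg′ fs zs (A ∘ collapse S r))))) →
      size (quotient-act S r) + 2 * length fs < size act + 2 * length es →
      ∃[ os ] (Reor os fs × (∀ A → ∂ os (A ∘ collapse S r) ≡ chg cs (A ∘ collapse S r)))
    quotient fs S r ar sr fs-act cond′ mode′ lt =
      let ks , s , eq = smaller K′ lt′
          os , s′ , eq′ = Reor-map ρ fs s
      in os , s′ , λ A → trans (sym (eq′ A)) (trans (eq A) (chg-map ρ cs A))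
      where
      ρ : Vertex → Vertex
      ρ = collapse S r

      keep-act : ∀ v → act v ≡ true → quotient-act S r (ρ v) ≡ true
      keep-act v a with S v in s
      ... | true  rewrite ar | self r = Bool.∨-zeroʳ (not (S r))
      ... | false rewrite a | s = refl

      act-keep : ∀ v → quotient-act S r v ≡ true → act v ≡ true × ρ v ≡ v
      act-keep v q with act v | S v
      ... | true | false = refl , refl
      ... | true | true  = refl , ⁅⁆-≡ q

      proper : ∀ A → Proper (quotient-act S r) A → Proper act (A ∘ ρ)
      proper A ((u , p , q) , (w , p′ , q′)) =
        (u , proj₁ (act-keep u p) , trans (cong A (proj₂ (act-keep u p))) q) ,
        (w , proj₁ (act-keep w p′) , trans (cong A (proj₂ (act-keep w p′))) q′)

      deg-map : ∀ A → deg′ (map (both ρ) fs) (map (first ρ) zs) A ≡ deg′ fs zs (A ∘ ρ)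
      deg-map A = cong₂ _+_ (cut-map ρ fs A) (cnt-map ρ zs A)

      bdry-map : ∀ A → bdry (map (first ρ) cs) (map (first ρ) zs) A ≡ σ (A ∘ ρ)
      bdry-map A = cong₂ _⊕_ (chg-map ρ cs A) (γ-map ρ zs A)

      mode″ : Small zs ⊎ (∃[ x ] (act x ≡ true × (∀ A → Proper act (A ∘ ρ) → A (ρ x) ≡ true →
                                                  D ≤ suc (deg′ fs zs (A ∘ ρ))))) →
              Mode (quotient-act S r) (map (both ρ) fs) (map (first ρ) zs)
      mode″ (inj₁ small) rewrite length-map (first {Bool} ρ) zs =
        inj₁ (subst (λ c → D ≤ 4 + τ D c) (sym (γ-map ρ zs full)) small)
      mode″ (inj₂ (x , a , c)) = inj₂ (ρ x , keep-act x a , λ A p q →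
        subst₂ (λ l n → l ≤ suc n) (sym (length-map (first ρ) zs)) (sym (deg-map A)) (c A (proper A p) q))

      K′ : Canvas
      K′ = canvas (quotient-act S r) (map (both ρ) fs) (map (first ρ) zs) (map (first ρ) cs)
             (Within-map ρ keep-act fs-act) (On-map ρ keep-act zs-act) (On-map ρ keep-act cs-act)
             (trans (chg-map ρ cs full) total)
             (λ A p → subst₂ (λ n c → 4 + τ n c ≤ n) (sym (deg-map A)) (sym (bdry-map A)) (cond′ A (proper A p)))
             (mode″ mode′)

      lt′ : μ K′ < μ K
      lt′ rewrite length-map (both ρ) fs | length-map (first {Bool} ρ) zs =
        lin 5 (λ a b x y z → (# 1 :+ (a :+ 2 :* b) :≤ x :+ 2 :* y) ∷ [] ⊢
                 # 1 :+ (a :+ (2 :* b :+ z)) :≤ x :+ (2 :* y :+ z))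
          (size (quotient-act S r)) (length fs) (size act) (length es) (length zs) lt

    outside : ∀ S r os → S r ≡ true → (∀ A → ∂ os (A ∘ collapse S r) ≡ chg cs (A ∘ collapse S r)) →
              ∀ A → ∂ os (A ∩ ∁ S) ≡ chg cs (A ∩ ∁ S)
    outside S r os sr h A =
      trans (chg-ext (charges os) closed) (trans (h (A ∩ ∁ S)) (sym (chg-ext cs closed)))
      where
      closed : ∀ v → (A ∩ ∁ S) v ≡ (A ∩ ∁ S) (collapse S r v)
      closed v with S v in s
      ... | true  rewrite sr = trans (Bool.∧-zeroʳ (A v)) (sym (Bool.∧-zeroʳ (A r)))
      ... | false rewrite s = refl

    -- The complement of `S` becomes the tip. Any list `zs′` certifying the conditions on `S` will
    -- do; its length is bounded only to make `μ` decrease.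
    restrict : ∀ {fs os} S → es ≋ fs → Reor os fs → (∀ A → ∂ os (A ∩ ∁ S) ≡ chg cs (A ∩ ∁ S)) →
      ∀ zs′ → On (act ∩ S) zs′ → length zs′ ≤ length zs + length (outer S os) →
      (∃[ w ] (act w ≡ true × S w ≡ false)) →
      (∀ A → Proper (act ∩ S) A →
         4 + τ (deg′ (inner S os) zs′ A) (bdry (inner-charges S os cs) zs′ A) ≤ deg′ (inner S os) zs′ A) →
      Mode (act ∩ S) (inner S os) zs′ → ⊥
    restrict {fs} {os} S p r out zs′ on len (w , a , s) cond′ mode′ =
      no-flow (Flow-≋ {cs = cs} p (flow-inner S cs r out (smaller K′ lt)))
      where
      os-act : Within act os
      os-act = Within-Reor r (Within-≋ p es-act)

      K′ : Canvas
      K′ = canvas (act ∩ S) (inner S os) zs′ (inner-charges S os cs) (inner-Within os-act) on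
             (inner-charges-On os-act cs-act) (inner-total S os cs out total) cond′ mode′

      lt : μ K′ < μ K
      lt = lin 8 (λ a b i o z z′ n m → (# 1 :+ a :≤ b) ∷ (2 :* i :+ o :≤ 2 :* n) ∷ (z′ :≤ z :+ o) ∷ (n :≡ m) ∷ [] ⊢
                    # 1 :+ (a :+ (2 :* i :+ z′)) :≤ b :+ (2 :* m :+ z))
             (size (act ∩ S)) (size act) (length (inner S os)) (length (outer S os)) (length zs) (length zs′)
             (length os) (length es)
             (size-< (act ∩ S) act (λ v q → proj₁ (∧-true q)) w a (trans (cong (act w ∧_) s) (Bool.∧-zeroʳ (act w))))
             (length-inner S os) len (trans (length-Reor r) (sym (length-≋ p)))

    Proper-inner : ∀ {S A} → Proper (act ∩ S) A → Proper act (A ∩ S)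
    Proper-inner {S} {A} ((u , p , q) , (w , p′ , q′)) =
      (u , proj₁ (∧-true p) , cong₂ _∧_ q (proj₂ (∧-true p))) ,
      (w , proj₁ (∧-true p′) , cong (_∧ S w) q′)

    deg-inner : ∀ {fs os} S → es ≋ fs → Reor os fs →
                ∀ A → deg′ (inner S os) (restr S zs ++ outer S os) A ≡ d (A ∩ S)
    deg-inner {os = os} S p r A =
      lin 7 (λ i z o c k l m → (l :≡ z :+ o) ∷ (i :+ o :≡ c) ∷ (z :≡ k) ∷ (c :≡ m) ∷ [] ⊢ i :+ l :≡ m :+ k)
        (cut (inner S os) A) (cnt (restr S zs) A) (cnt (outer S os) A) (cut os (A ∩ S)) (k (A ∩ S))
        (cnt (restr S zs ++ outer S os) A) (e (A ∩ S))
        (cnt-++ (restr S zs) (outer S os) A) (cut-inner S os A) (cnt-restr S zs A)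
        (trans (cut-Reor r (A ∩ S)) (sym (cut-≋ p (A ∩ S))))

    bdry-inner : ∀ S os A → bdry (inner-charges S os cs) (restr S zs ++ outer S os) A ≡ σ (A ∩ S)
    bdry-inner S os A =
      z3 6 (λ c l z o x g → (l , z ⊕ o) ∷ (c ⊕ o , x) ∷ (z , g) ∷ [] , (c ⊕ l , x ⊕ g))
        (chg (inner-charges S os cs) A) (γ (restr S zs ++ outer S os) A) (γ (restr S zs) A) (γ (outer S os) A)
        (chg cs (A ∩ S)) (γ zs (A ∩ S))
        (γ-++ (restr S zs) (outer S os) A) (chg-inner S os cs A) (γ-restr S zs A)

    length-inner-tips : ∀ {fs os} S → es ≋ fs → Reor os fs → length (restr S zs ++ outer S os) ≡ d S
    length-inner-tips {os = os} S p r =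
      trans (sym (cnt-full (restr S zs ++ outer S os)))
            (trans (cong (_+ cnt (restr S zs ++ outer S os) full) (sym (cut-full (inner S os))))
                   (deg-inner S p r full))

    size-quotient : ∀ S r → size (quotient-act S r) ≤ size act
    size-quotient S r = size-≤ _ act λ v q → proj₁ (∧-true q)

    -- Sets of the contracted canvas and of the canvas on `S` are sets of `K` with the same degrees,
    -- so both inherit `Cond`, and the first also inherits the mode. What remains is the mode at the
    -- new tip of degree `d S`; the last hypothesis is exactly that.
    contract : ∀ S → NT S →
      d S ≤ 4 + τ (d S) (σ S) ⊎
      (∃[ x ] (act x ≡ true × S x ≡ true ×
               (∀ A → Proper act (A ∩ S) → (A ∩ S) x ≡ true → d S ≤ suc (d (A ∩ S))))) → ⊥
    contract S ((u , v , u≢v , (au , su) , (av , sv)) , w) m =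
      let os , r , h = quotient es S u au su es-act (λ A → cond _) mode′ lt
          out = outside S u os su h
      in restrict S ≋-refl r out (restr S zs ++ outer S os)
           (On-++ (restr-On zs-act) (outer-On (Within-Reor r es-act)))
           (≤-trans (≤-reflexive (length-++ (restr S zs))) (+-monoˡ-≤ _ (length-restr S zs))) w
           (λ A p → subst₂ (λ n c → 4 + τ n c ≤ n) (sym (deg-inner S ≋-refl r A)) (sym (bdry-inner S os A))
                      (cond (A ∩ S) (Proper-inner p)))
           (inner-mode os r out m)
      where
      mode′ : Small zs ⊎ (∃[ x ] (act x ≡ true × (∀ A → Proper act (A ∘ collapse S u) →
                A (collapse S u x) ≡ true → D ≤ suc (d (A ∘ collapse S u)))))
      mode′ with mode
      ... | inj₁ small       = inj₁ small
      ... | inj₂ (x , a , c) = inj₂ (x , a , λ A p q → c _ p q)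

      lt : size (quotient-act S u) + 2 * length es < size act + 2 * length es
      lt = +-monoˡ-< _ (size-< (quotient-act S u) act (λ x q → proj₁ (∧-true q)) v av
             (trans (cong₂ (λ a b → act v ∧ (not a ∨ b)) sv (⁅⁆-≢ u≢v)) (Bool.∧-zeroʳ (act v))))

      inner-mode : ∀ os → Reor os es → (∀ A → ∂ os (A ∩ ∁ S) ≡ chg cs (A ∩ ∁ S)) →
        d S ≤ 4 + τ (d S) (σ S) ⊎
        (∃[ x ] (act x ≡ true × S x ≡ true ×
                 (∀ A → Proper act (A ∩ S) → (A ∩ S) x ≡ true → d S ≤ suc (d (A ∩ S))))) →
        Mode (act ∩ S) (inner S os) (restr S zs ++ outer S os)
      inner-mode os r out (inj₁ small) = inj₁ (subst₂ (λ n c → n ≤ 4 + τ n c) (sym len) (sym gam) small)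
        where
        gam : γ (restr S zs ++ outer S os) full ≡ σ S
        gam = trans (cong (_⊕ γ (restr S zs ++ outer S os) full) (sym (inner-total S os cs out total)))
                    (bdry-inner S os full)

        len : length (restr S zs ++ outer S os) ≡ d S
        len = length-inner-tips S ≋-refl r
      inner-mode os r out (inj₂ (x , a , s , c)) = inj₂ (x , cong₂ _∧_ a s , λ A p q →
        subst₂ (λ l n → l ≤ suc n) (sym (length-inner-tips S ≋-refl r)) (sym (deg-inner S ≋-refl r A))
               (c A (Proper-inner p) (cong₂ _∧_ q s)))

    NT-loose : ∀ S → NT S → 6 + τ (d S) (σ S) ≤ d S
    NT-loose S nt with tight-or-loose (d S) (σ S) (cond S (NT⇒Proper nt))
    ... | inj₁ tight = ⊥-elim (contract S nt (inj₁ (≤-reflexive tight)))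
    ... | inj₂ loose = loose

    -- If `d S ≤ D`, then `x` is also a centre of the canvas on `S`, whose tip has degree `d S`.
    NT-center : ∀ {x} → Center act es zs x → ∀ S → NT S → S x ≡ true → suc D ≤ d S
    NT-center {x} (a , c) S nt s with suc D ≤? d S
    ... | yes p = p
    ... | no ¬p = ⊥-elim (contract S nt (inj₂ (x , a , s , λ A p q → ≤-trans (≤-pred (≰⇒> ¬p)) (c _ p q))))

    -- Parallel edges, lifting, and vertices of degree four

    not-true : ∀ {a} → not a ≡ true → a ≡ false
    not-true {false} _ = refl

    pair-NT : ∀ {u v} → u ≢ v → act u ≡ true → act v ≡ true → NT (pair u v)
    pair-NT {u} {v} u≢v p q with w , w≢u , w≢v , a ← third u v u≢v p q =
      (u , v , u≢v , (p , cong (_∨ ⁅ v ⁆ u) (self u)) ,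
        (q , trans (cong (⁅ u ⁆ v ∨_) (self v)) (Bool.∨-zeroʳ (⁅ u ⁆ v)))) ,
      (w , a , cong₂ _∨_ (⁅⁆-≢ (w≢u ∘ sym)) (⁅⁆-≢ (w≢v ∘ sym)))

    pair-flow : ∀ {fs os} u v → u ≢ v → es ≋ fs → Reor os fs →
      (∀ A → ∂ os (A ∩ ∁ (pair u v)) ≡ chg cs (A ∩ ∁ (pair u v))) →
      Reachable (btw es ⁅ u ⁆ ⁅ v ⁆) (chg (inner-charges (pair u v) os cs) ⁅ u ⁆) → ⊥
    pair-flow {fs} {os} u v u≢v p r out reach =
      no-flow (Flow-≋ {cs = cs} p (flow-inner (pair u v) cs r out
        (flow-two u v (inner (pair u v) os) (inner-charges (pair u v) os cs) u≢v
          (Within-weaken (λ w q → proj₂ (∧-true q)) (inner-Within {S = pair u v} os-act))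
          (On-weaken (λ w q → proj₂ (∧-true q)) (inner-charges-On {S = pair u v} os-act cs-act))
          (inner-total (pair u v) os cs out total)
          (subst (λ m → Reachable m (chg (inner-charges (pair u v) os cs) ⁅ u ⁆)) (sym count) reach))))
      where
      os-act : Within act os
      os-act = Within-Reor r (Within-≋ p es-act)

      count : btw (inner (pair u v) os) ⁅ u ⁆ ⁅ v ⁆ ≡ btw es ⁅ u ⁆ ⁅ v ⁆
      count = trans (btw-inner (pair u v) os ⁅ u ⁆ ⁅ v ⁆)
                (trans (btw-ext os (λ w → Bool.∧-abs-∨ (⁅ u ⁆ w) (⁅ v ⁆ w)) (λ w → absorb (⁅ u ⁆ w) (⁅ v ⁆ w)))
                  (trans (btw-Reor r ⁅ u ⁆ ⁅ v ⁆) (sym (btw-≋ p ⁅ u ⁆ ⁅ v ⁆))))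
        where
        absorb : ∀ a b → b ∧ (a ∨ b) ≡ b
        absorb a b = trans (cong (b ∧_) (Bool.∨-comm a b)) (Bool.∧-abs-∨ b a)

    mode-contracted : ∀ S r → Small zs ⊎ (∃[ x ] (act x ≡ true × (∀ A → Proper act (A ∘ collapse S r) →
                        A (collapse S r x) ≡ true → D ≤ suc (d (A ∘ collapse S r)))))
    mode-contracted S r with mode
    ... | inj₁ small       = inj₁ small
    ... | inj₂ (x , a , c) = inj₂ (x , a , λ A p q → c _ p q)

    -- Two parallel edges realise every boundary, so once the pair is contracted and the rest is
    -- solved, the pair can be completed.
    simple : ∀ u v → u ≢ v → act u ≡ true → act v ≡ true → btw es ⁅ u ⁆ ⁅ v ⁆ ≤ 1
    simple u v u≢v au av with btw es ⁅ u ⁆ ⁅ v ⁆ ≤? 1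
    ... | yes p = p
    ... | no ¬p =
      let su = cong (_∨ ⁅ v ⁆ u) (self u)
          os , r , h = quotient es (pair u v) u au su es-act (λ A → cond _)
                         (mode-contracted (pair u v) u) lt
      in ⊥-elim (pair-flow u v u≢v ≋-refl r (outside (pair u v) u os su h) (Reachable-many _ _ (≰⇒> ¬p)))
      where
      lt : size (quotient-act (pair u v) u) + 2 * length es < size act + 2 * length es
      lt = +-monoˡ-< _ (size-< (quotient-act (pair u v) u) act (λ x q → proj₁ (∧-true q)) v av
             (trans (cong₂ (λ a b → act v ∧ (not (⁅ u ⁆ v ∨ a) ∨ b)) (self v) (⁅⁆-≢ u≢v))
                    (trans (cong (λ b → act v ∧ (not b ∨ false)) (Bool.∨-zeroʳ (⁅ u ⁆ v))) (Bool.∧-zeroʳ (act v)))))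

    neighbour : ∀ {fs} v C → act v ≡ true → Within act fs → C v ≡ false → btw fs ⁅ v ⁆ C < cut fs ⁅ v ⁆ →
                ∃[ a ] ∃[ gs ] (v ≢ a × act a ≡ true × C a ≡ false × fs ≋ (v , a) ∷ gs)
    neighbour {fs} v C av ins cv lt
      with find-edge fs ⁅ v ⁆ (∁ ⁅ v ⁆ ∩ ∁ C)
             (lin 3 (λ c m n → (# 1 :+ m :≤ c) ∷ (c :≡ m :+ n) ∷ [] ⊢ # 1 :≤ n)
                (cut fs ⁅ v ⁆) (btw fs ⁅ v ⁆ C) _ lt (cut-btw fs ⁅ v ⁆ C dis))
      where
      dis : ∀ w → ⁅ v ⁆ w ∧ C w ≡ false
      dis w with v ≟ w
      ... | yes refl = cv
      ... | no _     = refl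
    ... | u , a , gs , p , q , r with refl ← ⁅⁆-≡ {v} {u} p with (_ , aa) ∷ _ ← Within-≋ r ins =
      a , gs , v≢a , aa , notC , r
      where
      v≢a : v ≢ a
      v≢a refl with () ← trans (sym (cong not (self v))) (proj₁ (∧-true {not (⁅ v ⁆ a)} q))

      notC : C a ≡ false
      notC = not-true (proj₂ (∧-true {not (⁅ v ⁆ a)} q))

    -- By `simple`, the first neighbour accounts for one edge only, so a further edge has a
    -- different end.
    two-neighbours : ∀ v C → act v ≡ true → C v ≡ false → 2 + btw es ⁅ v ⁆ C ≤ e ⁅ v ⁆ →
      ∃[ a ] ∃[ c ] ∃[ fs ] (v ≢ a × v ≢ c × a ≢ c × C a ≡ false × C c ≡ false × es ≋ (v , a) ∷ (v , c) ∷ fs)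
    two-neighbours v C av cv h
      with a , gs , v≢a , aa , ca , p ← neighbour v C av es-act cv (≤-trans (n≤1+n _) h)
      with gs-act ← Within-≋ p es-act
      with find-edge gs ⁅ v ⁆ (∁ ⁅ v ⁆ ∩ ∁ (C ∪ ⁅ a ⁆)) (more a gs v≢a aa ca p)
      where
      more : ∀ a gs → v ≢ a → act a ≡ true → C a ≡ false → es ≋ (v , a) ∷ gs →
             1 ≤ btw gs ⁅ v ⁆ (∁ ⁅ v ⁆ ∩ ∁ (C ∪ ⁅ a ⁆))
      more a gs v≢a aa ca p =
        lin 7 (λ c m u n s t g → (# 2 :+ m :≤ c) ∷ (c :≡ u :+ n) ∷ (u :≤ m :+ s) ∷ (s :≤ # 1) ∷ (n :≡ t) ∷ (t :≡ g) ∷ [] ⊢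
                              # 1 :≤ g)
          (e ⁅ v ⁆) (btw es ⁅ v ⁆ C) (btw es ⁅ v ⁆ (C ∪ ⁅ a ⁆)) (btw es ⁅ v ⁆ B) (btw es ⁅ v ⁆ ⁅ a ⁆)
          (btw ((v , a) ∷ gs) ⁅ v ⁆ B) (btw gs ⁅ v ⁆ B)
          h (cut-btw es ⁅ v ⁆ (C ∪ ⁅ a ⁆) dis) (btw-∪ es ⁅ v ⁆ C ⁅ a ⁆) (simple v a v≢a av aa)
          (btw-≋ p ⁅ v ⁆ B) (cong (λ b → ind b + btw gs ⁅ v ⁆ B) head)
        where
        B : VSet
        B = ∁ ⁅ v ⁆ ∩ ∁ (C ∪ ⁅ a ⁆)

        dis : ∀ w → ⁅ v ⁆ w ∧ (C w ∨ ⁅ a ⁆ w) ≡ false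
        dis w with v ≟ w
        ... | yes refl = cong₂ _∨_ cv (⁅⁆-≢ (v≢a ∘ sym))
        ... | no _     = refl

        head : (⁅ v ⁆ v ∧ B a) ∨ (⁅ v ⁆ a ∧ B v) ≡ false
        head rewrite ⁅⁆-≢ v≢a | self a | Bool.∨-zeroʳ (C a) | self v = refl
    ... | u , c , fs , x , y , q with refl ← ⁅⁆-≡ {v} {u} x =
      a , c , fs , v≢a , v≢c , a≢c , ca , cc , ≋-trans p (≋-cons q)
      where
      y′ : C c ∨ ⁅ a ⁆ c ≡ false
      y′ = not-true (proj₂ (∧-true {not (⁅ v ⁆ c)} y))

      v≢c : v ≢ c
      v≢c refl with () ← trans (sym (cong not (self v))) (proj₁ (∧-true {not (⁅ v ⁆ c)} y))

      a≢c : a ≢ c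
      a≢c refl with () ← trans (sym y′) (trans (cong (C a ∨_) (self a)) (Bool.∨-zeroʳ (C a)))

      cc : C c ≡ false
      cc with C c | y′
      ... | false | _ = refl

    -- Contract S to r and replace two edges leaving S at u₁ and u₂ by one edge joining their
    -- other ends a and c: one of the two edges is then directed out of S and one into S.
    lift : ∀ S r u₁ u₂ a c fs → act r ≡ true → S r ≡ true → S u₁ ≡ true → S u₂ ≡ true →
      S a ≡ false → S c ≡ false → a ≢ c → es ≋ (u₁ , a) ∷ (u₂ , c) ∷ fs →
      6 + τ (d S) (σ S) ≤ d S →
      Small zs ⊎ (∃[ x ] (Center act es zs x × (S x ≡ true → suc D ≤ d S))) →
      ∃[ os ] (Reor os ((u₁ , a) ∷ (u₂ , c) ∷ fs) × (∀ A → ∂ os (A ∘ collapse S r) ≡ chg cs (A ∘ collapse S r)) ×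
               (∃[ os′ ] (os ≡ (u₁ , a) ∷ (c , u₂) ∷ os′ ⊎ os ≡ (a , u₁) ∷ (u₂ , c) ∷ os′)))
    lift S r u₁ u₂ a c fs ar sr s₁ s₂ sa sc a≢c p looseS m =
      unlift (quotient ((a , c) ∷ fs) S r ar sr (lifted-act (Within-≋ p es-act)) cond′ (mode′ m) lt)
      where
      ρ : Vertex → Vertex
      ρ = collapse S r

      lifted-act : Within act ((u₁ , a) ∷ (u₂ , c) ∷ fs) → Within act ((a , c) ∷ fs)
      lifted-act ((_ , aa) ∷ (_ , ac) ∷ ps) = (aa , ac) ∷ ps

      act-a : act a ≡ true
      act-a with (_ , q) ∷ _ ← Within-≋ p es-act = q

      act-c : act c ≡ true
      act-c with _ ∷ (_ , q) ∷ _ ← Within-≋ p es-act = q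

      ρ-in : ∀ {v} → S v ≡ true → ρ v ≡ r
      ρ-in s rewrite s = refl

      ρ-out : ∀ {v} → S v ≡ false → ρ v ≡ v
      ρ-out s rewrite s = refl

      d′ : VSet → ℕ
      d′ = deg′ ((a , c) ∷ fs) zs

      d-split : ∀ A → d (A ∘ ρ) ≡ ind (A r xor A a) + (ind (A r xor A c) + (cut fs (A ∘ ρ) + k (A ∘ ρ)))
      d-split A = trans (cong (_+ k (A ∘ ρ)) (cut-≋ p (A ∘ ρ))) (trans
        (cong₂ (λ x y → x + (y + cut fs (A ∘ ρ)) + k (A ∘ ρ))
           (cong₂ (λ x y → ind (A x xor A y)) (ρ-in s₁) (ρ-out sa))
           (cong₂ (λ x y → ind (A x xor A y)) (ρ-in s₂) (ρ-out sc)))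
        (lin 4 (λ x y f z → [] ⊢ x :+ (y :+ f) :+ z :≡ x :+ (y :+ (f :+ z)))
           (ind (A r xor A a)) (ind (A r xor A c)) (cut fs (A ∘ ρ)) (k (A ∘ ρ))))

      d′-split : ∀ A → d′ (A ∘ ρ) ≡ ind (A a xor A c) + (cut fs (A ∘ ρ) + k (A ∘ ρ))
      d′-split A = trans (cong₂ (λ x y → ind (A x xor A y) + cut fs (A ∘ ρ) + k (A ∘ ρ)) (ρ-out sa) (ρ-out sc))
                         (+-assoc (ind (A a xor A c)) (cut fs (A ∘ ρ)) (k (A ∘ ρ)))

      S-or-NT : ∀ A → Proper act (A ∘ ρ) → A r ≡ true → (A ∘ ρ) ≗[ act ] S ⊎ NT (A ∘ ρ)
      S-or-NT A (_ , w) tr with some (act ∩ ((A ∘ ρ) ∩ ∁ S))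
      ... | inj₁ (v , q) = inj₂ ((r , v , r≢v , (ar , trans (cong A (ρ-in sr)) tr) ,
                                  (proj₁ (∧-true q) , proj₁ (∧-true (proj₂ (∧-true {act v} q))))) , w)
        where
        r≢v : r ≢ v
        r≢v refl with () ← trans (sym (cong not sr)) (proj₂ (∧-true {A (ρ v)} (proj₂ (∧-true {act v} q))))
      ... | inj₂ none = inj₁ eq
        where
        eq : (A ∘ ρ) ≗[ act ] S
        eq v av with S v in sv | none v
        ... | true  | _ = tr
        ... | false | q rewrite av | Bool.∧-identityʳ (A v) = q

      -- Only sets crossed by both edges lose degree.
      drop : ∀ A → Proper act (A ∘ ρ) →
             d (A ∘ ρ) ≡ d′ (A ∘ ρ) ⊎ (d (A ∘ ρ) ≡ 2 + d′ (A ∘ ρ) × ((A ∘ ρ) ≗[ act ] S ⊎ NT (A ∘ ρ)))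
      drop A pr with A r in er | A a in ea | A c in ec | d-split A | d′-split A
      ... | true  | true  | true  | x | y = inj₁ (trans x (sym y))
      ... | false | false | false | x | y = inj₁ (trans x (sym y))
      ... | true  | true  | false | x | y = inj₁ (trans x (sym y))
      ... | true  | false | true  | x | y = inj₁ (trans x (sym y))
      ... | false | true  | false | x | y = inj₁ (trans x (sym y))
      ... | false | false | true  | x | y = inj₁ (trans x (sym y))
      ... | true  | false | false | x | y = inj₂ (trans x (cong (2 +_) (sym y)) , S-or-NT A pr er)
      ... | false | true  | true  | x | y =
        inj₂ (trans x (cong (2 +_) (sym y)) ,
              inj₂ ((a , c , a≢c , (act-a , trans (cong A (ρ-out sa)) ea) , (act-c , trans (cong A (ρ-out sc)) ec)) ,
                    proj₂ pr))

      loose : ∀ A → (A ∘ ρ) ≗[ act ] S ⊎ NT (A ∘ ρ) → 6 + τ (d (A ∘ ρ)) (σ (A ∘ ρ)) ≤ d (A ∘ ρ)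
      loose A (inj₁ eq) = subst₂ (λ n c → 6 + τ n c ≤ n) (sym (d-cong eq)) (sym (σ-cong eq)) looseS
      loose A (inj₂ nt) = NT-loose (A ∘ ρ) nt

      cond′ : ∀ A → Proper act (A ∘ ρ) → 4 + τ (d′ (A ∘ ρ)) (σ (A ∘ ρ)) ≤ d′ (A ∘ ρ)
      cond′ A pr with drop A pr
      ... | inj₁ eq = subst (λ n → 4 + τ n (σ (A ∘ ρ)) ≤ n) eq (cond (A ∘ ρ) pr)
      ... | inj₂ (eq , q) =
        lin 4 (λ n n′ t t′ → (n :≡ # 2 :+ n′) ∷ (t :≡ t′) ∷ (# 6 :+ t :≤ n) ∷ [] ⊢ # 4 :+ t′ :≤ n′)
          (d (A ∘ ρ)) (d′ (A ∘ ρ)) (τ (d (A ∘ ρ)) (σ (A ∘ ρ))) (τ (d′ (A ∘ ρ)) (σ (A ∘ ρ)))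
          eq (trans (cong (λ n → τ n (σ (A ∘ ρ))) eq) (τ-+2* (d′ (A ∘ ρ)) (σ (A ∘ ρ)) 1)) (loose A q)

      mode′ : Small zs ⊎ (∃[ x ] (Center act es zs x × (S x ≡ true → suc D ≤ d S))) →
              Small zs ⊎ (∃[ x ] (act x ≡ true × (∀ A → Proper act (A ∘ ρ) → A (ρ x) ≡ true →
                                                    D ≤ suc (d′ (A ∘ ρ)))))
      mode′ (inj₁ small) = inj₁ small
      mode′ (inj₂ (x , ctr , hS)) = inj₂ (x , proj₁ ctr , λ A pr q → case drop A pr of λ where
        (inj₁ eq) → subst (λ n → D ≤ suc n) eq (proj₂ ctr (A ∘ ρ) pr q)
        (inj₂ (eq , inj₁ same-S)) → ≤-pred (subst (suc D ≤_) (trans (sym (d-cong same-S)) eq)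
                                     (hS (trans (sym (same-S x (proj₁ ctr))) q)))
        (inj₂ (eq , inj₂ nt)) → ≤-pred (subst (suc D ≤_) eq (NT-center ctr (A ∘ ρ) nt q)))

      lt : size (quotient-act S r) + 2 * length ((a , c) ∷ fs) < size act + 2 * length es
      lt = lin 4 (λ x y n m → (x :≤ y) ∷ (m :≡ # 2 :+ n) ∷ [] ⊢ # 1 :+ (x :+ 2 :* (# 1 :+ n)) :≤ y :+ 2 :* m)
             (size (quotient-act S r)) (size act) (length fs) (length es) (size-quotient S r) (length-≋ p)

      unlift : ∃[ os ] (Reor os ((a , c) ∷ fs) × (∀ A → ∂ os (A ∘ ρ) ≡ chg cs (A ∘ ρ))) →
               ∃[ os ] (Reor os ((u₁ , a) ∷ (u₂ , c) ∷ fs) × (∀ A → ∂ os (A ∘ ρ) ≡ chg cs (A ∘ ρ)) ×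
                        (∃[ os′ ] (os ≡ (u₁ , a) ∷ (c , u₂) ∷ os′ ⊎ os ≡ (a , u₁) ∷ (u₂ , c) ∷ os′)))
      unlift (_ , same {os} s , h) =
        (a , u₁) ∷ (u₂ , c) ∷ os , flip (same s) , (λ A → trans (through A) (h A)) , os , inj₂ refl
        where
        through : ∀ A → ∂ ((a , u₁) ∷ (u₂ , c) ∷ os) (A ∘ ρ) ≡ ∂ ((a , c) ∷ os) (A ∘ ρ)
        through A = trans
          (cong₂ (λ x y → sel (A (ρ a)) 1₃ ⊕ (sel (A x) 2₃ ⊕ (sel (A y) 1₃ ⊕ (sel (A (ρ c)) 2₃ ⊕ ∂ os (A ∘ ρ)))))
                 (ρ-in s₁) (ρ-in s₂))
          (bool 3 (λ x y z → _ , all? λ o → sel x 1₃ ⊕ (sel y 2₃ ⊕ (sel y 1₃ ⊕ (sel z 2₃ ⊕ o))) ≟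
                                              sel x 1₃ ⊕ (sel z 2₃ ⊕ o))
             (A (ρ a)) (A r) (A (ρ c)) (∂ os (A ∘ ρ)))
      unlift (_ , flip {os} s , h) =
        (u₁ , a) ∷ (c , u₂) ∷ os , same (flip s) , (λ A → trans (through A) (h A)) , os , inj₁ refl
        where
        through : ∀ A → ∂ ((u₁ , a) ∷ (c , u₂) ∷ os) (A ∘ ρ) ≡ ∂ ((c , a) ∷ os) (A ∘ ρ)
        through A = trans
          (cong₂ (λ x y → sel (A x) 1₃ ⊕ (sel (A (ρ a)) 2₃ ⊕ (sel (A (ρ c)) 1₃ ⊕ (sel (A y) 2₃ ⊕ ∂ os (A ∘ ρ)))))
                 (ρ-in s₁) (ρ-in s₂))
          (bool 3 (λ x y z → _ , all? λ o → sel y 1₃ ⊕ (sel x 2₃ ⊕ (sel z 1₃ ⊕ (sel y 2₃ ⊕ o))) ≟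
                                              sel z 1₃ ⊕ (sel x 2₃ ⊕ o))
             (A (ρ a)) (A r) (A (ρ c)) (∂ os (A ∘ ρ)))

    -- Degrees of single vertices

    another : ∀ v → ∃[ w ] (w ≢ v × act w ≡ true)
    another v with u , w , u≢w , p , q ← two-active with u ≟ v
    ... | no u≢v   = u , u≢v , p
    ... | yes refl = w , u≢w ∘ sym , q

    vertex-Proper : ∀ v → act v ≡ true → Proper act ⁅ v ⁆
    vertex-Proper v av with w , w≢v , aw ← another v = sing-Proper (w≢v ∘ sym) av aw

    -- What lifting at `A` needs to preserve the mode: losing two from the degree of a set around
    -- the centre must leave at least D - 1.
    Big : Mode act es zs → VSet → Set
    Big (inj₁ _)       A = ⊤
    Big (inj₂ (x , _)) A = A x ≡ true → suc D ≤ d A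

    Away : Mode act es zs → Vertex → Set
    Away (inj₁ _)       v = ⊤
    Away (inj₂ (x , _)) v = x ≢ v

    NT-Big : ∀ m A → NT A → Big m A
    NT-Big (inj₁ _)         A nt = tt
    NT-Big (inj₂ (x , ctr)) A nt = NT-center ctr A nt

    Away-Big : ∀ m v → Away m v → Big m ⁅ v ⁆
    Away-Big (inj₁ _)       v aw = tt
    Away-Big (inj₂ (x , _)) v aw = λ p → ⊥-elim (aw (sym (⁅⁆-≡ p)))

    big-mode : ∀ m A → Big m A → Small zs ⊎ (∃[ x ] (Center act es zs x × (A x ≡ true → suc D ≤ d A)))
    big-mode (inj₁ small)     A b = inj₁ small
    big-mode (inj₂ (x , ctr)) A b = inj₂ (x , ctr , b)

    -- Two edges at `v` are lifted; contracting `⁅ v ⁆` to `v` itself changes nothing, so the flow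
    -- obtained is one of the original canvas.
    not-loose : ∀ m v → act v ≡ true → Big m ⁅ v ⁆ → 6 + τ (d ⁅ v ⁆) (σ ⁅ v ⁆) ≤ d ⁅ v ⁆ → ⊥
    not-loose m v av big loose =
      let a , c , fs , v≢a , v≢c , a≢c , _ , _ , p =
            two-neighbours v ∅ av refl (subst (λ n → 2 + n ≤ e ⁅ v ⁆) (sym (btw-∅ es ⁅ v ⁆))
                                         (e≥2 ⁅ v ⁆ (vertex-Proper v av)))
          os , r , h , _ = lift ⁅ v ⁆ v v v a c fs av (self v) (self v) (self v) (⁅⁆-≢ v≢a) (⁅⁆-≢ v≢c) a≢c p
                             loose (big-mode m ⁅ v ⁆ big)
      in no-flow (Flow-≋ {cs = cs} p (os , r , λ A →
           trans (chg-ext {A} {A ∘ collapse ⁅ v ⁆ v} (charges os) (trivial A))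
                 (trans (h A) (sym (chg-ext {A} {A ∘ collapse ⁅ v ⁆ v} cs (trivial A))))))
      where
      trivial : ∀ (A : VSet) w → A w ≡ A (collapse ⁅ v ⁆ v w)
      trivial A w with v ≟ w
      ... | yes refl = refl
      ... | no _     = refl

    ∁-NT : ∀ v → act v ≡ true → NT (∁ ⁅ v ⁆)
    ∁-NT v av with u , u≢v , au ← another v with w , w≢u , w≢v , aw ← third u v u≢v au av =
      (u , w , w≢u ∘ sym , (au , cong not (⁅⁆-≢ (u≢v ∘ sym))) , (aw , cong not (⁅⁆-≢ (w≢v ∘ sym)))) ,
      (v , av , cong not (self v))

    -- The complement of `v` is non-trivial, and the lower bound on its degree forces at least three
    -- of the four edges at `v` to avoid the tip.
    four-tips : ∀ m v → act v ≡ true → Away m v → d ⁅ v ⁆ ≡ 4 → σ ⁅ v ⁆ ≡ 0₃ → k ⁅ v ⁆ ≤ 1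
    four-tips m v av aw d≡4 σ≡0 = ≤-pred (*-cancelˡ-< 2 (k ⁅ v ⁆) 2 (bound m aw))
      where
      bound : ∀ m → Away m v → 2 * k ⁅ v ⁆ < 4
      bound (inj₁ small) _ =
        lin 8 (λ D t a b x y c k → (D :≤ # 4 :+ t) ∷ (t :≤ a :+ b) ∷ (a :≡ # 0) ∷ (# 6 :+ b :≤ y) ∷
                                   (x :+ y :≡ 2 :* c :+ D) ∷ (x :≡ # 4) ∷ (x :≡ c :+ k) ∷ [] ⊢ # 1 :+ 2 :* k :≤ # 4)
          D (τ D Γ) (τ (d ⁅ v ⁆) (σ ⁅ v ⁆)) (τ (d (∁ ⁅ v ⁆)) (σ (∁ ⁅ v ⁆))) (d ⁅ v ⁆) (d (∁ ⁅ v ⁆)) (e ⁅ v ⁆) (k ⁅ v ⁆)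
          small (τ-∁ ⁅ v ⁆) (cong₂ τ d≡4 σ≡0) (NT-loose (∁ ⁅ v ⁆) (∁-NT v av)) (d-∁ ⁅ v ⁆) d≡4 refl
      bound (inj₂ (x , ctr)) x≢v =
        lin 5 (λ D x y c k → (# 1 :+ D :≤ y) ∷ (x :+ y :≡ 2 :* c :+ D) ∷ (x :≡ # 4) ∷ (x :≡ c :+ k) ∷ [] ⊢
                               # 1 :+ 2 :* k :≤ # 4)
          D (d ⁅ v ⁆) (d (∁ ⁅ v ⁆)) (e ⁅ v ⁆) (k ⁅ v ⁆)
          (NT-center ctr (∁ ⁅ v ⁆) (∁-NT v av) (cong not (⁅⁆-≢ (x≢v ∘ sym)))) (d-∁ ⁅ v ⁆) d≡4 refl

    not-∨ : ∀ a b → not (a ∨ b) ≡ not a ∧ not b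
    not-∨ = bool 2 λ a b → _ , (not (a ∨ b) Bool.≟ not a ∧ not b)

    outer-head : ∀ S {u w} os → S u ≡ true → S w ≡ false → outer S ((u , w) ∷ os) ≡ (u , true) ∷ outer S os
    outer-head S os p q rewrite p | q = refl

    outer-head′ : ∀ S {u w} os → S u ≡ false → S w ≡ true → outer S ((u , w) ∷ os) ≡ (w , false) ∷ outer S os
    outer-head′ S os p q rewrite p | q = refl

    single-tip : ∀ zs A → cnt zs A ≡ 1 → γ zs A ≢ 0₃
    single-tip zs A p q with τ-tips zs A
    ... | h rewrite p | q with () ← ≤-pred h

    Reachable-pos : ∀ m c → 1 ≤ m → c ≢ 0₃ → Reachable m c
    Reachable-pos (suc (suc m)) c  _ _ = many
    Reachable-pos (suc zero)    0₃ _ q = ⊥-elim (q refl)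
    Reachable-pos (suc zero)    1₃ _ q = one true
    Reachable-pos (suc zero)    2₃ _ q = one false

    -- Two edges at `v` are lifted while `v` is contracted with a third neighbour `a`. The lifted
    -- pair cancels at `v`, so besides the edge to `a` just one of the four edges counts. Hence that
    -- edge has to carry 1 or -1 and never 0, which a single edge can do.
    not-four : ∀ m v → act v ≡ true → Away m v → d ⁅ v ⁆ ≡ 4 → σ ⁅ v ⁆ ≡ 0₃ → ⊥
    not-four m v av aw d≡4 σ≡0 =
      let a , gs , v≢a , aa , _ , p₀ =
            neighbour v ∅ av es-act refl (subst (_< e ⁅ v ⁆) (sym (btw-∅ es ⁅ v ⁆))
                                           (≤-trans (s≤s z≤n) (e≥2 ⁅ v ⁆ (vertex-Proper v av))))
          b , c , fs , v≢b , v≢c , b≢c , ab , ac , p =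
            two-neighbours v ⁅ a ⁆ av (⁅⁆-≢ (v≢a ∘ sym))
              (lin 4 (λ m e k d → (m :≤ # 1) ∷ (d :≡ e :+ k) ∷ (d :≡ # 4) ∷ (k :≤ # 1) ∷ [] ⊢ # 2 :+ m :≤ e)
                 (btw es ⁅ v ⁆ ⁅ a ⁆) (e ⁅ v ⁆) (k ⁅ v ⁆) (d ⁅ v ⁆)
                 (simple v a v≢a av aa) refl d≡4 (four-tips m v av aw d≡4 σ≡0))
      in finish a b c fs gs v≢a v≢b v≢c b≢c aa ab ac p₀ p
      where
      finish : ∀ a b c fs gs → v ≢ a → v ≢ b → v ≢ c → b ≢ c → act a ≡ true → ⁅ a ⁆ b ≡ false → ⁅ a ⁆ c ≡ false →
               es ≋ (v , a) ∷ gs → es ≋ (v , b) ∷ (v , c) ∷ fs → ⊥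
      finish a b c fs gs v≢a v≢b v≢c b≢c aa ab ac p₀ p =
        let os , r , h , os′ , shape = lift S v v v b c fs av sv sv sv sb sc b≢c p (NT-loose S nt)
                                         (big-mode m S (NT-Big m S nt))
        in pair-flow v a v≢a p r (outside S v os sv h)
             (Reachable-pos (btw es ⁅ v ⁆ ⁅ a ⁆) _ va≥1 (nonzero os os′ r (cancel os os′ shape)))
        where
        S : VSet
        S = pair v a

        nt : NT S
        nt = pair-NT v≢a av aa

        sv : S v ≡ true
        sv = cong (_∨ ⁅ a ⁆ v) (self v)

        sb : S b ≡ false
        sb = cong₂ _∨_ (⁅⁆-≢ v≢b) ab

        sc : S c ≡ false
        sc = cong₂ _∨_ (⁅⁆-≢ v≢c) ac

        va≥1 : 1 ≤ btw es ⁅ v ⁆ ⁅ a ⁆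
        va≥1 = subst (1 ≤_) (sym (btw-≋ p₀ ⁅ v ⁆ ⁅ a ⁆))
                 (subst (λ b → 1 ≤ ind b + btw gs ⁅ v ⁆ ⁅ a ⁆)
                        (sym (cong₂ (λ x y → (x ∧ y) ∨ (⁅ v ⁆ a ∧ ⁅ a ⁆ v)) (self v) (self a))) (s≤s z≤n))

        cancel : ∀ os os′ → os ≡ (v , b) ∷ (c , v) ∷ os′ ⊎ os ≡ (b , v) ∷ (v , c) ∷ os′ →
                 cnt (outer S os) ⁅ v ⁆ ≡ 2 + cnt (outer S os′) ⁅ v ⁆ ×
                 γ (outer S os) ⁅ v ⁆ ≡ γ (outer S os′) ⁅ v ⁆
        cancel _ os′ (inj₁ refl)
          rewrite outer-head S {v} {b} ((c , v) ∷ os′) sv sb | outer-head′ S {c} {v} os′ sc sv | self v =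
          refl , z3 1 (λ x → [] , (1₃ ⊕ (2₃ ⊕ x) , x)) _
        cancel _ os′ (inj₂ refl)
          rewrite outer-head′ S {b} {v} ((v , c) ∷ os′) sb sv | outer-head S {v} {c} os′ sv sc | self v =
          refl , z3 1 (λ x → [] , (2₃ ⊕ (1₃ ⊕ x) , x)) _

        nonzero : ∀ os os′ → Reor os ((v , b) ∷ (v , c) ∷ fs) →
                  cnt (outer S os) ⁅ v ⁆ ≡ 2 + cnt (outer S os′) ⁅ v ⁆ ×
                  γ (outer S os) ⁅ v ⁆ ≡ γ (outer S os′) ⁅ v ⁆ →
                  chg (inner-charges S os cs) ⁅ v ⁆ ≢ 0₃
        nonzero os os′ r (c≡ , g≡) zero-charge =
          single-tip (zs ++ outer S os′) ⁅ v ⁆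
            (lin 8 (λ l k o′ o w m e d → (l :≡ k :+ o′) ∷ (o :≡ # 2 :+ o′) ∷ (o :≡ w) ∷ (e :≡ m :+ w) ∷
                                        (d :≡ e :+ k) ∷ (d :≡ # 4) ∷ (m :≤ # 1) ∷ (# 1 :≤ m) ∷ [] ⊢ l :≡ # 1)
               (cnt (zs ++ outer S os′) ⁅ v ⁆) (k ⁅ v ⁆) (cnt (outer S os′) ⁅ v ⁆) (cnt (outer S os) ⁅ v ⁆)
               (btw es ⁅ v ⁆ (∁ ⁅ v ⁆ ∩ ∁ ⁅ a ⁆)) (btw es ⁅ v ⁆ ⁅ a ⁆) (e ⁅ v ⁆) (d ⁅ v ⁆)
               (cnt-++ zs (outer S os′) ⁅ v ⁆) c≡ leaving (cut-btw es ⁅ v ⁆ ⁅ a ⁆ (disjoint v≢a)) refl d≡4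
               (simple v a v≢a av aa) va≥1)
            (z3 6 (λ l z o′ o c x → (l , z ⊕ o′) ∷ (o , o′) ∷ (c , 0₃) ∷ (c ⊕ o , x) ∷ (x ⊕ z , 0₃) ∷ [] , (l , 0₃))
               (γ (zs ++ outer S os′) ⁅ v ⁆) (γ zs ⁅ v ⁆) (γ (outer S os′) ⁅ v ⁆) (γ (outer S os) ⁅ v ⁆)
               (chg (inner-charges S os cs) ⁅ v ⁆) (chg cs ⁅ v ⁆)
               (γ-++ zs (outer S os′) ⁅ v ⁆) g≡ zero-charge
               (trans (chg-inner S os cs ⁅ v ⁆) (chg-ext cs in-S)) σ≡0)
          where
          in-S : ∀ w → ⁅ v ⁆ w ∧ (⁅ v ⁆ w ∨ ⁅ a ⁆ w) ≡ ⁅ v ⁆ w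
          in-S w = Bool.∧-abs-∨ (⁅ v ⁆ w) (⁅ a ⁆ w)

          leaving : cnt (outer S os) ⁅ v ⁆ ≡ btw es ⁅ v ⁆ (∁ ⁅ v ⁆ ∩ ∁ ⁅ a ⁆)
          leaving = trans (cnt-outer S os ⁅ v ⁆)
                      (trans (btw-ext os in-S (λ w → not-∨ (⁅ v ⁆ w) (⁅ a ⁆ w)))
                             (trans (btw-Reor r ⁅ v ⁆ (∁ ⁅ v ⁆ ∩ ∁ ⁅ a ⁆)) (sym (btw-≋ p ⁅ v ⁆ (∁ ⁅ v ⁆ ∩ ∁ ⁅ a ⁆)))))

    vertex-tight : ∀ m v → act v ≡ true → Big m ⁅ v ⁆ → d ⁅ v ⁆ ≡ 4 + τ (d ⁅ v ⁆) (σ ⁅ v ⁆)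
    vertex-tight m v av big with tight-or-loose (d ⁅ v ⁆) (σ ⁅ v ⁆) (cond ⁅ v ⁆ (vertex-Proper v av))
    ... | inj₁ tight = tight
    ... | inj₂ loose = ⊥-elim (not-loose m v av big loose)

    norm₆≡0 : ∀ d c → d ≡ 4 → τ d c ≡ 0 → c ≡ 0₃
    norm₆≡0 _ 0₃ refl _ = refl

    vertex-τ≥1 : ∀ m v → act v ≡ true → Away m v → 1 ≤ τ (d ⁅ v ⁆) (σ ⁅ v ⁆)
    vertex-τ≥1 m v av aw with τ (d ⁅ v ⁆) (σ ⁅ v ⁆) in eq | vertex-tight m v av (Away-Big m v aw)
    ... | suc _ | _     = s≤s z≤n
    ... | zero  | tight = ⊥-elim (not-four m v av aw tight (norm₆≡0 (d ⁅ v ⁆) (σ ⁅ v ⁆) tight eq))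

    -- Deleting tip edges and edges

    -- The degree falls by one and `τ` grows by at most one, which uses up the slack of two.
    step-ok : ∀ {n m} c s → suc n ≡ m → 6 + τ m c ≤ m → 4 + τ n (c ⊕ val s) ≤ n
    step-ok {n} {m} c s eq h =
      lin 4 (λ n m t t′ → (# 1 :+ n :≡ m) ∷ (# 6 :+ t :≤ m) ∷ (t′ :≤ # 1 :+ t) ∷ [] ⊢ # 4 :+ t′ :≤ n)
        n m (τ m c) (τ n (c ⊕ val s)) eq h (τ-remove eq c s)

    like-ok : ∀ {n m} c r → suc n ≡ m → likes m c r ≡ true → 4 + τ m c ≤ m → 4 + τ n (c ⊕ val (not r)) ≤ n
    like-ok {n} {m} c r eq l h =
      lin 4 (λ n m t t′ → (# 1 :+ n :≡ m) ∷ (# 4 :+ t :≤ m) ∷ (# 1 :+ t′ :≡ t) ∷ [] ⊢ # 4 :+ t′ :≤ n)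
        n m (τ m c) (τ n (c ⊕ val (not r))) eq h (τ-like eq c r l)

    sing-or-NT : ∀ A y → Proper act A → act y ≡ true → A y ≡ true → NT A ⊎ A ≗[ act ] ⁅ y ⁆
    sing-or-NT A y (_ , w) ay p with some (act ∩ (A ∩ ∁ ⁅ y ⁆))
    ... | inj₁ (v , q) = inj₁ ((y , v , y≢v , (ay , p) , (proj₁ (∧-true q) ,
                                proj₁ (∧-true {A v} (proj₂ (∧-true {act v} q))))) , w)
      where
      y≢v : y ≢ v
      y≢v refl with () ← trans (sym (cong not (self y))) (proj₂ (∧-true {A v} (proj₂ (∧-true {act v} q))))
    ... | inj₂ none = inj₂ eq
      where
      eq : A ≗[ act ] ⁅ y ⁆
      eq v av with y ≟ v | none v
      ... | yes refl | _ = p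
      ... | no _     | q rewrite av | Bool.∧-identityʳ (A v) = q

    cond-subst : ∀ {n n′ c c′} → n ≡ n′ → c ≡ c′ → 4 + τ n c ≤ n → 4 + τ n′ c′ ≤ n′
    cond-subst refl refl h = h

    -- The new list is described by its counts and charges only. In `two-tips` it is not a sublist
    -- of `zs`.
    remove-tip : ∀ y s zs′ → act y ≡ true → On act zs′ →
      (∀ A → k A ≡ ind (A y) + cnt zs′ A) → (∀ A → γ zs A ≡ sel (A y) (val s) ⊕ γ zs′ A) →
      likes (d ⁅ y ⁆) (σ ⁅ y ⁆) s ≡ true ⊎ 6 + τ (d ⁅ y ⁆) (σ ⁅ y ⁆) ≤ d ⁅ y ⁆ → ⊥
    remove-tip y s zs′ ay on k≡ γ≡ reason =
      no-flow (smaller (canvas act es zs′ cs es-act on cs-act total cond′ (mode′ mode)) lt)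
      where
      d′ : VSet → ℕ
      d′ = deg′ es zs′

      σ′ : VSet → Z3
      σ′ = bdry cs zs′

      len : D ≡ suc (length zs′)
      len = trans (sym (cnt-full zs)) (trans (k≡ full) (cong suc (cnt-full zs′)))

      lt : size act + (2 * length es + length zs′) < μ K
      lt rewrite len = ≤-reflexive (sym (trans (cong (size act +_) (+-suc (2 * length es) (length zs′)))
                                               (+-suc (size act) _)))

      d-eq : ∀ A → d A ≡ ind (A y) + d′ A
      d-eq A = lin 4 (λ c k i k′ → (k :≡ i :+ k′) ∷ [] ⊢ c :+ k :≡ i :+ (c :+ k′))
                 (e A) (k A) (ind (A y)) (cnt zs′ A) (k≡ A)

      σ-eq : ∀ A → σ A ≡ sel (A y) (val s) ⊕ σ′ A
      σ-eq A = z3 4 (λ c g t g′ → (g , t ⊕ g′) ∷ [] , (c ⊕ g , t ⊕ (c ⊕ g′)))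
                 (chg cs A) (γ zs A) (sel (A y) (val s)) (γ zs′ A) (γ≡ A)

      at-y : likes (d ⁅ y ⁆) (σ ⁅ y ⁆) s ≡ true ⊎ 6 + τ (d ⁅ y ⁆) (σ ⁅ y ⁆) ≤ d ⁅ y ⁆ →
             ∀ n → suc n ≡ d ⁅ y ⁆ → 4 + τ n (σ ⁅ y ⁆ ⊕ val (not s)) ≤ n
      at-y (inj₁ l) n eq = like-ok (σ ⁅ y ⁆) s eq l (cond ⁅ y ⁆ (vertex-Proper y ay))
      at-y (inj₂ h) n eq = step-ok (σ ⁅ y ⁆) (not s) eq h

      cond′ : Cond act es zs′ cs
      cond′ A pr with A y in p | d-eq A | σ-eq A
      ... | false | x | z = cond-subst x z (cond A pr)
      ... | true  | x | z with sing-or-NT A y pr ay p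
      ...   | inj₁ nt = cond-subst refl (val-cancel s _ _ z) (step-ok (σ A) (not s) (sym x) (NT-loose A nt))
      ...   | inj₂ eq = cond-subst refl (trans (cong (_⊕ val (not s)) (sym (σ-cong eq))) (val-cancel s _ _ z))
                          (at-y reason (d′ A) (trans (sym x) (d-cong eq)))

      mode′ : Mode act es zs → Mode act es zs′
      mode′ (inj₁ small) = inj₁
        (lin 5 (λ D D′ t t′ u → (D :≡ # 1 :+ D′) ∷ (D :≤ # 4 :+ t) ∷ (t :≡ u) ∷ (u :≤ # 1 :+ t′) ∷ [] ⊢ D′ :≤ # 4 :+ t′)
           D (length zs′) (τ D Γ) (τ (length zs′) (γ zs′ full)) (τ (suc (length zs′)) (γ zs′ full ⊕ val s))
           len small (cong₂ τ len (trans (γ≡ full) (z3 2 (λ a b → [] , (a ⊕ b , b ⊕ a)) (val s) (γ zs′ full))))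
           (τ-up (length zs′) (γ zs′ full) s))
      mode′ (inj₂ (x , ax , c)) = inj₂ (x , ax , λ A pr p →
        lin 5 (λ D D′ n n′ i → (D :≡ # 1 :+ D′) ∷ (D :≤ # 1 :+ n) ∷ (n :≡ i :+ n′) ∷ (i :≤ # 1) ∷ [] ⊢ D′ :≤ # 1 :+ n′)
          D (length zs′) (d A) (d′ A) (ind (A y)) len (c A pr p) (d-eq A) (ind≤1 (A y)))

    -- Otherwise the tip edge could be dropped from the certificate, which leaves the flow problem
    -- untouched and decreases `μ`.
    tip-fact : ∀ {y s ys} → Pick (y , s) zs ys →
               d ⁅ y ⁆ ≡ 4 + τ (d ⁅ y ⁆) (σ ⁅ y ⁆) × likes (d ⁅ y ⁆) (σ ⁅ y ⁆) s ≡ false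
    tip-fact {y} {s} {ys} i = tight , hates
      where
      ay : act y ≡ true
      ay = proj₁ (Pick-All i zs-act)

      bad : likes (d ⁅ y ⁆) (σ ⁅ y ⁆) s ≡ true ⊎ 6 + τ (d ⁅ y ⁆) (σ ⁅ y ⁆) ≤ d ⁅ y ⁆ → ⊥
      bad = remove-tip y s ys ay (proj₂ (Pick-All i zs-act)) (Pick-cnt i) (Pick-γ i)

      tight : d ⁅ y ⁆ ≡ 4 + τ (d ⁅ y ⁆) (σ ⁅ y ⁆)
      tight with tight-or-loose (d ⁅ y ⁆) (σ ⁅ y ⁆) (cond ⁅ y ⁆ (vertex-Proper y ay))
      ... | inj₁ t = t
      ... | inj₂ l = ⊥-elim (bad (inj₂ l))

      hates : likes (d ⁅ y ⁆) (σ ⁅ y ⁆) s ≡ false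
      hates = Bool.¬-not (λ l → bad (inj₁ l))

    -- Delete an edge between b and y, directed so that it contributes val r at b; the number
    -- of tip edges at y changes by j and their contribution by q.
    delete : ∀ b y fs r zs′ j q → es ≋ (b , y) ∷ fs → b ≢ y → On act zs′ →
      (∀ A → cnt zs′ A ≡ k A + ind (A y ∧ j)) → (∀ A → γ zs′ A ≡ γ zs A ⊕ sel (A y) q) →
      likes (d ⁅ b ⁆) (σ ⁅ b ⁆) r ≡ true →
      (∀ n → suc n ≡ d ⁅ y ⁆ + ind j → 4 + τ n (σ ⁅ y ⁆ ⊕ (val r ⊕ q)) ≤ n) →
      (∀ A → NT A → ∀ n → suc n ≡ d A + ind j → 4 + τ n (σ A ⊕ (val r ⊕ q)) ≤ n) →
      (∀ A → NT A → 4 + τ (d A + ind j) (σ A ⊕ q) ≤ d A + ind j) →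
      Small zs′ ⊎ (∃[ x ] (Center act es zs x × x ≢ b × x ≢ y × D + ind j ≤ suc (d ⁅ x ⁆))) → ⊥
    delete b y fs r zs′ j q p b≢y on cnt≡ γ≡ lb hy hone htwo m =
      no-flow (Flow-≋ {cs = cs} p (back (smaller
        (canvas act fs zs′ cs′ (fs-act (Within-≋ p es-act)) on ((ab ∷ ay ∷ cs-act)) total′ cond′ (mode′ m)) lt)))
      where
      ab : act b ≡ true
      ab with (q , _) ∷ _ ← Within-≋ p es-act = q

      ay : act y ≡ true
      ay with (_ , q) ∷ _ ← Within-≋ p es-act = q

      fs-act : Within act ((b , y) ∷ fs) → Within act fs
      fs-act (_ ∷ ps) = ps

      cs′ : List Charge
      cs′ = (b , val (not r)) ∷ (y , val r) ∷ cs

      opp : ∀ r c → val (not r) ⊕ (val r ⊕ c) ≡ c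
      opp = bool 1 λ r → _ , all? λ c → (val (not r) ⊕ (val r ⊕ c) ≟ c)

      total′ : chg cs′ full ≡ 0₃
      total′ = trans (opp r (chg cs full)) total

      d′ : VSet → ℕ
      d′ = deg′ fs zs′

      len : length zs′ ≡ D + ind j
      len = trans (sym (cnt-full zs′)) (trans (cnt≡ full) (cong (_+ ind j) (cnt-full zs)))

      lt : size act + (2 * length fs + length zs′) < μ K
      lt = lin 6 (λ s n m z z′ i → (m :≡ # 1 :+ n) ∷ (z′ :≡ z :+ i) ∷ (i :≤ # 1) ∷ [] ⊢
                     # 1 :+ (s :+ (2 :* n :+ z′)) :≤ s :+ (2 :* m :+ z))
             (size act) (length fs) (length es) D (length zs′) (ind j) (length-≋ p) len (ind≤1 j)

      back : Flow fs cs′ → Flow ((b , y) ∷ fs) cs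
      back (os , s , h) = dir r refl
        where
        dir : ∀ r′ → r′ ≡ r → Flow ((b , y) ∷ fs) cs
        dir true  refl = (b , y) ∷ os , same s , λ A →
          trans (cong (λ c → sel (A b) 1₃ ⊕ (sel (A y) 2₃ ⊕ c)) (h A))
                (bool 2 (λ x z → _ , all? λ c → (sel x 1₃ ⊕ (sel z 2₃ ⊕ (sel x 2₃ ⊕ (sel z 1₃ ⊕ c))) ≟ c))
                   (A b) (A y) (chg cs A))
        dir false refl = (y , b) ∷ os , flip s , λ A →
          trans (cong (λ c → sel (A y) 1₃ ⊕ (sel (A b) 2₃ ⊕ c)) (h A))
                (bool 2 (λ x z → _ , all? λ c → (sel z 1₃ ⊕ (sel x 2₃ ⊕ (sel x 1₃ ⊕ (sel z 2₃ ⊕ c))) ≟ c))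
                   (A b) (A y) (chg cs A))

      d-eq : ∀ A → d A ≡ ind (A b xor A y) + (cut fs A + k A)
      d-eq A = trans (cong (_+ k A) (cut-≋ p A)) (+-assoc (ind (A b xor A y)) (cut fs A) (k A))

      d′-eq : ∀ A → d′ A ≡ cut fs A + k A + ind (A y ∧ j)
      d′-eq A = trans (cong (cut fs A +_) (cnt≡ A)) (sym (+-assoc (cut fs A) (k A) _))

      σ′-eq : ∀ A → bdry cs′ zs′ A ≡ σ A ⊕ (sel (A b) (val (not r)) ⊕ sel (A y) (val r ⊕ q))
      σ′-eq A =
        trans (cong (sel (A b) (val (not r)) ⊕ (sel (A y) (val r) ⊕ chg cs A) ⊕_) (γ≡ A))
          (trans (z3 5 (λ sb sy c g sq → [] , (sb ⊕ (sy ⊕ c) ⊕ (g ⊕ sq) , c ⊕ g ⊕ (sb ⊕ (sy ⊕ sq))))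
                    (sel (A b) (val (not r))) (sel (A y) (val r)) (chg cs A) (γ zs A) (sel (A y) q))
                 (cong (λ s → σ A ⊕ (sel (A b) (val (not r)) ⊕ s)) (sym (sel-⊕ (A y) (val r) q))))
        where
        sel-⊕ : ∀ b c c′ → sel b (c ⊕ c′) ≡ sel b c ⊕ sel b c′
        sel-⊕ true  c c′ = refl
        sel-⊕ false c c′ = refl

      two-NT : ∀ {u v} A → Proper act A → u ≢ v → act u ≡ true → act v ≡ true → A u ≡ true → A v ≡ true → NT A
      two-NT A (_ , w) u≢v au av p q = (_ , _ , u≢v , (au , p) , (av , q)) , w

      cond′ : Cond act fs zs′ cs′
      cond′ A pr with A b in pb | A y in py | d-eq A | d′-eq A | σ′-eq A
      ... | false | false | x | x′ | z =
        cond-subst (trans x (sym (trans x′ (+-identityʳ _))))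
                   (sym (trans z (z3 1 (λ a → [] , (a ⊕ 0₃ , a)) (σ A)))) (cond A pr)
      ... | true | true | x | x′ | z =
        cond-subst (sym (trans x′ (cong (_+ ind j) (sym x))))
                   (sym (trans z (cong (σ A ⊕_) (opp r q)))) (htwo A (two-NT A pr b≢y ab ay pb py))
      ... | true | false | x | x′ | z with sing-or-NT A b pr ab pb
      ...   | inj₁ nt = cond-subst (sym (trans x′ (+-identityʳ _)))
                          (sym (trans z (cong (σ A ⊕_) (z3 1 (λ a → [] , (a ⊕ 0₃ , a)) (val (not r))))))
                          (step-ok (σ A) (not r) (sym x) (NT-loose A nt))
      ...   | inj₂ eq = cond-subst (sym (trans x′ (+-identityʳ _)))
                          (trans (cong (_⊕ val (not r)) (sym (σ-cong eq)))
                                 (sym (trans z (cong (σ A ⊕_) (z3 1 (λ a → [] , (a ⊕ 0₃ , a)) (val (not r)))))))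
                          (like-ok (σ ⁅ b ⁆) r (trans (sym x) (d-cong eq)) lb (cond ⁅ b ⁆ (vertex-Proper b ab)))
      cond′ A pr | false | true | x | x′ | z with sing-or-NT A y pr ay py
      ...   | inj₁ nt = cond-subst refl (sym z) (hone A nt (d′ A) (trans (cong suc x′) (cong (_+ ind j) (sym x))))
      ...   | inj₂ eq = cond-subst refl (trans (cong (_⊕ (val r ⊕ q)) (sym (σ-cong eq))) (sym z))
                          (hy (d′ A) (trans (cong suc x′) (cong (_+ ind j) (trans (sym x) (d-cong eq)))))

      mode′ : Small zs′ ⊎ (∃[ x ] (Center act es zs x × x ≢ b × x ≢ y × D + ind j ≤ suc (d ⁅ x ⁆))) →
              Mode act fs zs′
      mode′ (inj₁ small) = inj₁ small
      mode′ (inj₂ (x , ctr@(ax , c) , x≢b , x≢y , hx)) = inj₂ (x , ax , center)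
        where
        bound : ∀ A → NT A → A x ≡ true → length zs′ ≤ suc (d′ A)
        bound A nt p =
          -- A non-trivial set around `x` has degree at least `suc D`, two more than the mode asks
          -- for; this pays for the lost edge together with the new tip edge.
          lin 9 (λ D z n n′ c k i x f → (z :≡ D :+ i) ∷ (# 1 :+ D :≤ n) ∷ (n :≡ x :+ (c :+ k)) ∷ (n′ :≡ c :+ k :+ f) ∷
                                     (x :+ i :≤ # 2 :+ f) ∷ [] ⊢ z :≤ # 1 :+ n′)
            D (length zs′) (d A) (d′ A) (cut fs A) (k A) (ind j) (ind (A b xor A y)) (ind (A y ∧ j))
            len (NT-center ctr A nt p) (d-eq A) (d′-eq A)
            (bool 3 (λ x y j → _ , (ind (x xor y) + ind j ≤? 2 + ind (y ∧ j))) (A b) (A y) j)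

        center : ∀ A → Proper act A → A x ≡ true → length zs′ ≤ suc (d′ A)
        center A pr p = case sing-or-NT A x pr ax p of λ where
          (inj₁ nt) → bound A nt p
          (inj₂ eq) → subst₂ (λ l n → l ≤ suc n) (sym len)
            (trans (sym (d-cong eq)) (trans (d-eq A) (trans
              (cong₂ (λ u v → ind (u xor v) + (cut fs A + k A))
                     (trans (eq b ab) (⁅⁆-≢ x≢b)) (trans (eq y ay) (⁅⁆-≢ x≢y)))
              (sym (trans (d′-eq A) (trans (cong (λ u → cut fs A + k A + ind (u ∧ j)) (trans (eq y ay) (⁅⁆-≢ x≢y)))
                                           (+-identityʳ _))))))) hx

    -- Reducing moves at an edge

    Likes : Vertex → Bool → Set
    Likes v r = likes (d ⁅ v ⁆) (σ ⁅ v ⁆) r ≡ true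

    Only : Vertex → Bool → Set
    Only v r = Likes v r × likes (d ⁅ v ⁆) (σ ⁅ v ⁆) (not r) ≡ false

    edge-ends : ∀ {u w fs} → es ≋ (u , w) ∷ fs → act u ≡ true × act w ≡ true
    edge-ends p with q ∷ _ ← Within-≋ p es-act = q

    away-mode : ∀ m b y → Away m b → Away m y →
                Small zs ⊎ (∃[ x ] (Center act es zs x × x ≢ b × x ≢ y × D + 0 ≤ suc (d ⁅ x ⁆)))
    away-mode (inj₁ small) b y _ _ = inj₁ small
    away-mode (inj₂ (x , ctr@(ax , c))) b y x≢b x≢y =
      inj₂ (x , ctr , x≢b , x≢y , subst (_≤ suc (d ⁅ x ⁆)) (sym (+-identityʳ D)) (c ⁅ x ⁆ (vertex-Proper x ax) (self x)))

    no-opposite : ∀ m b y fs r → es ≋ (b , y) ∷ fs → b ≢ y → Away m b → Away m y → Likes b r → Likes y (not r) → ⊥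
    no-opposite m b y fs r p b≢y xb xy lb ly =
      delete b y fs r zs false 0₃ p b≢y zs-act
        (λ A → trans (sym (+-identityʳ (k A))) (cong (λ b → k A + ind b) (sym (Bool.∧-zeroʳ (A y)))))
        (λ A → trans (z3 1 (λ g → [] , (g , g ⊕ 0₃)) (γ zs A)) (cong (γ zs A ⊕_) (sym (sel-0 (A y)))))
        lb
        (λ n eq → cond-subst refl (cong (σ ⁅ y ⁆ ⊕_) (nn r))
                    (like-ok (σ ⁅ y ⁆) (not r) (trans eq (+-identityʳ _)) ly (cond ⁅ y ⁆ (vertex-Proper y (proj₂ (edge-ends p))))))
        (λ A nt n eq → cond-subst refl (cong (σ A ⊕_) (z3 1 (λ g → [] , (g , g ⊕ 0₃)) (val r)))
                         (step-ok (σ A) r (trans eq (+-identityʳ _)) (NT-loose A nt)))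
        (λ A nt → cond-subst (sym (+-identityʳ (d A))) (z3 1 (λ g → [] , (g , g ⊕ 0₃)) (σ A)) (cond A (NT⇒Proper nt)))
        (away-mode m b y xb xy)
      where
      sel-0 : ∀ b → sel b 0₃ ≡ 0₃
      sel-0 true  = refl
      sel-0 false = refl

      nn : ∀ r → val (not (not r)) ≡ val r ⊕ 0₃
      nn true  = refl
      nn false = refl

    val-opp : ∀ r c → c ≡ c ⊕ (val r ⊕ val (not r))
    val-opp true  c = z3 1 (λ c → [] , (c , c ⊕ 0₃)) c
    val-opp false c = z3 1 (λ c → [] , (c , c ⊕ 0₃)) c

    suc-inj-1 : ∀ {n m} → suc n ≡ m + 1 → m ≡ n
    suc-inj-1 {n} {m} eq = suc-injective (trans (sym (+-comm m 1)) (sym eq))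

    -- At `y` the edge is exchanged for a tip edge of the same direction, so only `b` loses an edge,
    -- in a direction it likes. The price is that D grows by one, for which the mode must have room.
    reattach : ∀ b y fs r → es ≋ (b , y) ∷ fs → b ≢ y → Likes b r →
      Small ((y , not r) ∷ zs) ⊎ (∃[ x ] (Center act es zs x × x ≢ b × x ≢ y × D ≤ d ⁅ x ⁆)) → ⊥
    reattach b y fs r p b≢y lb m =
      delete b y fs r ((y , not r) ∷ zs) true (val (not r)) p b≢y (proj₂ (edge-ends p) ∷ zs-act)
        (λ A → trans (+-comm (ind (A y)) (k A)) (cong (λ b → k A + ind b) (sym (Bool.∧-identityʳ (A y)))))
        (λ A → z3 2 (λ a b → [] , (a ⊕ b , b ⊕ a)) (sel (A y) (val (not r))) (γ zs A))
        lb
        (λ n eq → cond-subst (suc-inj-1 eq) (val-opp r (σ ⁅ y ⁆)) (cond ⁅ y ⁆ (vertex-Proper y (proj₂ (edge-ends p)))))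
        (λ A nt n eq → cond-subst (suc-inj-1 eq) (val-opp r (σ A)) (cond A (NT⇒Proper nt)))
        (λ A nt → cond-subst (sym (+-comm (d A) 1)) refl
           (lin 3 (λ n t t′ → (# 6 :+ t :≤ n) ∷ (t′ :≤ # 1 :+ t) ∷ [] ⊢ # 4 :+ t′ :≤ # 1 :+ n)
              (d A) (τ (d A) (σ A)) (τ (suc (d A)) (σ A ⊕ val (not r))) (NT-loose A nt) (τ-up (d A) (σ A) (not r))))
        (mode′ m)
      where
      mode′ : Small ((y , not r) ∷ zs) ⊎ (∃[ x ] (Center act es zs x × x ≢ b × x ≢ y × D ≤ d ⁅ x ⁆)) →
              Small ((y , not r) ∷ zs) ⊎ (∃[ x ] (Center act es zs x × x ≢ b × x ≢ y × D + 1 ≤ suc (d ⁅ x ⁆)))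
      mode′ (inj₁ small) = inj₁ small
      mode′ (inj₂ (x , ctr , x≢b , x≢y , h)) =
        inj₂ (x , ctr , x≢b , x≢y , subst (_≤ suc (d ⁅ x ⁆)) (sym (+-comm D 1)) (s≤s h))

    -- Replace a tip edge at y by two of the opposite direction, which reverses the preference of y.
    double : ∀ b y fs r ys → es ≋ (b , y) ∷ fs → b ≢ y → Likes b r → Only y r → Pick (y , not r) zs ys →
             Small ((y , r) ∷ (y , r) ∷ ys) → ⊥
    double b y fs r ys p b≢y lb (ly , hy) i small =
      delete b y fs r ((y , r) ∷ (y , r) ∷ ys) true 0₃ p b≢y (ay ∷ ay ∷ proj₂ (Pick-All i zs-act))
        (λ A → trans (lin 3 (λ i c k → (k :≡ i :+ c) ∷ [] ⊢ i :+ (i :+ c) :≡ k :+ i) (ind (A y)) (cnt ys A) (k A) (Pick-cnt i A))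
                     (cong (λ b → k A + ind b) (sym (Bool.∧-identityʳ (A y)))))
        (λ A → trans (twice r (A y) (γ ys A)) (cong (_⊕ sel (A y) 0₃) (sym (Pick-γ i A))))
        lb
        (λ n eq → cond-subst (suc-inj-1 eq) (cong (σ ⁅ y ⁆ ⊕_) (z3 1 (λ g → [] , (g , g ⊕ 0₃)) (val r)))
                    (≤-trans (+-monoʳ-≤ 4 (proj₂ (proj₂ (likes-one (d ⁅ y ⁆) (σ ⁅ y ⁆) r ly hy)))) (cond ⁅ y ⁆ (vertex-Proper y ay))))
        (λ A nt n eq → cond-subst (suc-inj-1 eq) (cong (σ A ⊕_) (z3 1 (λ g → [] , (g , g ⊕ 0₃)) (val r)))
                         (≤-trans (+-monoʳ-≤ 4 (τ-shift (d A) (σ A) (val r))) (NT-loose A nt)))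
        (λ A nt → cond-subst (sym (+-comm (d A) 1)) (z3 1 (λ g → [] , (g , g ⊕ 0₃)) (σ A))
           (lin 3 (λ n t t′ → (# 6 :+ t :≤ n) ∷ (t′ :≤ # 3 :+ t) ∷ [] ⊢ # 4 :+ t′ :≤ # 1 :+ n)
              (d A) (τ (d A) (σ A)) (τ (suc (d A)) (σ A)) (NT-loose A nt) (τ-suc (d A) (σ A))))
        (inj₁ small)
      where
      ay : act y ≡ true
      ay = proj₂ (edge-ends p)

      twice : ∀ r b c → sel b (val r) ⊕ (sel b (val r) ⊕ c) ≡ sel b (val (not r)) ⊕ c ⊕ sel b 0₃
      twice = bool 2 λ r b → _ , all? λ c → (sel b (val r) ⊕ (sel b (val r) ⊕ c) ≟ sel b (val (not r)) ⊕ c ⊕ sel b 0₃)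

    -- Reversing the tip edge changes the boundary of `y` by `val (not r)`, which cancels the effect
    -- of deleting the edge from `b`; so `y` falls to degree 5 with the same boundary. Non-trivial
    -- sets keep degree at least six, which is enough for every boundary by `6≤⇒cond`.
    reverse : ∀ {x} → Center act es zs x → ∀ b y fs r ys → es ≋ (b , y) ∷ fs → b ≢ y → x ≢ b → x ≢ y → Likes b r →
              Pick (y , not r) zs ys → d ⁅ y ⁆ ≡ 6 → τ 5 (σ ⁅ y ⁆) ≤ 1 → (∀ A → NT A → 8 ≤ d A) → ⊥
    reverse {x} ctr@(ax , c) b y fs r ys p b≢y x≢b x≢y lb i d≡6 t≤1 big =
      delete b y fs r ((y , r) ∷ ys) false (val (not r)) p b≢y (ay ∷ proj₂ (Pick-All i zs-act))
        (λ A → trans (sym (Pick-cnt i A)) (trans (sym (+-identityʳ (k A)))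
                     (cong (λ b → k A + ind b) (sym (Bool.∧-zeroʳ (A y))))))
        (λ A → trans (rev r (A y) (γ ys A)) (cong (_⊕ sel (A y) (val (not r))) (sym (Pick-γ i A))))
        lb
        (λ n eq → cond-subst (sym (suc-injective (trans eq (trans (+-identityʳ (d ⁅ y ⁆)) d≡6)))) (val-opp r (σ ⁅ y ⁆)) (+-monoʳ-≤ 4 t≤1))
        (λ A nt n eq → 6≤⇒cond n _ (lin 2 (λ n m → (# 1 :+ n :≡ m :+ # 0) ∷ (# 8 :≤ m) ∷ [] ⊢ # 6 :≤ n) n (d A) eq (big A nt)))
        (λ A nt → 6≤⇒cond (d A + 0) _ (lin 1 (λ m → (# 8 :≤ m) ∷ [] ⊢ # 6 :≤ m :+ # 0) (d A) (big A nt)))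
        (inj₂ (x , ctr , x≢b , x≢y , subst (_≤ suc (d ⁅ x ⁆)) (sym (+-identityʳ D)) (c ⁅ x ⁆ (vertex-Proper x ax) (self x))))
      where
      ay : act y ≡ true
      ay = proj₂ (edge-ends p)

      rev : ∀ r b c → sel b (val r) ⊕ c ≡ sel b (val (not r)) ⊕ c ⊕ sel b (val (not r))
      rev = bool 2 λ r b → _ , all? λ c → (sel b (val r) ⊕ c ≟ sel b (val (not r)) ⊕ c ⊕ sel b (val (not r)))

    -- The case deg z ≤ 4 + |τ(z)|, and the preferences of the vertices

    separate : ∀ (A : VSet) {b y} → A b ≡ true → A y ≡ false → b ≢ y
    separate A p q refl with () ← trans (sym p) q

    any-neighbour : ∀ v → act v ≡ true → ∃[ a ] ∃[ gs ] (v ≢ a × act a ≡ true × es ≋ (v , a) ∷ gs)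
    any-neighbour v av =
      let a , gs , v≢a , aa , _ , p =
            neighbour v ∅ av es-act refl (subst (_< e ⁅ v ⁆) (sym (btw-∅ es ⁅ v ⁆))
                                           (≤-trans (s≤s z≤n) (e≥2 ⁅ v ⁆ (vertex-Proper v av))))
      in a , gs , v≢a , aa , p

    neighbour-≢ : ∀ v x → act v ≡ true → act x ≡ true → v ≢ x →
                  ∃[ a ] ∃[ gs ] (v ≢ a × x ≢ a × act a ≡ true × es ≋ (v , a) ∷ gs)
    neighbour-≢ v x av ax v≢x =
      let a , gs , v≢a , aa , xa , p =
            neighbour v ⁅ x ⁆ av es-act (⁅⁆-≢ (v≢x ∘ sym))
              (≤-trans (s≤s (simple v x v≢x av ax)) (e≥2 ⁅ v ⁆ (vertex-Proper v av)))
      in a , gs , v≢a , separate ⁅ x ⁆ (self x) xa , aa , p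

    flipped : ∀ {u w gs} → es ≋ (u , w) ∷ gs → es ≋ (w , u) ∷ gs
    flipped p = ≋-trans p ≋-flip

    prefers : ∀ m v → act v ≡ true → Away m v → ∃[ r ] Likes v r
    prefers m v av aw = likes-some (d ⁅ v ⁆) (σ ⁅ v ⁆) (vertex-τ≥1 m v av aw)

    not-not : ∀ {v} r → Likes v r → Likes v (not (not r))
    not-not {v} r = subst (Likes v) (sym (Bool.not-involutive r))

    likes-other : ∀ v r s → Likes v s → likes (d ⁅ v ⁆) (σ ⁅ v ⁆) r ≡ false → Likes v (not r)
    likes-other v r s l n with s Bool.≟ r
    ... | yes refl with () ← trans (sym l) n
    ... | no ne = subst (Likes v) (Bool.¬-not ne) l

    only-unique : ∀ {r r′} v → Only v r → Only v r′ → r ≡ r′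
    only-unique {r} {r′} v (l , _) (_ , n) with r Bool.≟ r′
    ... | yes eq = eq
    ... | no ne with () ← trans (sym l) (subst (λ s → likes (d ⁅ v ⁆) (σ ⁅ v ⁆) s ≡ false) (sym (Bool.¬-not ne)) n)

    -- Adjacent vertices have equal preferences, since otherwise the edge could be deleted.
    others-agree : ∀ m v r → act v ≡ true → Away m v → ∀ a gs → es ≋ (v , a) ∷ gs → v ≢ a → Away m a →
                   Likes v r → Likes a r → Only v r
    others-agree m v r av aw a gs p v≢a awa lv la =
      lv , Bool.¬-not λ l → no-opposite m v a gs (not r) p v≢a aw awa l (not-not {a} r la)

    Uniform : Bool → Set
    Uniform r = ∀ v → act v ≡ true → Only v r

    uniform-tips : ∀ {r} (A : VSet) → (∀ v → act v ≡ true → A v ≡ true → Only v r) →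
                   γ zs A ≡ times (k A) (val (not r))
    uniform-tips {r} A u = γ-uniform zs A (not r) λ v t ys i p → opposite-of t v i p
      where
      opposite-of : ∀ t v {ys} → Pick (v , t) zs ys → A v ≡ true → t ≡ not r
      opposite-of t v i p with t Bool.≟ not r
      ... | yes eq = eq
      ... | no ne = ⊥-elim (case trans (sym (proj₁ (u v (proj₁ (Pick-All i zs-act)) p)))
                      (subst (λ s → likes (d ⁅ v ⁆) (σ ⁅ v ⁆) s ≡ false) (≢not ne) (proj₂ (tip-fact i))) of λ ())
        where
        ≢not : ∀ {a b} → a ≢ not b → a ≡ b
        ≢not {true}  {true}  _ = refl
        ≢not {false} {false} _ = refl
        ≢not {true}  {false} h = ⊥-elim (h refl)
        ≢not {false} {true}  h = ⊥-elim (h refl)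

    uniform-Γ : ∀ {r} → Uniform r → Γ ≡ times D (val (not r))
    uniform-Γ {r} u = trans (uniform-tips full (λ v a _ → u v a)) (cong (λ n → times n (val (not r))) (cnt-full zs))

    -- All tip edges contribute `val (not r)`, and `double` keeps this total while D grows by one.
    -- The new `τ` at the tip is 2 for D = 5 and 3 for D = 6, so `suc D` is at most `4 + τ` and the
    -- result is in the mode `Small`.
    uniform-⊥ : ∀ r → Uniform r → D ≡ 5 ⊎ D ≡ 6 → ⊥
    uniform-⊥ r u D≡ =
      let y , s , ys , _ , i = find-tip zs full (subst (1 ≤_) (sym (cnt-full zs)) (pos D≡))
          ay = proj₁ (Pick-All i zs-act)
          b , gs , y≢b , ab , p = any-neighbour y ay
      in go y s ys i (tip-sign i) b gs p y≢b ab ay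
      where
      pos : D ≡ 5 ⊎ D ≡ 6 → 1 ≤ D
      pos (inj₁ eq) = subst (1 ≤_) (sym eq) (s≤s z≤n)
      pos (inj₂ eq) = subst (1 ≤_) (sym eq) (s≤s z≤n)

      tip-sign : ∀ {y s ys} → Pick (y , s) zs ys → s ≡ not r
      tip-sign {y} {s} i with s Bool.≟ r
      ... | no ne = Bool.¬-not ne
      ... | yes refl = case trans (sym (proj₁ (u y (proj₁ (Pick-All i zs-act))))) (proj₂ (tip-fact i)) of λ ()

      small₅ : ∀ r → 6 ≤ 4 + τ 6 (times 5 (val (not r)))
      small₅ true  = ≤-refl
      small₅ false = ≤-refl

      small₆ : ∀ r → 7 ≤ 4 + τ 7 (times 6 (val (not r)))
      small₆ true  = ≤-refl
      small₆ false = ≤-refl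

      suc-small : D ≡ 5 ⊎ D ≡ 6 → suc D ≤ 4 + τ (suc D) Γ
      suc-small (inj₁ eq) = subst (λ c → suc D ≤ 4 + τ (suc D) c) (sym (uniform-Γ u))
                              (subst (λ n → suc n ≤ 4 + τ (suc n) (times n (val (not r)))) (sym eq) (small₅ r))
      suc-small (inj₂ eq) = subst (λ c → suc D ≤ 4 + τ (suc D) c) (sym (uniform-Γ u))
                              (subst (λ n → suc n ≤ 4 + τ (suc n) (times n (val (not r)))) (sym eq) (small₆ r))

      go : ∀ y s ys → Pick (y , s) zs ys → s ≡ not r → ∀ b gs → es ≋ (y , b) ∷ gs → y ≢ b →
           act b ≡ true → act y ≡ true → ⊥
      go y _ ys i refl b gs p y≢b ab ay =
        double b y gs r ys (flipped p) (y≢b ∘ sym) (proj₁ (u b ab)) (u y ay) i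
          (subst₂ (λ n c → n ≤ 4 + τ n c) (cong suc (Pick-length i))
                  (trans (Pick-γ i full) (twice r (γ ys full))) (suc-small D≡))
        where
        twice : ∀ r c → val (not r) ⊕ c ≡ val r ⊕ (val r ⊕ c)
        twice = bool 1 λ r → _ , all? λ c → (val (not r) ⊕ c ≟ val r ⊕ (val r ⊕ c))

    -- If the vertices liking `r` were a proper subset, `e≥2` would give an edge leaving it, whose
    -- ends then have opposite preferences.
    small-uniform : Small zs → ∃[ r ] Uniform r
    small-uniform small =
      let u , _ , _ , au , _ = two-active
          r , lu = prefers (inj₁ small) u au tt
      in r , λ v av →
           let a , gs , v≢a , aa , p = any-neighbour v av
           in others-agree (inj₁ small) v r av tt a gs p v≢a tt (all-like r u au lu v av) (all-like r u au lu a aa)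
      where
      all-like : ∀ r u → act u ≡ true → Likes u r → ∀ v → act v ≡ true → Likes v r
      all-like r u au lu v av with likes (d ⁅ v ⁆) (σ ⁅ v ⁆) r in lv
      ... | true  = refl
      ... | false =
        let b , y , gs , lb , ly , p = find-edge es P (∁ P)
              (≤-trans (≤-trans (s≤s z≤n) (e≥2 P ((u , au , lu) , (v , av , lv))))
                       (≤-reflexive (cut-btw∁ es P)))
            ab , ay = edge-ends p
        in ⊥-elim (no-opposite (inj₁ small) b y gs r p (separate P lb (not-true ly)) tt tt lb
                     (other-sign y ay (not-true ly)))
        where
        P : VSet
        P w = likes (d ⁅ w ⁆) (σ ⁅ w ⁆) r

        other-sign : ∀ y → act y ≡ true → P y ≡ false → Likes y (not r)
        other-sign y ay py = let s , l = prefers (inj₁ small) y ay tt in likes-other y r s l py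

    small-⊥ : Small zs → ⊥
    small-⊥ small with D ≤? 4
    ... | yes D≤4 =
      let b , _ , _ , ab , _ = two-active
          r , lb = prefers (inj₁ small) b ab tt
          y , gs , b≢y , _ , p = any-neighbour b ab
      -- With at most four tip edges there is room for one more: any tip of degree at most five is
      -- small.
      in reattach b y gs r p b≢y lb (inj₁ (≤5⇒small (suc D) _ (s≤s D≤4)))
    ... | no D≰4 = let r , u = small-uniform small in uniform-⊥ r u (inj₁ (five r D (≰⇒> D≰4) (subst (λ c → D ≤ 4 + τ D c) (uniform-Γ u) small)))
      where
      -- Equal directions put the tip at residue D or -D modulo 6. Its distance from 0 is 1, 0, 1
      -- for D = 5, 6, 7, so 6 and 7 are too large, and from 8 on so is every D, as `τ` is at most
      -- 3.
      five : ∀ r D → 5 ≤ D → D ≤ 4 + τ D (times D (val (not r))) → D ≡ 5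
      five r 5 _ _ = refl
      five true  6 _ (s≤s (s≤s (s≤s (s≤s ()))))
      five false 6 _ (s≤s (s≤s (s≤s (s≤s ()))))
      five true  7 _ (s≤s (s≤s (s≤s (s≤s (s≤s ())))))
      five false 7 _ (s≤s (s≤s (s≤s (s≤s (s≤s ())))))
      five r D@(suc (suc (suc (suc (suc (suc (suc (suc n)))))))) _ h =
        ⊥-elim (1≰0 (lin 1 (λ n → (# 8 :+ n :≤ # 7) ∷ [] ⊢ # 1 :≤ # 0) n
                       (≤-trans h (+-monoʳ-≤ 4 (τ≤3 D (times D (val (not r))))))))
      five r 4 (s≤s (s≤s (s≤s (s≤s ())))) _
      five r 3 (s≤s (s≤s (s≤s ()))) _
      five r 2 (s≤s (s≤s ())) _
      five r 1 (s≤s ()) _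

    -- Canvases with a centre: its degree and the preferences of the other vertices

    center-deg : ∀ {x} → Center act es zs x → D ≡ suc (d ⁅ x ⁆)
    center-deg {x} ctr@(ax , c) with D ≤? d ⁅ x ⁆
    ... | no ¬p = ≤-antisym (c ⁅ x ⁆ (vertex-Proper x ax) (self x)) (≰⇒> ¬p)
    ... | yes p =
      -- Here the mode has room for one more tip edge, so an edge avoiding `x` can be moved to the
      -- tip.
      let y , y≢x , ay = another x
          b , gs , y≢b , x≢b , ab , q = neighbour-≢ y x ay ax y≢x
          r , lb = prefers (inj₂ (x , ctr)) b ab x≢b
      in ⊥-elim (reattach b y gs r (flipped q) (y≢b ∘ sym) lb (inj₂ (x , ctr , x≢b , y≢x ∘ sym , p)))

    -- Two classes W of vertices other than x with different preferences would both satisfy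
    -- k(W) < e(W); as all edges leaving W end at x, its degree would be at least D + 2.
    center-uniform : ∀ {x} → Center act es zs x → ∃[ r ] (∀ v → act v ≡ true → x ≢ v → Only v r)
    center-uniform {x} ctr@(ax , _) =
      let u , u≢x , au = another x
          r , lu = prefers m u au (u≢x ∘ sym)
      in r , λ v av x≢v →
           let a , gs , v≢a , x≢a , aa , p = neighbour-≢ v x av ax (x≢v ∘ sym)
           in others-agree m v r av x≢v a gs p v≢a x≢a
                (all-like r u au (u≢x ∘ sym) lu v av x≢v) (all-like r u au (u≢x ∘ sym) lu a aa x≢a)
      where
      m : Mode act es zs
      m = inj₂ (x , ctr)

      all-like : ∀ r u → act u ≡ true → x ≢ u → Likes u r → ∀ v → act v ≡ true → x ≢ v → Likes v r
      all-like r u au x≢u lu v av x≢v with likes (d ⁅ v ⁆) (σ ⁅ v ⁆) r in lv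
      ... | true  = refl
      ... | false = ⊥-elim (1≰0
        (lin 9 (λ D dx ex kx kC kP kQ eP eQ →
                  (D :≡ # 1 :+ dx) ∷ (dx :≡ ex :+ kx) ∷ (kx :+ kC :≡ D) ∷ (kC :≡ kP :+ kQ) ∷
                  (# 1 :+ kP :≤ eP) ∷ (# 1 :+ kQ :≤ eQ) ∷ (eP :+ eQ :≡ ex) ∷ [] ⊢ # 1 :≤ # 0)
           D (d ⁅ x ⁆) (e ⁅ x ⁆) (k ⁅ x ⁆) (k (∁ ⁅ x ⁆)) (k P) (k Q) (e P) (e Q)
           (center-deg ctr) refl (cnt-∁ zs ⁅ x ⁆) (cnt-split zs (∁ ⁅ x ⁆) L)
           (leaving P (NT-∁ P v av x≢v (cong₂ (λ a b → not a ∧ b) (⁅⁆-≢ x≢v) lv) u au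
                         (cong₂ (λ a b → not a ∧ b) (⁅⁆-≢ x≢u) lu) (cong (λ a → not a ∧ L x) (self x)))
                      (cong (λ a → not a ∧ L x) (self x)))
           (leaving Q (NT-∁ Q u au x≢u (cong₂ (λ a b → not a ∧ not b) (⁅⁆-≢ x≢u) lu) v av
                         (cong₂ (λ a b → not a ∧ not b) (⁅⁆-≢ x≢v) lv) (cong (λ a → not a ∧ not (L x)) (self x)))
                      (cong (λ a → not a ∧ not (L x)) (self x)))
           edges))
        where
        L P Q : VSet
        L w = likes (d ⁅ w ⁆) (σ ⁅ w ⁆) r
        P = ∁ ⁅ x ⁆ ∩ L
        Q = ∁ ⁅ x ⁆ ∩ ∁ L

        NT-∁ : ∀ A w → act w ≡ true → x ≢ w → A w ≡ false → ∀ u → act u ≡ true → A u ≡ true → A x ≡ false → NT (∁ A)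
        NT-∁ A w aw x≢w nw u au pu nx = (x , w , x≢w , (ax , cong not nx) , (aw , cong not nw)) , (u , au , cong not pu)

        leaving : ∀ A → NT (∁ A) → A x ≡ false → suc (k A) ≤ e A
        leaving A nt nx =
          lin 5 (λ D k k′ e e′ → (# 1 :+ D :≤ e′ :+ k′) ∷ (k :+ k′ :≡ D) ∷ (e′ :≡ e) ∷ [] ⊢ # 1 :+ k :≤ e)
            D (k A) (k (∁ A)) (e A) (e (∁ A)) (NT-center ctr (∁ A) nt (cong not nx)) (cnt-∁ zs A) (cut-∁ es A)

        other-sign : ∀ y → act y ≡ true → x ≢ y → L y ≡ false → Likes y (not r)
        other-sign y ay x≢y ly = let s , l = prefers m y ay x≢y in likes-other y r s l ly

        away : ∀ {w} → not (⁅ x ⁆ w) ≡ true → x ≢ w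
        away {w} h refl with () ← trans (sym (cong not (self x))) h

        none : btw es P Q ≡ 0
        none = btw-none λ b y pb py p →
          let ab , ay = edge-ends p
              lb = proj₂ (∧-true {not (⁅ x ⁆ b)} pb)
              ly = not-true (proj₂ (∧-true {not (⁅ x ⁆ y)} py))
              x≢b = away (proj₁ (∧-true {not (⁅ x ⁆ b)} pb))
              x≢y = away (proj₁ (∧-true {not (⁅ x ⁆ y)} py))
          in no-opposite m b y _ r p (separate L lb ly) x≢b x≢y lb (other-sign y ay x≢y ly)

        edges : e P + e Q ≡ e ⁅ x ⁆
        edges = trans (cut-∪ es P Q (λ w → bool 2 (λ a b → _ , ((a ∧ b) ∧ (a ∧ not b) Bool.≟ false)) (not (⁅ x ⁆ w)) (L w)))
                  (trans (cong₂ _+_ (trans (cut-ext es (λ w → bool 2 (λ a b → _ , ((a ∧ b) ∨ (a ∧ not b) Bool.≟ a)) (not (⁅ x ⁆ w)) (L w)))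
                                           (cut-∁ es ⁅ x ⁆))
                                    (cong (2 *_) none))
                         (+-identityʳ _))

    -- If D = 6, every vertex may play the role of x.
    six-⊥ : ∀ {x} → Center act es zs x → D ≡ 6 → ⊥
    six-⊥ {x} ctr@(ax , _) D≡6 =
      let r , ux = center-uniform ctr
          y , y≢x , ay = another x
          r′ , uy = center-uniform (all-center y ay)
          -- A third vertex is covered by both choices of the centre, so the two common preferences
          -- coincide.
          w , w≢y , w≢x , aw = third y x y≢x ay ax
      in uniform-⊥ r (λ v av → case x ≟ v of λ where
           (no x≢v)   → ux v av x≢v
           (yes refl) → subst (Only x) (only-unique w (uy w aw (w≢y ∘ sym)) (ux w aw (w≢x ∘ sym))) (uy x ax y≢x))
           (inj₂ D≡6)
      where
      d≥5 : ∀ v → act v ≡ true → 5 ≤ d ⁅ v ⁆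
      d≥5 v av with x ≟ v
      ... | yes refl = ≤-pred (≤-reflexive (trans (sym D≡6) (center-deg ctr)))
      ... | no x≢v = subst (5 ≤_) (sym (vertex-tight (inj₂ (x , ctr)) v av (Away-Big (inj₂ (x , ctr)) v x≢v)))
                       (+-monoʳ-≤ 4 (vertex-τ≥1 (inj₂ (x , ctr)) v av x≢v))

      all-center : ∀ v → act v ≡ true → Center act es zs v
      all-center v av = av , λ A pr p → subst (_≤ suc (d A)) (sym D≡6) (s≤s (at-least A (sing-or-NT A v pr av p)))
        where
        at-least : ∀ A → NT A ⊎ A ≗[ act ] ⁅ v ⁆ → 5 ≤ d A
        at-least A (inj₁ nt) = lin 2 (λ n t → (# 6 :+ t :≤ n) ∷ [] ⊢ # 5 :≤ n) (d A) (τ (d A) (σ A)) (NT-loose A nt)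
        at-least A (inj₂ eq) = subst (5 ≤_) (sym (d-cong eq)) (d≥5 v av)

    -- The case D ≥ 7

    times-6 : ∀ r → times 6 (val r) ≡ 0₃
    times-6 true  = refl
    times-6 false = refl

    σ-five : ∀ {y r} → d ⁅ y ⁆ ≡ 5 → Only y r → σ ⁅ y ⁆ ≡ val r
    σ-five {y} {r} eq (l , n) =
      bool 1 (λ r → _ , all? λ c → (likes₆ true c r Bool.≟ true) →-dec (likes₆ true c (not r) Bool.≟ false) →-dec
                (c ≟ val r)) r (σ ⁅ y ⁆)
        (subst (λ n → likes n (σ ⁅ y ⁆) r ≡ true) eq l) (subst (λ n → likes n (σ ⁅ y ⁆) (not r) ≡ false) eq n)

    σ-six : ∀ {y r} → d ⁅ y ⁆ ≡ 6 → Likes y r → σ ⁅ y ⁆ ≡ val (not r)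
    σ-six {y} {r} eq l =
      bool 1 (λ r → _ , all? λ c → (likes₆ false c r Bool.≟ true) →-dec (c ≟ val (not r))) r (σ ⁅ y ⁆)
        (subst (λ n → likes n (σ ⁅ y ⁆) r ≡ true) eq l)

    Pick-weaken : ∀ {X : Set} {a b : X} {xs ys ws} → Pick a xs ys → Pick b ys ws → ∃[ us ] Pick b xs us
    Pick-weaken here      j         = _ , there j
    Pick-weaken (there i) here      = _ , here
    Pick-weaken (there i) (there j) = let _ , j′ = Pick-weaken i j in _ , there j′

    -- Three tip edges of the same direction may be replaced by two of the opposite direction.
    two-tips : ∀ v → act v ≡ true → 5 ≤ d ⁅ v ⁆ → k ⁅ v ⁆ ≤ 2
    two-tips v av 5≤d with k ⁅ v ⁆ ≤? 2
    ... | yes p = p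
    ... | no ¬p =
      let v₁ , s₁ , z₁ , p₁ , i₁ = find-tip zs ⁅ v ⁆ (≤-trans (s≤s z≤n) 3≤k)
          k₁ = fewer v₁ s₁ i₁ p₁ 3≤k
          v₂ , s₂ , z₂ , p₂ , i₂ = find-tip z₁ ⁅ v ⁆ (≤-trans (s≤s z≤n) k₁)
          v₃ , s₃ , z₃ , p₃ , i₃ = find-tip z₂ ⁅ v ⁆ (fewer v₂ s₂ i₂ p₂ k₁)
      in ⊥-elim (three v₁ s₁ v₂ s₂ v₃ s₃ p₁ p₂ p₃ i₁ i₂ i₃)
      where
      3≤k : 3 ≤ k ⁅ v ⁆
      3≤k = ≰⇒> ¬p

      fewer : ∀ {zs ys n} u s → Pick (u , s) zs ys → ⁅ v ⁆ u ≡ true → suc n ≤ cnt zs ⁅ v ⁆ → n ≤ cnt ys ⁅ v ⁆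
      fewer u s i p h = ≤-pred (subst (_ ≤_) (trans (Pick-cnt i ⁅ v ⁆) (cong (λ b → ind b + _) p)) h)

      three : ∀ v₁ s₁ v₂ s₂ v₃ s₃ {z₁ z₂ z₃} → ⁅ v ⁆ v₁ ≡ true → ⁅ v ⁆ v₂ ≡ true → ⁅ v ⁆ v₃ ≡ true →
              Pick (v₁ , s₁) zs z₁ → Pick (v₂ , s₂) z₁ z₂ → Pick (v₃ , s₃) z₂ z₃ → ⊥
      three v₁ s₁ v₂ s₂ v₃ s₃ {z₁} {z₂} {z₃} p₁ p₂ p₃ i₁ i₂ i₃
        with refl ← ⁅⁆-≡ {v} p₁ | refl ← ⁅⁆-≡ {v} p₂ | refl ← ⁅⁆-≡ {v} p₃ =
        let r , l = likes-some (d ⁅ v ⁆) (σ ⁅ v ⁆) τ≥1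
        in finish r l (hated r l (proj₂ (tip-fact i₁))) (hated r l (proj₂ (tip-fact (proj₂ (Pick-weaken i₁ i₂)))))
                      (hated r l (proj₂ (tip-fact (proj₂ (Pick-weaken i₁ (proj₂ (Pick-weaken i₂ i₃)))))))
        where
        τ≥1 : 1 ≤ τ (d ⁅ v ⁆) (σ ⁅ v ⁆)
        τ≥1 = +-cancelˡ-≤ 4 _ _ (subst (5 ≤_) (proj₁ (tip-fact i₁)) 5≤d)

        hated : ∀ {s} r → Likes v r → likes (d ⁅ v ⁆) (σ ⁅ v ⁆) s ≡ false → s ≡ not r
        hated {s} r l h with s Bool.≟ r
        ... | no ne = Bool.¬-not ne
        ... | yes refl with () ← trans (sym l) h

        finish : ∀ r → Likes v r → s₁ ≡ not r → s₂ ≡ not r → s₃ ≡ not r → ⊥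
        finish r l refl refl refl =
          remove-tip v r ((v , r) ∷ (v , r) ∷ z₃) av (av ∷ av ∷ z₃-act)
            (λ A → trans (Pick-cnt i₁ A) (cong (ind (A v) +_) (trans (Pick-cnt i₂ A) (cong (ind (A v) +_) (Pick-cnt i₃ A)))))
            (λ A → trans (Pick-γ i₁ A) (trans (cong (sel (A v) (val (not r)) ⊕_) (trans (Pick-γ i₂ A)
                      (cong (sel (A v) (val (not r)) ⊕_) (Pick-γ i₃ A)))) (triple r (A v) (γ z₃ A))))
            (inj₁ l)
          where
          z₃-act : On act z₃
          z₃-act = proj₂ (Pick-All i₃ (proj₂ (Pick-All i₂ (proj₂ (Pick-All i₁ zs-act)))))

          triple : ∀ r b c → sel b (val (not r)) ⊕ (sel b (val (not r)) ⊕ (sel b (val (not r)) ⊕ c)) ≡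
                             sel b (val r) ⊕ (sel b (val r) ⊕ (sel b (val r) ⊕ c))
          triple = bool 2 λ r b → _ , all? λ c →
            (sel b (val (not r)) ⊕ (sel b (val (not r)) ⊕ (sel b (val (not r)) ⊕ c)) ≟
             sel b (val r) ⊕ (sel b (val r) ⊕ (sel b (val r) ⊕ c)))

    module Seven {x} (ctr : Center act es zs x) (7≤D : 7 ≤ D) {r} (uni : ∀ v → act v ≡ true → x ≢ v → Only v r) where

      m : Mode act es zs
      m = inj₂ (x , ctr)

      ax : act x ≡ true
      ax = proj₁ ctr

      tight : ∀ v → act v ≡ true → x ≢ v → d ⁅ v ⁆ ≡ 4 + τ (d ⁅ v ⁆) (σ ⁅ v ⁆)
      tight v av x≢v = vertex-tight m v av (Away-Big m v x≢v)

      five-or-six : ∀ v → act v ≡ true → x ≢ v → d ⁅ v ⁆ ≡ 5 ⊎ d ⁅ v ⁆ ≡ 6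
      five-or-six v av x≢v =
        go (tight v av x≢v) (likes-one (d ⁅ v ⁆) (σ ⁅ v ⁆) r (proj₁ (uni v av x≢v)) (proj₂ (uni v av x≢v)))
        where
        go : ∀ {n t} {B : Set} → n ≡ 4 + t → 1 ≤ t × t ≤ 2 × B → n ≡ 5 ⊎ n ≡ 6
        go {t = suc zero}       eq _ = inj₁ eq
        go {t = suc (suc zero)} eq _ = inj₂ eq
        go {t = suc (suc (suc _))} eq (_ , s≤s (s≤s ()) , _)

      five-up : ∀ {n} → n ≡ 5 ⊎ n ≡ 6 → 5 ≤ n
      five-up (inj₁ refl) = ≤-refl
      five-up (inj₂ refl) = n≤1+n 5

      -- Contract A and lift two edges leaving it; then some edge between A and the rest has the
      -- direction preferred inside A, and it can be dropped when A is solved as a canvas of its own.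
      outer-big : ∀ A → NT A → A x ≡ false → 8 ≤ d A
      outer-big A nt@((u , v , u≢v , (au , pu) , (av , pv)) , _) nx with 8 ≤? d A
      ... | yes p = p
      ... | no ¬p with some (act ∩ (∁ A ∩ ∁ ⁅ x ⁆))
      -- Now `A` is everything but `x`, so `d A` is `2 * e ⁅ x ⁆ + 1`. As `x` has degree at least
      -- six and at most two tip edges, this is at least 9.
      ...   | inj₂ none = ⊥-elim (1≰0
        (lin 6 (λ n n′ dx ex kx D → (n :≤ # 7) ∷ (n :≡ n′) ∷ (dx :+ n′ :≡ 2 :* ex :+ D) ∷ (dx :≡ ex :+ kx) ∷ (kx :≤ # 2) ∷
                                   (D :≡ # 1 :+ dx) ∷ (# 7 :≤ D) ∷ [] ⊢ # 1 :≤ # 0)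
           (d A) (d (∁ ⁅ x ⁆)) (d ⁅ x ⁆) (e ⁅ x ⁆) (k ⁅ x ⁆) D
           (≤-pred (≰⇒> ¬p)) (d-cong all) (d-∁ ⁅ x ⁆) refl
           (two-tips x ax (≤-pred (≤-trans (≤-trans (n≤1+n 6) 7≤D) (≤-reflexive (center-deg ctr))))) (center-deg ctr) 7≤D))
        where
        all : A ≗[ act ] ∁ ⁅ x ⁆
        all w aw with x ≟ w | none w
        ... | yes refl | _ = nx
        ... | no _     | q with A w
        ...   | true  = refl
        ...   | false rewrite aw with () ← q
      ...   | inj₁ (q , qq) =
        let u₁ , a , gs , p₁ , pa , es₁ = find-edge es A (∁ A) crossing
            u₂ , c , fs , p₂ , pc , es₂ = find-edge gs A (∁ A ∩ ∁ ⁅ a ⁆) (second u₁ a gs p₁ (not-true pa) es₁)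
        in ⊥-elim (finish u₁ u₂ a c fs p₁ p₂ (not-true pa) pc (≋-trans es₁ (≋-cons es₂)))
        where
        aq : act q ≡ true
        aq = proj₁ (∧-true {act q} qq)

        nq : A q ≡ false
        nq = not-true (proj₁ (∧-true {not (A q)} (proj₂ (∧-true {act q} qq))))

        x≢q : x ≢ q
        x≢q = separate (∁ ⁅ x ⁆) (proj₂ (∧-true {not (A q)} (proj₂ (∧-true {act q} qq)))) (cong not (self x)) ∘ sym

        dA≤7 : d A ≤ 7
        dA≤7 = ≤-pred (≰⇒> ¬p)

        crossing : 1 ≤ btw es A (∁ A)
        crossing = ≤-trans (≤-trans (s≤s z≤n) (e≥2 A (NT⇒Proper nt))) (≤-reflexive (cut-btw∁ es A))

        many-leave : 4 ≤ e A
        many-leave = *-cancelˡ-< 2 3 (e A)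
          (lin 7 (λ D e e′ k k′ n t → (# 1 :+ D :≤ e′ :+ k′) ∷ (e′ :≡ e) ∷ (k :+ k′ :≡ D) ∷ (# 6 :+ t :≤ n) ∷ (n :≡ e :+ k) ∷ [] ⊢
                                   # 7 :≤ 2 :* e)
             D (e A) (e (∁ A)) (k A) (k (∁ A)) (d A) (τ (d A) (σ A))
             (NT-center ctr (∁ A) ((x , q , x≢q , (ax , cong not nx) , (aq , cong not nq)) , (u , au , cong not pu)) (cong not nx))
             (cut-∁ es A) (cnt-∁ zs A) (NT-loose A nt) refl)

        off : ∀ a → A a ≡ false → ∀ w → A w ∧ ⁅ a ⁆ w ≡ false
        off a na w with a ≟ w
        ... | yes refl = trans (Bool.∧-identityʳ (A w)) na
        ... | no _     = Bool.∧-zeroʳ (A w)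

        -- If all edges leaving `A`, at least four by `many-leave`, ended at `a`, then adding `a`
        -- would give a non-trivial set of degree at most 7 + `d ⁅ a ⁆` - 8, which is too small.
        some-other : ∀ a → act a ≡ true → A a ≡ false → 1 ≤ btw es A (∁ A ∩ ∁ ⁅ a ⁆)
        some-other a aa na with btw es A (∁ A ∩ ∁ ⁅ a ⁆) in eq
        ... | suc _ = s≤s z≤n
        ... | zero  = ⊥-elim (too-few (x ≟ a))
          where
          e≡ : e A ≡ btw es A ⁅ a ⁆
          e≡ = trans (cut-btw es A ⁅ a ⁆ (off a na)) (trans (cong (btw es A ⁅ a ⁆ +_) eq) (+-identityʳ _))

          with-a : ∀ w → act w ≡ true → A w ≡ false → a ≢ w → NT (A ∪ ⁅ a ⁆)
          with-a w aw nw a≢w = (u , v , u≢v , (au , cong (_∨ ⁅ a ⁆ u) pu) , (av , cong (_∨ ⁅ a ⁆ v) pv)) ,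
                               (w , aw , cong₂ _∨_ nw (⁅⁆-≢ a≢w))

          too-few : Dec (x ≡ a) → ⊥
          too-few (yes refl) = 1≰0
            (lin 6 (λ n dx n′ b e D → (n :+ dx :≡ n′ :+ 2 :* b) ∷ (e :≡ b) ∷ (# 4 :≤ e) ∷ (n :≤ # 7) ∷ (D :≡ # 1 :+ dx) ∷
                                   (# 1 :+ D :≤ n′) ∷ [] ⊢ # 1 :≤ # 0)
               (d A) (d ⁅ x ⁆) (d (A ∪ ⁅ x ⁆)) (btw es A ⁅ x ⁆) (e A) D
               (d-∪ A ⁅ x ⁆ (off x na)) e≡ many-leave dA≤7 (center-deg ctr)
               (NT-center ctr (A ∪ ⁅ x ⁆) (with-a q aq nq x≢q) (trans (cong (A x ∨_) (self x)) (Bool.∨-zeroʳ (A x)))))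
          too-few (no x≢a) = 1≰0
            (lin 6 (λ n da n′ b e t → (n :+ da :≡ n′ :+ 2 :* b) ∷ (e :≡ b) ∷ (# 4 :≤ e) ∷ (n :≤ # 7) ∷ (da :≤ # 6) ∷
                                   (# 6 :+ t :≤ n′) ∷ [] ⊢ # 1 :≤ # 0)
               (d A) (d ⁅ a ⁆) (d (A ∪ ⁅ a ⁆)) (btw es A ⁅ a ⁆) (e A) (τ (d (A ∪ ⁅ a ⁆)) (σ (A ∪ ⁅ a ⁆)))
               (d-∪ A ⁅ a ⁆ (off a na)) e≡ many-leave dA≤7 (at-most (five-or-six a aa x≢a))
               (NT-loose (A ∪ ⁅ a ⁆) (with-a x ax nx (x≢a ∘ sym))))
            where
            at-most : ∀ {n} → n ≡ 5 ⊎ n ≡ 6 → n ≤ 6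
            at-most (inj₁ refl) = n≤1+n 5
            at-most (inj₂ refl) = ≤-refl

        second : ∀ u₁ a gs → A u₁ ≡ true → A a ≡ false → es ≋ (u₁ , a) ∷ gs → 1 ≤ btw gs A (∁ A ∩ ∁ ⁅ a ⁆)
        second u₁ a gs p₁ na es₁ =
          subst (1 ≤_) (trans (btw-≋ es₁ A (∁ A ∩ ∁ ⁅ a ⁆)) (cong (λ b → ind b + btw gs A (∁ A ∩ ∁ ⁅ a ⁆)) head))
            (some-other a (proj₂ (edge-ends es₁)) na)
          where
          head : (A u₁ ∧ (not (A a) ∧ not (⁅ a ⁆ a))) ∨ (A a ∧ (not (A u₁) ∧ not (⁅ a ⁆ u₁))) ≡ false
          head rewrite na | self a = Bool.∧-zeroʳ (A u₁) ∙ refl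
            where
            _∙_ : ∀ {b c : Bool} → b ≡ false → c ≡ false → b ∨ c ≡ false
            refl ∙ refl = refl

        finish : ∀ u₁ u₂ a c fs → A u₁ ≡ true → A u₂ ≡ true → A a ≡ false → (∁ A ∩ ∁ ⁅ a ⁆) c ≡ true →
                 es ≋ (u₁ , a) ∷ (u₂ , c) ∷ fs → ⊥
        finish u₁ u₂ a c fs p₁ p₂ na pc p =
          let os , s , h , os′ , shape =
                lift A u₁ u₁ u₂ a c fs (proj₁ (edge-ends p)) p₁ p₁ p₂ na nc a≢c p (NT-loose A nt)
                     (inj₂ (x , ctr , λ px → case trans (sym px) nx of λ ()))
              w , L , pw , i = preferred os os′ shape r refl
          in inside os s (outside A u₁ os p₁ h) w L pw i
          where
          nc : A c ≡ false
          nc = not-true (proj₁ (∧-true {not (A c)} pc))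

          a≢c : a ≢ c
          a≢c = separate ⁅ a ⁆ (self a) (not-true (proj₂ (∧-true {not (A c)} pc)))

          -- One edge of the lifted pair leaves `A` and the other enters it, so one of them has
          -- direction `r` whatever `r` is.
          preferred : ∀ os os′ → os ≡ (u₁ , a) ∷ (c , u₂) ∷ os′ ⊎ os ≡ (a , u₁) ∷ (u₂ , c) ∷ os′ → ∀ r′ → r′ ≡ r →
                      ∃[ w ] ∃[ L ] (A w ≡ true × Pick (w , r) (outer A os) L)
          preferred _ os′ (inj₁ refl) true refl
            rewrite outer-head A {u₁} {a} ((c , u₂) ∷ os′) p₁ na = _ , _ , p₁ , here
          preferred _ os′ (inj₁ refl) false refl
            rewrite outer-head A {u₁} {a} ((c , u₂) ∷ os′) p₁ na | outer-head′ A {c} {u₂} os′ nc p₂ = _ , _ , p₂ , there here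
          preferred _ os′ (inj₂ refl) true refl
            rewrite outer-head′ A {a} {u₁} ((u₂ , c) ∷ os′) na p₁ | outer-head A {u₂} {c} os′ p₂ nc = _ , _ , p₂ , there here
          preferred _ os′ (inj₂ refl) false refl
            rewrite outer-head′ A {a} {u₁} ((u₂ , c) ∷ os′) na p₁ = _ , _ , p₁ , here

          inside : ∀ os → Reor os ((u₁ , a) ∷ (u₂ , c) ∷ fs) → (∀ B → ∂ os (B ∩ ∁ A) ≡ chg cs (B ∩ ∁ A)) →
                   ∀ w L → A w ≡ true → Pick (w , r) (outer A os) L → ⊥
          inside os s out w L pw i =
            restrict A p s out (restr A zs ++ L) (On-++ (restr-On zs-act) (proj₂ picked)) len-bound (x , ax , nx)
              cond′ (inj₂ (center (w ≟ u)))
            where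
            picked : (act ∩ A) w ≡ true × On (act ∩ A) L
            picked = Pick-All i (outer-On (Within-Reor s (Within-≋ p es-act)))

            aw : act w ≡ true
            aw = proj₁ (∧-true {act w} (proj₁ picked))

            x≢w : x ≢ w
            x≢w = separate A pw nx ∘ sym

            len-bound : length (restr A zs ++ L) ≤ length zs + length (outer A os)
            len-bound = ≤-trans (≤-reflexive (length-++ (restr A zs)))
              (+-mono-≤ (length-restr A zs) (≤-trans (n≤1+n _) (≤-reflexive (sym (Pick-length i)))))

            len : suc (length (restr A zs ++ L)) ≡ d A
            len = trans (cong suc (length-++ (restr A zs))) (trans (sym (+-suc (length (restr A zs)) (length L)))
                    (trans (cong (length (restr A zs) +_) (sym (Pick-length i)))
                      (trans (sym (length-++ (restr A zs))) (length-inner-tips A p s))))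

            d″ : VSet → ℕ
            d″ = deg′ (inner A os) (restr A zs ++ L)

            d-eq : ∀ B → d (B ∩ A) ≡ ind (B w) + d″ B
            d-eq B = lin 8 (λ n c l z o L l′ b → (c :+ l :≡ n) ∷ (l :≡ z :+ o) ∷ (o :≡ b :+ L) ∷ (l′ :≡ z :+ L) ∷ [] ⊢
                                                   n :≡ b :+ (c :+ l′))
              (d (B ∩ A)) (cut (inner A os) B) (cnt (restr A zs ++ outer A os) B) (cnt (restr A zs) B)
              (cnt (outer A os) B) (cnt L B) (cnt (restr A zs ++ L) B) (ind (B w))
              (deg-inner A p s B) (cnt-++ (restr A zs) (outer A os) B) (Pick-cnt i B) (cnt-++ (restr A zs) L B)

            σ-eq : ∀ B → σ (B ∩ A) ≡ sel (B w) (val r) ⊕ bdry (inner-charges A os cs) (restr A zs ++ L) B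
            σ-eq B = trans (sym (bdry-inner A os B)) (trans
              (cong (chg (inner-charges A os cs) B ⊕_)
                 (trans (γ-++ (restr A zs) (outer A os) B) (cong (γ (restr A zs) B ⊕_) (Pick-γ i B))))
              (trans (z3 4 (λ c z b L → [] , (c ⊕ (z ⊕ (b ⊕ L)) , b ⊕ (c ⊕ (z ⊕ L))))
                        (chg (inner-charges A os cs) B) (γ (restr A zs) B) (sel (B w) (val r)) (γ L B))
                     (cong (λ g → sel (B w) (val r) ⊕ (chg (inner-charges A os cs) B ⊕ g)) (sym (γ-++ (restr A zs) L B)))))

            cond′ : ∀ B → Proper (act ∩ A) B →
                    4 + τ (d″ B) (bdry (inner-charges A os cs) (restr A zs ++ L) B) ≤ d″ B
            cond′ B pr = by (B w) refl (d-eq B) (σ-eq B)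
              where
              X : VSet
              X = B ∩ A

              by : ∀ b → B w ≡ b → d X ≡ ind (B w) + d″ B →
                   σ X ≡ sel (B w) (val r) ⊕ bdry (inner-charges A os cs) (restr A zs ++ L) B →
                   4 + τ (d″ B) (bdry (inner-charges A os cs) (restr A zs ++ L) B) ≤ d″ B
              by false e₁ e₂ e₃ rewrite e₁ = cond-subst e₂ e₃ (cond X (Proper-inner pr))
              by true  e₁ e₂ e₃ rewrite e₁ = case sing-or-NT X w (Proper-inner pr) aw (cong₂ _∧_ e₁ pw) of λ where
                (inj₁ ntX) → cond-subst refl (val-cancel r _ _ e₃) (step-ok (σ X) (not r) (sym e₂) (NT-loose X ntX))
                (inj₂ eq)  → cond-subst refl (trans (cong (_⊕ val (not r)) (sym (σ-cong eq))) (val-cancel r _ _ e₃))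
                               (like-ok (σ ⁅ w ⁆) r (trans (sym e₂) (d-cong eq)) (proj₁ (uni w aw x≢w))
                                        (cond ⁅ w ⁆ (vertex-Proper w aw)))

            -- With one tip edge dropped, the new tip has degree at most 6. Any `v` other than `w`
            -- can be the centre: it keeps its degree of at least 5, and larger sets had at least 6
            -- and lose at most one.
            centered : ∀ v → act v ≡ true → A v ≡ true → w ≢ v →
                       ∃ (Center (act ∩ A) (inner A os) (restr A zs ++ L))
            centered v av pv w≢v = v , cong₂ _∧_ av pv , λ B pr pB →
              lin 3 (λ l n n″ → (# 1 :+ l :≡ n) ∷ (n :≤ # 7) ∷ (# 5 :≤ n″) ∷ [] ⊢ l :≤ # 1 :+ n″)
                (length (restr A zs ++ L)) (d A) (d″ B) len dA≤7 (at-least B pr pB)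
              where
              at-least : ∀ B → Proper (act ∩ A) B → B v ≡ true → 5 ≤ d″ B
              at-least B pr pB = case sing-or-NT (B ∩ A) v (Proper-inner pr) av (cong₂ _∧_ pB pv) of λ where
                (inj₁ ntX) → lin 4 (λ n b n″ t → (n :≡ b :+ n″) ∷ (b :≤ # 1) ∷ (# 6 :+ t :≤ n) ∷ [] ⊢ # 5 :≤ n″)
                               (d (B ∩ A)) (ind (B w)) (d″ B) (τ (d (B ∩ A)) (σ (B ∩ A)))
                               (d-eq B) (ind≤1 (B w)) (NT-loose (B ∩ A) ntX)
                (inj₂ eq) → subst (5 ≤_) (trans (sym (d-cong eq)) (trans (d-eq B)
                              (cong (λ b → ind b + d″ B) (trans (sym (Bool.∧-identityʳ (B w)))
                                 (trans (cong (B w ∧_) (sym pw)) (trans (eq w aw) (⁅⁆-≢ (w≢v ∘ sym)))))))) (five-up (five-or-six v av (separate A pv nx ∘ sym)))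

            center : Dec (w ≡ u) → ∃ (Center (act ∩ A) (inner A os) (restr A zs ++ L))
            center (no w≢u)   = centered u au pu w≢u
            center (yes refl) = centered v av pv u≢v

      big : ∀ A → NT A → 8 ≤ d A
      big A nt with A x in px
      ... | true  = ≤-trans (s≤s 7≤D) (NT-center ctr A nt px)
      ... | false = outer-big A nt px

      -- A vertex of degree 6 liking `r` has boundary `val (not r)`. At degree 5 this boundary has
      -- `τ` equal to 1, so `reverse` applies.
      not-six : ∀ y ys → x ≢ y → Pick (y , not r) zs ys → d ⁅ y ⁆ ≢ 6
      not-six y ys x≢y i d≡6 =
        let ay = proj₁ (Pick-All i zs-act)
            b , gs , y≢b , x≢b , ab , p = neighbour-≢ y x ay ax (x≢y ∘ sym)
        in reverse ctr b y gs r ys (flipped p) (y≢b ∘ sym) x≢b x≢y (proj₁ (uni b ab x≢b)) i d≡6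
             (subst (λ c → norm₆ true c ≤ 1) (sym (σ-six {y} {r} d≡6 (proj₁ (uni y ay x≢y)))) (odd-one r)) big
        where
        odd-one : ∀ r → norm₆ true (val (not r)) ≤ 1
        odd-one true  = ≤-refl
        odd-one false = ≤-refl

      -- Direct all edges at a vertex y of degree five so that they contribute val r at their other ends.
      sink : ∀ y → act y ≡ true → x ≢ y → d ⁅ y ⁆ ≡ 5 →
             btw es ⁅ x ⁆ ⁅ y ⁆ ≡ 0 ⊎ (1 ≤ k ⁅ y ⁆ × (Likes x r ⊎ 6 + τ (d ⁅ x ⁆) (σ ⁅ x ⁆) ≤ d ⁅ x ⁆)) → ⊥
      sink y ay x≢y d≡5 at-x =
        restrict S ≋-refl s out (restr S zs) (restr-On zs-act)
          (≤-trans (length-restr S zs) (m≤m+n _ _)) (y , ay , cong not (self y)) cond′ (inj₂ (x , cong₂ _∧_ ax x∈S , center))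
        where
        S : VSet
        S = ∁ ⁅ y ⁆

        x∈S : S x ≡ true
        x∈S = cong not (⁅⁆-≢ (x≢y ∘ sym))

        os : List Edge
        os = map (aim y r) es

        s : Reor os es
        s = Reor-aim y r es

        O : List Tip
        O = outer S os

        γO : ∀ B → γ O B ≡ times (cnt O B) (val r)
        γO B = γ-uniform O B r (λ v t ys i _ → aim-sign y r es i)

        only-y : ∀ v → act v ≡ true → ⁅ y ⁆ v ≡ true → Only v r
        only-y v av p with refl ← ⁅⁆-≡ {y} p = uni y ay x≢y

        -- No tip edge at `y` has the preferred direction, so all five edges contribute
        -- `val (not r)` at `y`; five times this is `val r`, the boundary of `y`.
        ∂-y : ∂ os ⁅ y ⁆ ≡ chg cs ⁅ y ⁆
        ∂-y =
          trans (z3 3 (λ p q t → (p ⊕ q , 0₃) ∷ (q , t) ∷ [] , (p , ⊖ t)) (∂ os ⁅ y ⁆) (∂ os S) (times (e ⁅ y ⁆) (val r))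
                   (trans (chg-∁ (charges os) ⁅ y ⁆) (∂-full os)) ∂-S)
                (sym (z3 5 (λ c a b v g → (c ⊕ g , v) ∷ (g , ⊖ b) ∷ (v ⊕ (a ⊕ b) , 0₃) ∷ [] , (c , ⊖ a))
                   (chg cs ⁅ y ⁆) (times (e ⁅ y ⁆) (val r)) (times (k ⁅ y ⁆) (val r)) (val r) (γ zs ⁅ y ⁆)
                   (σ-five {y} d≡5 (uni y ay x≢y))
                   (trans (uniform-tips ⁅ y ⁆ only-y) (times-not (k ⁅ y ⁆) r))
                   (trans (cong (val r ⊕_) (trans (sym (times-+ (e ⁅ y ⁆) (k ⁅ y ⁆) (val r)))
                                                  (cong (λ n → times n (val r)) d≡5))) (times-6 r))))
          where
          ∂-S : ∂ os S ≡ times (e ⁅ y ⁆) (val r)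
          ∂-S = trans (sym (∂-inner S os full)) (trans (cong (_⊕ γ O full) (∂-full (inner S os)))
                  (trans (γO full) (cong (λ n → times n (val r))
                    (trans (cong (_+ cnt O full) (sym (cut-full (inner S os))))
                      (trans (cut-inner S os full) (trans (cut-Reor s S) (cut-∁ es ⁅ y ⁆)))))))

        out : ∀ B → ∂ os (B ∩ ∁ S) ≡ chg cs (B ∩ ∁ S)
        out = demand-at os cs y ∂-y

        d″ : VSet → ℕ
        d″ = deg′ (inner S os) (restr S zs)

        σ″ : VSet → Z3
        σ″ = bdry (inner-charges S os cs) (restr S zs)

        κ : VSet → ℕ
        κ B = btw es (B ∩ S) ⁅ y ⁆

        cntO : ∀ B → cnt O B ≡ κ B
        cntO B = trans (cnt-outer S os B) (trans (btw-Reor s (B ∩ S) (∁ S))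
                   (btw-ext es (λ _ → refl) (λ v → Bool.not-involutive (⁅ y ⁆ v))))

        d-eq : ∀ B → d (B ∩ S) ≡ d″ B + κ B
        d-eq B = lin 6 (λ c o c′ z k κ → (c :+ o :≡ c′) ∷ (z :≡ k) ∷ (o :≡ κ) ∷ [] ⊢ c′ :+ k :≡ c :+ z :+ κ)
          (cut (inner S os) B) (cnt O B) (e (B ∩ S)) (cnt (restr S zs) B) (k (B ∩ S)) (κ B)
          (trans (cut-inner S os B) (cut-Reor s (B ∩ S))) (cnt-restr S zs B) (cntO B)

        σ-eq : ∀ B → σ″ B ⊕ times (κ B) (val r) ≡ σ (B ∩ S)
        σ-eq B = trans (cong (σ″ B ⊕_) (sym (trans (γO B) (cong (λ n → times n (val r)) (cntO B)))))
          (trans (z3 3 (λ c z o → [] , (c ⊕ z ⊕ o , c ⊕ o ⊕ z)) (chg (inner-charges S os cs) B) (γ (restr S zs) B) (γ O B))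
                 (cong₂ _⊕_ (chg-inner S os cs B) (γ-restr S zs B)))

        y∉ : ∀ B v → (B ∩ S) v ∧ ⁅ y ⁆ v ≡ false
        y∉ B v with y ≟ v
        ... | yes refl = trans (Bool.∧-identityʳ (B v ∧ false)) (Bool.∧-zeroʳ (B v))
        ... | no _     = Bool.∧-zeroʳ (B v ∧ true)

        plus-y : ∀ B → d (B ∩ S) + 5 ≡ d ((B ∩ S) ∪ ⁅ y ⁆) + 2 * κ B
        plus-y B = trans (cong (d (B ∩ S) +_) (sym d≡5)) (d-∪ (B ∩ S) ⁅ y ⁆ (y∉ B))

        plus-y-NT : ∀ B → Proper (act ∩ S) B → NT (B ∩ S) → NT ((B ∩ S) ∪ ⁅ y ⁆)
        plus-y-NT B (_ , (w , q , nw)) ((u , v , u≢v , (au , pu) , (av , pv)) , _) =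
          (u , v , u≢v , (au , cong (_∨ ⁅ y ⁆ u) pu) , (av , cong (_∨ ⁅ y ⁆ v) pv)) ,
          (w , proj₁ (∧-true {act w} q) , cong₂ _∨_ (cong (_∧ S w) nw) (not-true (proj₂ (∧-true {act w} q))))

        -- Here `d₁` and `d₂` are the degrees of a set without and with `y`, and `κ` counts its
        -- edges to `y`. If `κ` is at most 2, the bound on `d₁` suffices; otherwise `n` equals
        -- `d₂ + κ` - 5, and the bound on `d₂` does.
        few : ∀ {n d₁ d₂ κ D} → d₁ ≡ n + κ → d₁ + 5 ≡ d₂ + 2 * κ → 2 + D ≤ d₁ → 2 + D ≤ d₂ → D ≤ n
        few {n} {d₁} {d₂} {κ} {D} e₁ e₂ h₁ h₂ with κ ≤? 2
        ... | yes κ≤2 = lin 4 (λ n d₁ κ D → (d₁ :≡ n :+ κ) ∷ (# 2 :+ D :≤ d₁) ∷ (κ :≤ # 2) ∷ [] ⊢ D :≤ n)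
                          n d₁ κ D e₁ h₁ κ≤2
        ... | no κ≰2 = lin 5 (λ n d₁ d₂ κ D → (d₁ :≡ n :+ κ) ∷ (d₁ :+ # 5 :≡ d₂ :+ 2 :* κ) ∷ (# 2 :+ D :≤ d₂) ∷ (# 3 :≤ κ) ∷ [] ⊢ D :≤ n)
                          n d₁ d₂ κ D e₁ e₂ h₂ (≰⇒> κ≰2)

        κ-sing : ∀ B c → (B ∩ S) ≗[ act ] ⁅ c ⁆ → κ B ≡ btw es ⁅ c ⁆ ⁅ y ⁆
        κ-sing B c eq = btw-cong eq es-act

        undo : ∀ s c c′ → c′ ⊕ times 1 (val s) ≡ c → c ⊕ val (not s) ≡ c′
        undo = bool 1 λ s → _ , all? λ c → all? λ c′ → (c′ ⊕ times 1 (val s) ≟ c) →-dec (c ⊕ val (not s) ≟ c′)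

        cond′ : Cond (act ∩ S) (inner S os) (restr S zs) (inner-charges S os cs)
        cond′ B pr@((c , q , pc) , _) = case sing-or-NT X c (Proper-inner pr) ac Xc of λ where
            (inj₁ nt) → 6≤⇒cond (d″ B) (σ″ B) (few {n = d″ B} {κ = κ B} (d-eq B) (plus-y B) (big X nt)
                                               (big (X ∪ ⁅ y ⁆) (plus-y-NT B pr nt)))
            (inj₂ eq) → single eq (κ B) refl
          where
          X : VSet
          X = B ∩ S

          ac : act c ≡ true
          ac = proj₁ (∧-true {act c} q)

          Xc : X c ≡ true
          Xc = cong₂ _∧_ pc (proj₂ (∧-true {act c} q))

          c≢y : c ≢ y
          c≢y = separate S (proj₂ (∧-true {act c} q)) (cong not (self y))

          ok : ∀ {n} → suc n ≡ d ⁅ c ⁆ → btw es ⁅ c ⁆ ⁅ y ⁆ ≡ 1 → Dec (x ≡ c) → 4 + τ n (σ ⁅ c ⁆ ⊕ val (not r)) ≤ n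
          ok eq 1≡ (no x≢c) = like-ok (σ ⁅ c ⁆) r eq (proj₁ (uni c ac x≢c)) (cond ⁅ c ⁆ (vertex-Proper c ac))
          ok {n} eq 1≡ (yes refl) = by at-x
            where
            by : btw es ⁅ x ⁆ ⁅ y ⁆ ≡ 0 ⊎ (1 ≤ k ⁅ y ⁆ × (Likes x r ⊎ 6 + τ (d ⁅ x ⁆) (σ ⁅ x ⁆) ≤ d ⁅ x ⁆)) →
                 4 + τ n (σ ⁅ x ⁆ ⊕ val (not r)) ≤ n
            by (inj₁ none) = case trans (sym 1≡) none of λ ()
            by (inj₂ (_ , inj₁ l)) = like-ok (σ ⁅ x ⁆) r eq l (cond ⁅ x ⁆ (vertex-Proper x ax))
            by (inj₂ (_ , inj₂ h)) = step-ok (σ ⁅ x ⁆) (not r) eq h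

          single : X ≗[ act ] ⁅ c ⁆ → ∀ κ′ → κ B ≡ κ′ → 4 + τ (d″ B) (σ″ B) ≤ d″ B
          single eq zero κ≡ =
            cond-subst (trans (sym (d-cong eq)) (trans (d-eq B) (trans (cong (d″ B +_) κ≡) (+-identityʳ _))))
              (trans (sym (σ-cong eq)) (trans (sym (σ-eq B)) (trans (cong (λ n → σ″ B ⊕ times n (val r)) κ≡)
                 (z3 1 (λ a → [] , (a ⊕ 0₃ , a)) (σ″ B))))) (cond ⁅ c ⁆ (vertex-Proper c ac))
          single eq (suc zero) κ≡ =
            cond-subst refl (undo r (σ ⁅ c ⁆) (σ″ B)
                               (trans (sym (cong (λ n → σ″ B ⊕ times n (val r)) κ≡)) (trans (σ-eq B) (σ-cong eq))))
              (ok (trans (trans (+-comm 1 (d″ B)) (sym (trans (d-eq B) (cong (d″ B +_) κ≡)))) (d-cong eq))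
                  (trans (sym (κ-sing B c eq)) κ≡) (x ≟ c))
          single eq (suc (suc n)) κ≡ with () ← ≤-pred (subst (_≤ 1) (trans (sym (κ-sing B c eq)) κ≡) (simple c y c≢y ac ay))

        center : ∀ B → Proper (act ∩ S) B → B x ≡ true → length (restr S zs) ≤ suc (d″ B)
        center B pr px = case sing-or-NT (B ∩ S) x (Proper-inner pr) ax Xx of λ where
            (inj₁ nt) → ≤-trans (≤-trans fewer-tips (≤-reflexive (center-deg ctr)))
              (s≤s (few {n = d″ B} {κ = κ B} (d-eq B) (plus-y B) (bound (B ∩ S) nt Xx)
                        (bound ((B ∩ S) ∪ ⁅ y ⁆) (plus-y-NT B pr nt) (cong (_∨ ⁅ y ⁆ x) Xx))))
            (inj₂ eq) → single eq at-x
          where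
          Xx : (B ∩ S) x ≡ true
          Xx = cong₂ _∧_ px x∈S

          len : k ⁅ y ⁆ + length (restr S zs) ≡ D
          len = trans (cong (k ⁅ y ⁆ +_) (trans (sym (cnt-full (restr S zs))) (cnt-restr S zs full))) (cnt-∁ zs ⁅ y ⁆)

          fewer-tips : length (restr S zs) ≤ D
          fewer-tips = ≤-trans (m≤n+m _ _) (≤-reflexive len)

          bound : ∀ A → NT A → A x ≡ true → 2 + d ⁅ x ⁆ ≤ d A
          bound A nt p = ≤-trans (≤-reflexive (cong suc (sym (center-deg ctr)))) (NT-center ctr A nt p)

          single : (B ∩ S) ≗[ act ] ⁅ x ⁆ →
                   btw es ⁅ x ⁆ ⁅ y ⁆ ≡ 0 ⊎ (1 ≤ k ⁅ y ⁆ × (Likes x r ⊎ 6 + τ (d ⁅ x ⁆) (σ ⁅ x ⁆) ≤ d ⁅ x ⁆)) →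
                   length (restr S zs) ≤ suc (d″ B)
          -- If `x` is not adjacent to `y`, its degree stays. Otherwise it may lose one, and a tip
          -- edge at `y`, which disappears too, makes up for this.
          single eq (inj₁ none) =
            lin 7 (λ l D dx n n″ κ b → (l :≤ D) ∷ (D :≡ # 1 :+ dx) ∷ (n :≡ n″ :+ κ) ∷ (n :≡ dx) ∷ (κ :≡ b) ∷ (b :≡ # 0) ∷ [] ⊢
                                    l :≤ # 1 :+ n″)
              (length (restr S zs)) D (d ⁅ x ⁆) (d (B ∩ S)) (d″ B) (κ B) (btw es ⁅ x ⁆ ⁅ y ⁆)
              fewer-tips (center-deg ctr) (d-eq B) (d-cong eq) (κ-sing B x eq) none
          single eq (inj₂ (1≤k , _)) =
            lin 8 (λ l D dx n n″ κ b k → (k :+ l :≡ D) ∷ (# 1 :≤ k) ∷ (D :≡ # 1 :+ dx) ∷ (n :≡ n″ :+ κ) ∷ (n :≡ dx) ∷ (κ :≡ b) ∷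
                                    (b :≤ # 1) ∷ [] ⊢ l :≤ # 1 :+ n″)
              (length (restr S zs)) D (d ⁅ x ⁆) (d (B ∩ S)) (d″ B) (κ B) (btw es ⁅ x ⁆ ⁅ y ⁆) (k ⁅ y ⁆)
              len 1≤k (center-deg ctr) (d-eq B) (d-cong eq) (κ-sing B x eq) (simple x y x≢y ax ay)

      -- A vertex of degree five not adjacent to `x` could be deleted by `sink` without any
      -- assumption on the preferences of `x`.
      x-neighbour : ∀ v → act v ≡ true → x ≢ v → d ⁅ v ⁆ ≡ 5 → btw es ⁅ v ⁆ ⁅ x ⁆ ≡ 1
      x-neighbour v av x≢v d≡5 =
        trans (btw-sym es ⁅ v ⁆ ⁅ x ⁆)
              (≤-antisym (simple x v x≢v ax av) (n≢0⇒n>0 λ none → sink v av x≢v d≡5 (inj₁ none)))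

      -- The boundaries do not add up modulo 3.
      all-five-⊥ : (∀ v → act v ≡ true → x ≢ v → d ⁅ v ⁆ ≡ 5) → d ⁅ x ⁆ ≡ 6 → Only x (not r) → ⊥
      all-five-⊥ five d≡6 (lx , nx) =
        mod3 r (times (e ⁅ x ⁆) (val r)) (times (k ⁅ x ⁆) (val r))
          (trans (sym (times-+ (e ⁅ x ⁆) (k ⁅ x ⁆) (val r))) (trans (cong (λ n → times n (val r)) d≡6) (times-6 r)))
          (z3 6 (λ s s′ g g′ E K → (s ⊕ s′ , g ⊕ g′) ∷ (s′ , E) ∷ (g , K) ∷ [] , (s ⊕ E , K ⊕ g′))
             (σ ⁅ x ⁆) (σ (∁ ⁅ x ⁆)) (γ zs ⁅ x ⁆) (γ zs (∁ ⁅ x ⁆)) (times (e ⁅ x ⁆) (val r)) (times (k ⁅ x ⁆) (val r))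
             (trans (σ-∁ ⁅ x ⁆) (sym (chg-∁ (map tip-charge zs) ⁅ x ⁆))) σ-rest γ-x)
          (σ-six {x} d≡6 lx) γ-rest
        where
        -- `E` and `K` are the edges and the tip edges at `x`, weighted by `val r`. Substitution
        -- gives `val r ⊕ E ≡ K ⊕ (val (not r) ⊕ (⊖ E))`, and `E ⊕ K ≡ 0₃` reduces this to
        -- `val r ≡ val (not r)`.
        mod3 : ∀ r E K {s g} → E ⊕ K ≡ 0₃ → s ⊕ E ≡ K ⊕ g → s ≡ val (not (not r)) → g ≡ val (not r) ⊕ (⊖ E) → ⊥
        mod3 true  E K {s} {g} p q t u with () ←
          z3 4 (λ E K s g → (E ⊕ K , 0₃) ∷ (s ⊕ E , K ⊕ g) ∷ (s , 1₃) ∷ (g , 2₃ ⊕ (⊖ E)) ∷ [] , (0₃ , 1₃)) E K s g p q t u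
        mod3 false E K {s} {g} p q t u with () ←
          z3 4 (λ E K s g → (E ⊕ K , 0₃) ∷ (s ⊕ E , K ⊕ g) ∷ (s , 2₃) ∷ (g , 1₃ ⊕ (⊖ E)) ∷ [] , (0₃ , 1₃)) E K s g p q t u

        only-x : ∀ v → act v ≡ true → ⁅ x ⁆ v ≡ true → Only v (not r)
        only-x v av p with refl ← ⁅⁆-≡ {x} p = lx , nx

        γ-x : γ zs ⁅ x ⁆ ≡ times (k ⁅ x ⁆) (val r)
        γ-x = trans (uniform-tips ⁅ x ⁆ only-x) (cong (λ s → times (k ⁅ x ⁆) (val s)) (Bool.not-involutive r))

        γ-rest : γ zs (∁ ⁅ x ⁆) ≡ val (not r) ⊕ (⊖ times (e ⁅ x ⁆) (val r))
        γ-rest = trans (uniform-tips (∁ ⁅ x ⁆) (λ v av p → uni v av (separate (∁ ⁅ x ⁆) p (cong not (self x)) ∘ sym)))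
          (trans (cong (λ n → times n (val (not r))) count) (cong (val (not r) ⊕_) (times-not (e ⁅ x ⁆) r)))
          where
          count : k (∁ ⁅ x ⁆) ≡ suc (e ⁅ x ⁆)
          count = lin 5 (λ D dx e k k′ → (D :≡ # 1 :+ dx) ∷ (dx :≡ e :+ k) ∷ (k :+ k′ :≡ D) ∷ [] ⊢ k′ :≡ # 1 :+ e)
            D (d ⁅ x ⁆) (e ⁅ x ⁆) (k ⁅ x ⁆) (k (∁ ⁅ x ⁆)) (center-deg ctr) refl (cnt-∁ zs ⁅ x ⁆)

        S : VSet
        S = ∁ ⁅ x ⁆

        os : List Edge
        os = map (aim x r) es

        s : Reor os es
        s = Reor-aim x r es

        O : List Tip
        O = outer S os

        γO : ∀ B → γ O B ≡ times (cnt O B) (val r)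
        γO B = γ-uniform O B r (λ v t ys i _ → aim-sign x r es i)

        -- This is `σ` minus the edges at `x`, each counted as `val r` at its other end. It vanishes
        -- at every other vertex, as each has boundary `val r` and exactly one edge to `x`; thus
        -- `σ S` is found without counting vertices.
        L : List Charge
        L = (cs ++ map tip-charge zs) ++ opposite (map tip-charge O)

        chg-L : ∀ B → chg L B ≡ σ B ⊕ (⊖ γ O B)
        chg-L B = trans (chg-++ (cs ++ map tip-charge zs) _ B)
                    (cong₂ _⊕_ (chg-++ cs (map tip-charge zs) B) (chg-opposite (map tip-charge O) B))

        local : ∀ v → S v ≡ true → chg L ⁅ v ⁆ ≡ 0₃
        local v p = trans (chg-L ⁅ v ⁆) (at (act v) refl)
          where
          x≢v : x ≢ v
          x≢v = separate S p (cong not (self x)) ∘ sym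

          cntO : cnt O ⁅ v ⁆ ≡ btw es ⁅ v ⁆ ⁅ x ⁆
          cntO = trans (cnt-outer S os ⁅ v ⁆) (trans (btw-Reor s (⁅ v ⁆ ∩ S) (∁ S))
                   (btw-ext es v-in (λ w → Bool.not-involutive (⁅ x ⁆ w))))
            where
            v-in : ∀ w → ⁅ v ⁆ w ∧ not (⁅ x ⁆ w) ≡ ⁅ v ⁆ w
            v-in w with v ≟ w
            ... | yes refl = p
            ... | no _     = refl

          at : ∀ b → act v ≡ b → σ ⁅ v ⁆ ⊕ (⊖ γ O ⁅ v ⁆) ≡ 0₃
          at true  av = trans (cong₂ (λ a b → a ⊕ (⊖ b)) (σ-five {v} (five v av x≢v) (uni v av x≢v))
                                (trans (γO ⁅ v ⁆) (cong (λ n → times n (val r)) (trans cntO (x-neighbour v av x≢v (five v av x≢v))))))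
                              (cancel r)
            where
            cancel : ∀ r → val r ⊕ (⊖ times 1 (val r)) ≡ 0₃
            cancel true  = refl
            cancel false = refl
          at false nv = cong₂ (λ a b → a ⊕ (⊖ b))
            (trans (σ-cong off) (cong₂ _⊕_ (chg-∅ cs) (chg-∅ (map tip-charge zs))))
            (trans (γ-cong (λ w q → off w (proj₁ (∧-true q))) (outer-On (Within-Reor s es-act))) (chg-∅ (map tip-charge O)))
            where
            off : ⁅ v ⁆ ≗[ act ] ∅
            off w aw = ⁅⁆-≢ (separate act aw nv ∘ sym)

        σ-rest : σ S ≡ times (e ⁅ x ⁆) (val r)
        σ-rest = trans (z3 2 (λ a b → (a ⊕ (⊖ b) , 0₃) ∷ [] , (a , b)) (σ S) (γ O S)
                          (trans (sym (chg-L S)) (chg-local L S local)))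
                   (trans (γO S) (cong (λ n → times n (val r)) leave))
          where
          leave : cnt O S ≡ e ⁅ x ⁆
          leave = trans (cnt-outer S os S) (trans (btw-Reor s (S ∩ S) (∁ S))
                    (trans (btw-ext es (λ w → Bool.∧-idem (S w)) (λ _ → refl))
                      (trans (sym (cut-btw∁ es S)) (cut-∁ es ⁅ x ⁆))))

      tip-elsewhere : ∃[ y ] ∃[ ys ] (x ≢ y × act y ≡ true × Pick (y , not r) zs ys × d ⁅ y ⁆ ≡ 5 × 1 ≤ k ⁅ y ⁆)
      tip-elsewhere =
        let y , s , ys , p , i = find-tip zs (∁ ⁅ x ⁆)
              (lin 5 (λ D dx e k k′ → (D :≡ # 1 :+ dx) ∷ (dx :≡ e :+ k) ∷ (k :+ k′ :≡ D) ∷ [] ⊢ # 1 :≤ k′)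
                 D (d ⁅ x ⁆) (e ⁅ x ⁆) (k ⁅ x ⁆) (k (∁ ⁅ x ⁆)) (center-deg ctr) refl (cnt-∁ zs ⁅ x ⁆))
        in found y s ys i (separate (∁ ⁅ x ⁆) p (cong not (self x)) ∘ sym)
        where
        found : ∀ y s ys → Pick (y , s) zs ys → x ≢ y →
                ∃[ y ] ∃[ ys ] (x ≢ y × act y ≡ true × Pick (y , not r) zs ys × d ⁅ y ⁆ ≡ 5 × 1 ≤ k ⁅ y ⁆)
        found y s ys i x≢y with s Bool.≟ r
        ... | yes refl with () ← trans (sym (proj₁ (uni y (proj₁ (Pick-All i zs-act)) x≢y))) (proj₂ (tip-fact i))
        ... | no ne with refl ← Bool.¬-not ne = y , ys , x≢y , ay , i , five (five-or-six y ay x≢y) ,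
                                subst (1 ≤_) (sym (trans (Pick-cnt i ⁅ y ⁆) (cong (λ b → ind b + cnt ys ⁅ y ⁆) (self y)))) (s≤s z≤n)
          where
          ay : act y ≡ true
          ay = proj₁ (Pick-All i zs-act)

          five : d ⁅ y ⁆ ≡ 5 ⊎ d ⁅ y ⁆ ≡ 6 → d ⁅ y ⁆ ≡ 5
          five (inj₁ eq) = eq
          five (inj₂ eq) = ⊥-elim (not-six y ys x≢y i eq)

      seven-⊥ : ⊥
      seven-⊥ with likes (d ⁅ x ⁆) (σ ⁅ x ⁆) r in lx
                 | tight-or-loose (d ⁅ x ⁆) (σ ⁅ x ⁆) (cond ⁅ x ⁆ (vertex-Proper x ax))
      ... | true  | _ =
        let y , _ , x≢y , ay , _ , d≡5 , 1≤k = tip-elsewhere in sink y ay x≢y d≡5 (inj₂ (1≤k , inj₁ lx))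
      ... | false | inj₂ loose =
        let y , _ , x≢y , ay , _ , d≡5 , 1≤k = tip-elsewhere in sink y ay x≢y d≡5 (inj₂ (1≤k , inj₂ loose))
      ... | false | inj₁ tx = all-five-⊥ five d≡6 (lx′ , subst (λ s → likes (d ⁅ x ⁆) (σ ⁅ x ⁆) s ≡ false) (sym (Bool.not-involutive r)) lx)
        where
        6≤dx : 6 ≤ d ⁅ x ⁆
        6≤dx = ≤-pred (≤-trans 7≤D (≤-reflexive (center-deg ctr)))

        τ≡2 : τ (d ⁅ x ⁆) (σ ⁅ x ⁆) ≡ 2
        τ≡2 with 3 ≤? τ (d ⁅ x ⁆) (σ ⁅ x ⁆)
        ... | yes h with () ← trans (sym (likes-max (d ⁅ x ⁆) (σ ⁅ x ⁆) r h)) lx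
        ... | no h  = ≤-antisym (≤-pred (≰⇒> h)) (+-cancelˡ-≤ 4 _ _ (≤-trans 6≤dx (≤-reflexive tx)))

        d≡6 : d ⁅ x ⁆ ≡ 6
        d≡6 = trans tx (cong (4 +_) τ≡2)

        D≡7 : D ≡ 7
        D≡7 = trans (center-deg ctr) (cong suc d≡6)

        lx′ : Likes x (not r)
        lx′ = let s , l = likes-some (d ⁅ x ⁆) (σ ⁅ x ⁆) (subst (1 ≤_) (sym τ≡2) (s≤s z≤n))
              in likes-other x r s l lx

        -- A vertex of degree 6 = D - 1 would also be a centre, and `center-uniform` would then make
        -- `x` like `r`.
        five : ∀ v → act v ≡ true → x ≢ v → d ⁅ v ⁆ ≡ 5
        five v av x≢v with five-or-six v av x≢v
        ... | inj₁ eq  = eq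
        ... | inj₂ d≡6 =
          let r′ , u = center-uniform v-center
              w , w≢x , w≢v , aw = third x v x≢v ax av
          in differ (only-unique w (uni w aw (w≢x ∘ sym)) (u w aw (w≢v ∘ sym))) (u x ax (x≢v ∘ sym))
          where
          differ : ∀ {r′} → r ≡ r′ → Only x r′ → d ⁅ v ⁆ ≡ 5
          differ refl (l , _) with () ← trans (sym l) lx

          v-center : Center act es zs v
          v-center = av , λ A pr p → subst (_≤ suc (d A)) (sym D≡7) (s≤s (at-least A (sing-or-NT A v pr av p)))
            where
            at-least : ∀ A → NT A ⊎ A ≗[ act ] ⁅ v ⁆ → 6 ≤ d A
            at-least A (inj₁ nt) = ≤-trans (m≤n+m 6 2) (big A nt)
            at-least A (inj₂ eq) = ≤-reflexive (sym (trans (d-cong eq) d≡6))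

    minimal-⊥ : ⊥
    minimal-⊥ with mode
    ... | inj₁ small = small-⊥ small
    ... | inj₂ (x , ctr) with D ≤? 5
    ...   | yes D≤5 = small-⊥ (≤5⇒small D Γ D≤5)
    ...   | no D≰5 with D ℕ.≟ 6
    ...     | yes D≡6 = six-⊥ ctr D≡6
    ...     | no D≢6  =
      let r , u = center-uniform ctr
      in Seven.seven-⊥ ctr (≤∧≢⇒< (≰⇒> D≰5) (D≢6 ∘ sym)) u

  -- The induction

  solve : ∀ n K → μ K < n → Flow (Canvas.es K) (Canvas.cs K)
  solve (suc n) K h with flow? (Canvas.es K) (Canvas.cs K)
  ... | yes f = f
  ... | no ¬f = ⊥-elim (Step.minimal-⊥ K (λ K′ lt → solve n K′ (≤-trans lt (≤-pred h))) ¬f)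

  canvas-flow : ∀ K → Flow (Canvas.es K) (Canvas.cs K)
  canvas-flow K = solve (suc (μ K)) K ≤-refl

  -- Indexed families of edges

  edge-list : ∀ m → (Fin m → Edge) → List Edge
  edge-list zero    ends = []
  edge-list (suc m) ends = ends zero ∷ edge-list m (ends ∘ suc)

  orient : Bool → Edge → Edge
  orient true  (u , w) = u , w
  orient false (u , w) = w , u

  directed : ∀ m → (Fin m → Edge) → (Fin m → Bool) → List Edge
  directed m ends o = edge-list m (λ i → orient (o i) (ends i))

  Reor-directed : ∀ m ends o → Reor (directed m ends o) (edge-list m ends)
  Reor-directed zero    ends o = []
  Reor-directed (suc m) ends o with o zero
  ... | true  = same (Reor-directed m (ends ∘ suc) (o ∘ suc))
  ... | false = flip (Reor-directed m (ends ∘ suc) (o ∘ suc))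

  orient-not : ∀ b e {u w} → orient b e ≡ (u , w) → orient (not b) e ≡ (w , u)
  orient-not true  e refl = refl
  orient-not false e refl = refl

  -- Positions in the list are indices of edges, so an orientation as a function can be read back
  -- from a reoriented list.
  Turns-directed : ∀ {S} m ends ψ {ks} → Turns S ks (directed m ends ψ) →
    ∃[ o ] (directed m ends o ≡ ks × (∀ i → S (proj₁ (ends i)) ∧ S (proj₂ (ends i)) ≡ false → o i ≡ ψ i))
  Turns-directed zero ends ψ [] = ψ , refl , λ ()
  Turns-directed {S} (suc m) ends ψ t = go t refl
    where
    go : ∀ {ks os} → Turns S ks os → os ≡ directed (suc m) ends ψ →
         ∃[ o ] (directed (suc m) ends o ≡ ks × (∀ i → S (proj₁ (ends i)) ∧ S (proj₂ (ends i)) ≡ false → o i ≡ ψ i))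
    go (stay t) refl with o , eq , agree ← Turns-directed m (ends ∘ suc) (ψ ∘ suc) t =
      (λ { zero → ψ zero ; (suc i) → o i }) , cong (_ ∷_) eq , λ { zero _ → refl ; (suc i) h → agree i h }
    go (turn su sw t) eq₀ with orient (ψ zero) (ends zero) in eq₁
    go (turn su sw t) refl | u , w with o , eq , agree ← Turns-directed m (ends ∘ suc) (ψ ∘ suc) t =
      (λ { zero → not (ψ zero) ; (suc i) → o i }) , cong₂ _∷_ (orient-not (ψ zero) (ends zero) eq₁) eq ,
      λ { zero h → ⊥-elim (clash (ψ zero) (ends zero) eq₁ h) ; (suc i) h → agree i h }
      where
      clash : ∀ b e → orient b e ≡ (u , w) → S (proj₁ e) ∧ S (proj₂ e) ≡ false → ⊥
      clash true  _ refl h with () ← trans (sym h) (cong₂ _∧_ su sw)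
      clash false _ refl h with () ← trans (sym h) (cong₂ _∧_ sw su)

  ι : ℕ → Z3
  ι zero    = 0₃
  ι (suc n) = 1₃ ⊕ ι n

  ι-+ : ∀ a b → ι (a + b) ≡ ι a ⊕ ι b
  ι-+ zero    b = refl
  ι-+ (suc a) b rewrite ι-+ a b = z3 2 (λ x y → [] , (1₃ ⊕ (x ⊕ y) , 1₃ ⊕ x ⊕ y)) (ι a) (ι b)

  ι-2* : ∀ a → ι (2 * a) ≡ ι a ⊕ ι a
  ι-2* a rewrite +-identityʳ a = ι-+ a a

  ι-toℕ : ∀ c → ι (toℕ c) ≡ c
  ι-toℕ = from-yes (all? λ c → ι (toℕ c) ≟ c)

  toℕ-ι : ∀ n → toℕ (ι n) ≡ n % 3
  toℕ-ι zero    = refl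
  toℕ-ι (suc n) = trans (lem (ι n)) (trans (cong (λ r → (1 + r) % 3) (toℕ-ι n)) (sym (step n)))
    where
    lem : ∀ c → toℕ (1₃ ⊕ c) ≡ (1 + toℕ c) % 3
    lem = from-yes (all? λ c → toℕ (1₃ ⊕ c) ℕ.≟ (1 + toℕ c) % 3)

    step : ∀ n → suc n % 3 ≡ (1 + n % 3) % 3
    step n = %-distribˡ-+ 1 n 3

  ind-odd : ∀ n → n % 2 ≡ ind (odd n)
  ind-odd zero          = refl
  ind-odd (suc zero)    = refl
  ind-odd (suc (suc n)) = trans ([m+n]%n≡m%n′ n) (trans (ind-odd n) (cong ind (sym (Bool.not-involutive (odd n)))))
    where
    [m+n]%n≡m%n′ : ∀ n → (2 + n) % 2 ≡ n % 2
    [m+n]%n≡m%n′ n = trans (cong (_% 2) (+-comm 2 n)) ([m+n]%n≡m%n n 2)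

-- Translation of the statement

open import Defs hiding (Z3)

≟ᵇ-does : ∀ {k} (u v : Fin k) → (u ≟ᵇ v) ≡ does (v ≟ u)
≟ᵇ-does zero    zero    = refl
≟ᵇ-does zero    (suc v) = refl
≟ᵇ-does (suc u) zero    = refl
≟ᵇ-does (suc u) (suc v) = ≟ᵇ-does u v

if-ind : ∀ b → (if b then 1 else 0) ≡ ind b
if-ind true  = refl
if-ind false = refl

sumFin-cong : ∀ k {f g : Fin k → ℕ} → (∀ i → f i ≡ g i) → sumFin k f ≡ sumFin k g
sumFin-cong zero    eq = refl
sumFin-cong (suc k) eq = cong₂ _+_ (eq zero) (sumFin-cong k (eq ∘ suc))

count-cong : ∀ k {p q : Fin k → Bool} → (∀ i → p i ≡ q i) → count k p ≡ count k q
count-cong k eq = sumFin-cong k λ i → cong (if_then 1 else 0) (eq i)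

count-none : ∀ k {p : Fin k → Bool} → (∀ i → p i ≡ false) → count k p ≡ 0
count-none zero    h = refl
count-none (suc k) h rewrite h zero = count-none k (h ∘ suc)

module Translate (G : Graph) (β : V G → Z3) where

  open Canvases (n G)

  edges : List Edge
  edges = edge-list (m G) (ends G)

  demands : List Charge
  demands = tabulateₗ λ v → v , β v

  count-cut : ∀ k (es : Fin k → Edge) A →
              count k (λ i → A (proj₁ (es i)) xor A (proj₂ (es i))) ≡ cut (edge-list k es) A
  count-cut zero    es A = refl
  count-cut (suc k) es A = cong₂ _+_ (if-ind _) (count-cut k (es ∘ suc) A)

  chg-tabulate : ∀ k (f : Fin k → Charge) A →
    chg (tabulateₗ f) A ≡ ι (sumFin k (λ i → if A (proj₁ (f i)) then toℕ (proj₂ (f i)) else 0))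
  chg-tabulate zero    f A = refl
  chg-tabulate (suc k) f A =
    trans (cong₂ _⊕_ (head (A (proj₁ (f zero)))) (chg-tabulate k (f ∘ suc) A)) (sym (ι-+ (if A (proj₁ (f zero)) then _ else 0) _))
    where
    head : ∀ b → sel b (proj₂ (f zero)) ≡ ι (if b then toℕ (proj₂ (f zero)) else 0)
    head true  = sym (ι-toℕ _)
    head false = refl

  single-sum : ∀ k (v : Fin k) (f : Fin k → Z3) →
    ι (sumFin k (λ i → if does (v ≟ i) then toℕ (f i) else 0)) ≡ f v
  single-sum (suc k) zero    f = trans (cong ι (trans (cong (toℕ (f zero) +_) (nothing k)) (+-identityʳ _))) (ι-toℕ (f zero))
    where
    nothing : ∀ k → sumFin k (λ i → 0) ≡ 0
    nothing zero    = refl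
    nothing (suc k) = nothing k
  single-sum (suc k) (suc v) f = single-sum k v (f ∘ suc)

  demand-single : ∀ v → chg demands ⁅ v ⁆ ≡ β v
  demand-single v = trans (chg-tabulate (n G) (λ v → v , β v) ⁅ v ⁆) (single-sum (n G) v β)

  subset : VSet → Subset (n G)
  subset A = tabulate A

  subset-∈ : ∀ A {v} → v ∈ subset A → A v ≡ true
  subset-∈ A {v} p = trans (sym (lookup∘tabulate A v)) ([]=⇒lookup p)

  ∈-subset : ∀ A {v} → A v ≡ true → v ∈ subset A
  ∈-subset A {v} p = lookup⇒[]= v (subset A) (trans (lookup∘tabulate A v) p)

  ∉-subset : ∀ A {v} → A v ≡ false → v ∉ subset A
  ∉-subset A p q with () ← trans (sym (subset-∈ A q)) p

  deg-subset : ∀ A → deg G (subset A) ≡ cut edges A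
  deg-subset A = trans (count-cong (m G) λ i → cong₂ _xor_ (lookup∘tabulate A _) (lookup∘tabulate A _))
                       (count-cut (m G) (ends G) A)

  βsum-subset : ∀ A → ι (βsum G β (subset A)) ≡ chg demands A
  βsum-subset A = trans (cong ι (sumFin-cong (n G) λ v → cong (if_then toℕ (β v) else 0) (lookup∘tabulate A v)))
                        (sym (chg-tabulate (n G) (λ v → v , β v) A))

  tauAbs-τ : ∀ A → tauAbs G β A ≡ τ (deg G A) (ι (βsum G β A))
  tauAbs-τ A with deg G A % 2 | ind-odd (deg G A) | βsum G β A % 3 | toℕ-ι (βsum G β A)
  ... | _ | refl | _ | refl with odd (deg G A) | ι (βsum G β A)
  ...   | false | 0₃    = refl
  ...   | false | suc _ = refl
  ...   | true  | 0₃    = refl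
  ...   | true  | suc _ = refl

  tauAbs-subset : ∀ A → tauAbs G β (subset A) ≡ τ (cut edges A) (chg demands A)
  tauAbs-subset A = trans (tauAbs-τ (subset A)) (cong₂ τ (deg-subset A) (βsum-subset A))

  ends-count : ∀ p q c → sel p 1₃ ⊕ (sel q 2₃ ⊕ c) ≡
    ι (if p then 1 else 0) ⊕ (ι (if q then 1 else 0) ⊕ ι (if q then 1 else 0) ⊕ c)
  ends-count = bool 2 λ p q → _ , all? λ c →
    (sel p 1₃ ⊕ (sel q 2₃ ⊕ c) ≟ ι (if p then 1 else 0) ⊕ (ι (if q then 1 else 0) ⊕ ι (if q then 1 else 0) ⊕ c))

  net-count : ∀ k (es : Fin k → Edge) o v →
    ∂ (directed k es o) ⁅ v ⁆ ≡
    ι (count k (λ i → if o i then proj₁ (es i) ≟ᵇ v else proj₂ (es i) ≟ᵇ v) +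
       2 * count k (λ i → if o i then proj₂ (es i) ≟ᵇ v else proj₁ (es i) ≟ᵇ v))
  net-count zero    es o v = refl
  net-count (suc k) es o v =
    trans (head (o zero) (es zero) (∂ (directed k (es ∘ suc) (o ∘ suc)) ⁅ v ⁆))
      (trans (cong (λ c → ι t₀ ⊕ (ι h₀ ⊕ ι h₀ ⊕ c))
                (trans (net-count k (es ∘ suc) (o ∘ suc) v) (trans (ι-+ ts (2 * hs)) (cong (ι ts ⊕_) (ι-2* hs)))))
        (sym (trans (ι-+ (t₀ + ts) (2 * (h₀ + hs)))
          (trans (cong₂ _⊕_ (ι-+ t₀ ts) (trans (ι-2* (h₀ + hs)) (cong₂ _⊕_ (ι-+ h₀ hs) (ι-+ h₀ hs))))
            (z3 4 (λ a b c d → [] , (a ⊕ b ⊕ (c ⊕ d ⊕ (c ⊕ d)) , a ⊕ (c ⊕ c ⊕ (b ⊕ (d ⊕ d))))) (ι t₀) (ι ts) (ι h₀) (ι hs))))))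
    where
    t₀ ts h₀ hs : ℕ
    t₀ = if (if o zero then proj₁ (es zero) ≟ᵇ v else proj₂ (es zero) ≟ᵇ v) then 1 else 0
    h₀ = if (if o zero then proj₂ (es zero) ≟ᵇ v else proj₁ (es zero) ≟ᵇ v) then 1 else 0
    ts = count k (λ i → if o (suc i) then proj₁ (es (suc i)) ≟ᵇ v else proj₂ (es (suc i)) ≟ᵇ v)
    hs = count k (λ i → if o (suc i) then proj₂ (es (suc i)) ≟ᵇ v else proj₁ (es (suc i)) ≟ᵇ v)

    head : ∀ b e c → sel (⁅ v ⁆ (proj₁ (orient b e))) 1₃ ⊕ (sel (⁅ v ⁆ (proj₂ (orient b e))) 2₃ ⊕ c) ≡
           ι (if (if b then proj₁ e ≟ᵇ v else proj₂ e ≟ᵇ v) then 1 else 0) ⊕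
           (ι (if (if b then proj₂ e ≟ᵇ v else proj₁ e ≟ᵇ v) then 1 else 0) ⊕
            ι (if (if b then proj₂ e ≟ᵇ v else proj₁ e ≟ᵇ v) then 1 else 0) ⊕ c)
    head true  (u , w) c rewrite ≟ᵇ-does u v | ≟ᵇ-does w v = ends-count (⁅ v ⁆ u) (⁅ v ⁆ w) c
    head false (u , w) c rewrite ≟ᵇ-does u v | ≟ᵇ-does w v = ends-count (⁅ v ⁆ w) (⁅ v ⁆ u) c

  -- Components

  Connected-trans : ∀ {u v w} → Connected G u v → Connected G v w → Connected G u w
  Connected-trans here         q = q
  Connected-trans (step e x p) q = step e x (Connected-trans p q)

  Connected-sym : ∀ {u v} → Connected G u v → Connected G v u
  Connected-sym here         = here
  Connected-sym (step e x p) = Connected-trans (Connected-sym p) (step e (swap x) here)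
    where
    swap : ∀ {A B C D : Set} → (A × B) ⊎ (C × D) → (D × C) ⊎ (B × A)
    swap (inj₁ (a , b)) = inj₂ (b , a)
    swap (inj₂ (c , d)) = inj₁ (d , c)

  -- A connected set is enlarged along a crossing edge until no edge crosses; the size of its
  -- complement bounds the number of steps.
  component : ∀ f x C → C x ≡ true → (∀ u → C u ≡ true → Connected G x u) → size (∁ C) < f →
              ∃[ C′ ] (C′ x ≡ true × deg G (subset C′) ≡ 0 × (∀ u → C′ u ≡ true → Connected G x u))
  component (suc f) x C cx conn h
    with any? (λ i → C (proj₁ (ends G i)) xor C (proj₂ (ends G i)) Bool.≟ true)
  ... | no none = C , cx , trans (deg-subset C) (trans (sym (count-cut (m G) (ends G) C))
                    (count-none (m G) λ i → Bool.¬-not λ p → none (i , p))) , conn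
  ... | yes (i , crosses) = extend i (C (proj₁ (ends G i))) (C (proj₂ (ends G i))) refl refl crosses
    where
    grow : ∀ w → C w ≡ false → Connected G x w →
          ∃[ C′ ] (C′ x ≡ true × deg G (subset C′) ≡ 0 × (∀ u → C′ u ≡ true → Connected G x u))
    grow w cw q = component f x (C ∪ ⁅ w ⁆) (cong (_∨ ⁅ w ⁆ x) cx) conn′
      (≤-trans (size-< (∁ (C ∪ ⁅ w ⁆)) (∁ C) shrink w (cong not cw)
                  (cong not (trans (cong (C w ∨_) (self w)) (Bool.∨-zeroʳ (C w))))) (≤-pred h))
      where
      conn′ : ∀ u → C u ∨ ⁅ w ⁆ u ≡ true → Connected G x u
      conn′ u p with C u in cu
      ... | true  = conn u cu
      ... | false = subst (Connected G x) (⁅⁆-≡ {w} p) q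

      shrink : ∀ v → not (C v ∨ ⁅ w ⁆ v) ≡ true → not (C v) ≡ true
      shrink v = bool 2 (λ a b → _ , ((not (a ∨ b) Bool.≟ true) →-dec (not a Bool.≟ true))) (C v) (⁅ w ⁆ v)

    extend : ∀ i a b → C (proj₁ (ends G i)) ≡ a → C (proj₂ (ends G i)) ≡ b →
             C (proj₁ (ends G i)) xor C (proj₂ (ends G i)) ≡ true →
             ∃[ C′ ] (C′ x ≡ true × deg G (subset C′) ≡ 0 × (∀ u → C′ u ≡ true → Connected G x u))
    extend i true  false p q _ = grow _ q (Connected-trans (conn _ p) (step i (inj₁ (refl , refl)) here))
    extend i false true  p q _ = grow _ p (Connected-trans (conn _ q) (step i (inj₂ (refl , refl)) here))
    extend i true  true  p q r with () ← trans (sym r) (cong₂ _xor_ p q)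
    extend i false false p q r with () ← trans (sym r) (cong₂ _xor_ p q)

  component-demand : IsBoundary G β → ∀ C x → C x ≡ true → deg G (subset C) ≡ 0 →
                     (∀ u → C u ≡ true → Connected G x u) → chg demands C ≡ 0₃
  component-demand bd C x cx deg≡0 conn = trans (sym (βsum-subset C)) (toℕ-injective
    (trans (toℕ-ι (βsum G β (subset C))) (bd (subset C) ((x , ∈-subset C cx) , deg≡0 , λ u v p q →
      Connected-trans (Connected-sym (conn u (subset-∈ C p))) (conn v (subset-∈ C q))))))

  Conditions : V G → Set
  Conditions z = ∀ (A : Subset (n G)) → z ∉ A → (∃[ v ] v ∈ A) → (∃[ w ] (w ≢ z × w ∉ A)) →
                 4 + tauAbs G β A ≤ deg G A

  -- A canvas needs demands with total zero, whereas `β` sums to zero on components. A non-empty set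
  -- avoiding `z` that no edge leaves violates the degree condition unless it is everything but `z`.
  -- So the component of `x` is everything, or everything but an isolated `z`.
  component-total : IsBoundary G β → ∀ z → Conditions z → ∀ x → x ≢ z → ∀ C → C x ≡ true → deg G (subset C) ≡ 0 →
                    (∀ u → C u ≡ true → Connected G x u) → chg demands full ≡ 0₃
  component-total bd z conds x x≢z C cx deg≡0 conn with C z in cz
  ... | true = trans (chg-ext demands everything) (component-demand bd C x cx deg≡0 conn)
    where
    everything : ∀ v → true ≡ C v
    everything v with C v in cv
    ... | true  = refl
    ... | false with () ← subst (4 ≤_) (trans (deg-subset (∁ C)) (trans (cut-∁ edges C) (trans (sym (deg-subset C)) deg≡0)))
                          (≤-trans (m≤m+n 4 _) (conds (subset (∁ C)) (∉-subset (∁ C) (cong not cz))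
                            (v , ∈-subset (∁ C) (cong not cv)) (x , x≢z , ∉-subset (∁ C) (cong not cx))))
  ... | false = trans (sym (chg-∁ demands ⁅ z ⁆)) (cong₂ _⊕_
      (component-demand bd ⁅ z ⁆ z (self z) deg-z λ u p → subst (Connected G z) (⁅⁆-≡ {z} p) here)
      (trans (chg-ext demands (λ v → sym (rest v))) (component-demand bd C x cx deg≡0 conn)))
    where
    rest : ∀ v → C v ≡ not (⁅ z ⁆ v)
    rest v with z ≟ v
    ... | yes refl = cz
    ... | no z≢v with C v in cv
    ...   | true  = refl
    ...   | false with () ← subst (4 ≤_) deg≡0 (≤-trans (m≤m+n 4 _) (conds (subset C) (∉-subset C cz)
                              (x , ∈-subset C cx) (v , z≢v ∘ sym , ∉-subset C cv)))

    deg-z : deg G (subset ⁅ z ⁆) ≡ 0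
    deg-z = trans (deg-subset ⁅ z ⁆) (trans (sym (cut-∁ edges ⁅ z ⁆)) (trans (cut-ext edges (λ v → sym (rest v)))
              (trans (sym (deg-subset C)) deg≡0)))

  total-demand : IsBoundary G β → ∀ z → Conditions z → ∀ x → x ≢ z → chg demands full ≡ 0₃
  total-demand bd z conds x x≢z =
    let C , cx , deg≡0 , conn = component (suc (size (∁ ⁅ x ⁆))) x ⁅ x ⁆ (self x)
                                  (λ u p → subst (Connected G x) (⁅⁆-≡ {x} p) here) ≤-refl
    in component-total bd z conds x x≢z C cx deg≡0 conn

  -- Counting with `∨` and with `xor` differs on loops only.
  degV-cut : ∀ z → degV G z ≡ cut edges ⁅ z ⁆
  degV-cut z = trans (count-cong (m G) λ i → trans
      (cong₂ _∨_ (≟ᵇ-does (proj₁ (ends G i)) z) (≟ᵇ-does (proj₂ (ends G i)) z))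
      (not-both (proj₁ (ends G i)) (proj₂ (ends G i)) (loopless G i)))
    (count-cut (m G) (ends G) ⁅ z ⁆)
    where
    not-both : ∀ u w → u ≢ w → ⁅ z ⁆ u ∨ ⁅ z ⁆ w ≡ ⁅ z ⁆ u xor ⁅ z ⁆ w
    not-both u w u≢w with z ≟ u | z ≟ w
    ... | yes refl | yes refl = ⊥-elim (u≢w refl)
    ... | yes _    | no _     = refl
    ... | no _     | yes _    = refl
    ... | no _     | no _     = refl

  FlowAt⇒ : ∀ o v → FlowAt G β o v → ∂ (directed (m G) (ends G) o) ⁅ v ⁆ ≡ β v
  FlowAt⇒ o v h = trans (net-count (m G) (ends G) o v) (toℕ-injective (trans (toℕ-ι (outdeg G o v + 2 * indeg G o v)) h))

  FlowAt⇐ : ∀ o v → ∂ (directed (m G) (ends G) o) ⁅ v ⁆ ≡ β v → FlowAt G β o v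
  FlowAt⇐ o v h = trans (sym (toℕ-ι (outdeg G o v + 2 * indeg G o v))) (cong toℕ (trans (sym (net-count (m G) (ends G) o v)) h))

  -- The given canvas with its tip deleted

  module AtTip (bd : IsBoundary G β) (z : V G) (conds : Conditions z)
               (x : V G) (x≢z : x ≢ z)
               (center : ∀ (X : Subset (n G)) → z ∉ X → x ∈ X → deg G X + 2 > degV G z)
               (ψ : Orientation G) (tip : IsTipPreflow G β z ψ) where

    S : VSet
    S = ∁ ⁅ z ⁆

    os : List Edge
    os = directed (m G) (ends G) ψ

    out : ∀ A → ∂ os (A ∩ ∁ S) ≡ chg demands (A ∩ ∁ S)
    out = demand-at os demands z (trans (FlowAt⇒ ψ z tip) (sym (demand-single z)))

    everywhere : Within full os
    everywhere = go os
      where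
      go : ∀ es → Within full es
      go []       = []
      go (_ ∷ es) = (refl , refl) ∷ go es

    demands-full : On full demands
    demands-full = go demands
      where
      go : ∀ cs → On full cs
      go []       = []
      go (_ ∷ cs) = refl ∷ go cs

    deg-os : ∀ A → deg′ (inner S os) (outer S os) A ≡ deg G (subset (A ∩ S))
    deg-os A = trans (cut-inner S os A) (trans (cut-Reor (Reor-directed (m G) (ends G) ψ) (A ∩ S)) (sym (deg-subset (A ∩ S))))

    length-tips : length (outer S os) ≡ degV G z
    length-tips = trans (sym (cnt-full (outer S os))) (trans (cong (_+ cnt (outer S os) full) (sym (cut-full (inner S os))))
      (trans (cut-inner S os full) (trans (cut-Reor (Reor-directed (m G) (ends G) ψ) S)
        (trans (cut-∁ edges ⁅ z ⁆) (sym (degV-cut z))))))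

    away : ∀ {v} → S v ≡ true → v ≢ z
    away p refl with () ← trans (sym p) (cong not (self z))

    z∉ : ∀ A → z ∉ subset (A ∩ S)
    z∉ A = ∉-subset (A ∩ S) (trans (cong (λ b → A z ∧ not b) (self z)) (Bool.∧-zeroʳ (A z)))

    K : Canvas
    K = canvas S (inner S os) (outer S os) (inner-charges S os demands)
          (inner-Within everywhere) (outer-On everywhere) (inner-charges-On everywhere demands-full)
          (inner-total S os demands out (total-demand bd z conds x x≢z)) cond′ (inj₂ (x , x∈S , center′))
      where
      x∈S : S x ≡ true
      x∈S = cong not (⁅⁆-≢ (x≢z ∘ sym))

      cond′ : Cond S (inner S os) (outer S os) (inner-charges S os demands)
      cond′ A ((u , su , au) , (w , sw , aw)) =
        subst₂ (λ t n → 4 + t ≤ n)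
          (trans (tauAbs-subset (A ∩ S)) (cong₂ τ (trans (sym (deg-subset (A ∩ S))) (sym (deg-os A))) (sym (chg-inner S os demands A))))
          (sym (deg-os A))
          (conds (subset (A ∩ S)) (z∉ A) (u , ∈-subset (A ∩ S) (cong₂ _∧_ au su))
             (w , away sw , ∉-subset (A ∩ S) (cong (_∧ S w) aw)))

      center′ : ∀ A → Proper S A → A x ≡ true → length (outer S os) ≤ suc (deg′ (inner S os) (outer S os) A)
      center′ A _ ax = lin 3 (λ l n n′ → (# 1 :+ l :≤ n :+ # 2) ∷ (n′ :≡ n) ∷ [] ⊢ l :≤ # 1 :+ n′)
        (length (outer S os)) (deg G (subset (A ∩ S))) (deg′ (inner S os) (outer S os) A)
        (subst (λ l → suc l ≤ deg G (subset (A ∩ S)) + 2) (sym length-tips)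
               (center (subset (A ∩ S)) (z∉ A) (∈-subset (A ∩ S) (cong₂ _∧_ ax x∈S))))
        (deg-os A)

    extends : Extends G β z ψ
    extends =
      -- Only edges inside `S` are turned, and no edge incident with `z` lies inside `S`.
      let ks , t , eq = solve-inner S os demands out (canvas-flow K)
          o , same-edges , agree = Turns-directed (m G) (ends G) ψ t
      in o , (λ v → FlowAt⇐ o v (trans (cong (λ es → ∂ es ⁅ v ⁆) same-edges) (trans (eq ⁅ v ⁆) (demand-single v)))) ,
         λ i inc → agree i (at-z i inc)
      where
      at-z : ∀ i → incidentᵇ G z i ≡ true → S (proj₁ (ends G i)) ∧ S (proj₂ (ends G i)) ≡ false
      at-z i inc = bool 2 (λ a b → _ , ((a ∨ b Bool.≟ true) →-dec (not a ∧ not b Bool.≟ false)))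
        (⁅ z ⁆ (proj₁ (ends G i))) (⁅ z ⁆ (proj₂ (ends G i)))
        (trans (sym (cong₂ _∨_ (≟ᵇ-does (proj₁ (ends G i)) z) (≟ᵇ-does (proj₂ (ends G i)) z))) inc)

mainTheorem3 : (G : Graph) (β : V G → Z3) → IsBoundary G β → (z : V G) →
    (∀ (A : Subset (n G)) → z ∉ A → (∃[ v ] v ∈ A) →
    (∃[ w ] (w ≢ z × w ∉ A)) →
    4 + tauAbs G β A ≤ deg G A) →
    (∃[ x ] (x ≢ z × (∀ (X : Subset (n G)) → z ∉ X → x ∈ X →
    deg G X + 2 > degV G z))) →
    ∀ (ψ : Orientation G) → IsTipPreflow G β z ψ → Extends G β z ψ
mainTheorem3 G β bd z conds (x , x≢z , center) ψ tip =
  Translate.AtTip.extends G β bd z conds x x≢z center ψ tip
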